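{- Let $d\ge1$, $r_1,\dots,r_d\in\mathbb{Z}$, and let $(U_n)_{n\ge0}$ be a sequence of integers with $U_n=r_1U_{n-1}+\cdots+r_dU_{n-d}$ for all $n\ge d$. Suppose the characteristic polynomial $C(x)=x^d-r_1x^{d-1}-\cdots-r_d$ is irreducible over $\mathbb{F}_p$ for infinitely many primes $p$. Let $\alpha_0,\dots,\alpha_{d-1}$ be the roots of $C$ and $l_0,\dots,l_{d-1}$ the constants with $U_n=\sum_{i=0}^{d-1}l_i\alpha_i^n$ for all $n\ge0$. Then $(U_n)_{n\ge1}$ almost satisfies the Dold condition if and only if $l_0=l_1=\cdots=l_{d-1}$.
   Context: A sequence of integers $(A_n)_{n\ge1}$ satisfies the Dold condition if $n\mid\sum_{d\mid n}\mu(d)A_{n/d}$ for every $n\in\mathbb{N}_+$ ($\mu$ the Möbius function). It almost satisfies the Dold condition if there is $c\in\mathbb{N}_+$ such that $(cA_n)_{n\ge1}$ satisfies the Dold condition. -}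

module Defs where

open import Level using (Level; _⊔_) renaming (suc to lsuc)
open import Data.Nat as ℕ using (ℕ; zero; suc; _≤_; _<_; NonZero)
open import Data.Nat.Divisibility using (_∣?_)
open import Data.Nat.DivMod using (_/_)
open import Data.Nat.Primality using (prime?)
open import Data.Integer as ℤ using (ℤ; +_; -[1+_])
open import Data.Integer.Divisibility renaming (_∣_ to _∣ℤ_)
open import Data.Fin using (Fin)
open import Data.List using (List; []; _∷_; map; reverse; allFin; upTo; filter; length)
open import Data.Bool.ListAction using (any)
open import Data.Product using (Σ; ∃; _×_; _,_)
open import Data.Sum using (_⊎_)
open import Data.Bool using (Bool; true; false; if_then_else_)
open import Relation.Nullary using (¬_; does)
open import Relation.Nullary.Decidable using (_×-dec_)
open import Algebra.Bundles using (CommutativeRing)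

sumFinℤ : ∀ {d} → (Fin d → ℤ) → ℤ
sumFinℤ {zero}  f = + 0
sumFinℤ {suc d} f = f Data.Fin.zero ℤ.+ sumFinℤ (λ i → f (Data.Fin.suc i))

-- Möbius function:  μ(n) = 0 if p² ∣ n for some prime p,
-- otherwise (-1)^(number of distinct prime divisors of n).  (μ(0) := 0, unused.)

candidates : ℕ → List ℕ
candidates n = map (λ k → suc (suc k)) (upTo n)

primeDivisors : ℕ → List ℕ
primeDivisors n = filter (λ p → prime? p ×-dec (p ∣? n)) (candidates n)

hasSquareFactor : ℕ → Bool
hasSquareFactor n = any (λ p → does ((p ℕ.* p) ∣? n)) (primeDivisors n)

signPow : ℕ → ℤ
signPow zero    = + 1
signPow (suc k) = ℤ.- signPow k

μ : ℕ → ℤ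
μ zero = + 0
μ n@(suc _) = if hasSquareFactor n then + 0 else signPow (length (primeDivisors n))

-- Dold condition for a sequence A (only the values A 1, A 2, … matter):
--   n ∣ Σ_{k ∣ n} μ(k) A(n/k)   for every n ≥ 1.

doldSum : (ℕ → ℤ) → ℕ → ℤ
doldSum A n = go n
  where
  go : ℕ → ℤ
  go zero    = + 0
  go (suc j) = (if does (suc j ∣? n) then μ (suc j) ℤ.* A (n / suc j) else + 0) ℤ.+ go j

Dold : (ℕ → ℤ) → Set
Dold A = ∀ n → NonZero n → (+ n) ∣ℤ doldSum A n

AlmostDold : (ℕ → ℤ) → Set
AlmostDold A = Σ ℕ λ c → 1 ≤ c × Dold (λ n → + c ℤ.* A n)

-- Linear recurrence  U n = r₁ U(n-1) + … + r_d U(n-d)  for n ≥ d,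
-- with r (i) standing for r_{i+1}.

Recurrence : (d : ℕ) → (Fin d → ℤ) → (ℕ → ℤ) → Set
Recurrence d r U = ∀ n → d ≤ n →
  U n ≡ sumFinℤ (λ i → r i ℤ.* U (n ℕ.∸ suc (Data.Fin.toℕ i)))
  where open import Relation.Binary.PropositionalEquality using (_≡_)

-- Integer polynomials as ascending coefficient lists; reduction mod p.

polyAdd : List ℤ → List ℤ → List ℤ
polyAdd []       g        = g
polyAdd (a ∷ f)  []       = a ∷ f
polyAdd (a ∷ f)  (b ∷ g)  = (a ℤ.+ b) ∷ polyAdd f g

polyMul : List ℤ → List ℤ → List ℤ
polyMul []      g = []
polyMul (a ∷ f) g = polyAdd (map (a ℤ.*_) g) (+ 0 ∷ polyMul f g)

coeff : List ℤ → ℕ → ℤ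
coeff []      k       = + 0
coeff (a ∷ f) zero    = a
coeff (a ∷ f) (suc k) = coeff f k

charPoly : (d : ℕ) → (Fin d → ℤ) → List ℤ
charPoly d r = reverse (+ 1 ∷ map (λ i → ℤ.- r i) (allFin d))

CongPoly : ℕ → List ℤ → List ℤ → Set
CongPoly p f g = ∀ k → (+ p) ∣ℤ (coeff f k ℤ.- coeff g k)

IsUnitModP : ℕ → List ℤ → Set
IsUnitModP p f = ¬ ((+ p) ∣ℤ coeff f 0) × (∀ k → 0 < k → (+ p) ∣ℤ coeff f k)

IrreducibleModP : ℕ → List ℤ → Set
IrreducibleModP p f =
  ¬ CongPoly p f [] × ¬ IsUnitModP p f ×
  (∀ g h → CongPoly p f (polyMul g h) → IsUnitModP p g ⊎ IsUnitModP p h)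

record Field c ℓ : Set (lsuc (c ⊔ ℓ)) where
  field
    commutativeRing : CommutativeRing c ℓ
  open CommutativeRing commutativeRing public
  field
    1≉0     : ¬ (1# ≈ 0#)
    inverse : ∀ x → ¬ (x ≈ 0#) → Σ Carrier λ y → x * y ≈ 1#

module FieldOps {c ℓ} (K : Field c ℓ) where
  open Field K

  fromℕ : ℕ → Carrier
  fromℕ zero    = 0#
  fromℕ (suc n) = 1# + fromℕ n

  fromℤ : ℤ → Carrier
  fromℤ (+ n)    = fromℕ n
  fromℤ -[1+ n ] = - fromℕ (suc n)

  _^_ : Carrier → ℕ → Carrier
  x ^ zero  = 1#
  x ^ suc n = x * (x ^ n)

  sumFin : ∀ {d} → (Fin d → Carrier) → Carrier
  sumFin {zero}  f = 0#
  sumFin {suc d} f = f Data.Fin.zero + sumFin (λ i → f (Data.Fin.suc i))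

  CharZero : Set ℓ
  CharZero = ∀ n → NonZero n → ¬ (fromℕ n ≈ 0#)

  IsRootOfChar : (d : ℕ) → (Fin d → ℤ) → Carrier → Set ℓ
  IsRootOfChar d r α =
    (α ^ d) - sumFin (λ i → fromℤ (r i) * (α ^ (d ℕ.∸ suc (Data.Fin.toℕ i)))) ≈ 0#

{-# OPTIONS --safe #-}

-- Let Tₙ = Σ αᵢⁿ. By Newton's identities T is −x E′/E for the integral reciprocal polynomial E of C.
-- Multiplying or dividing E by factors 1 − xᴺ changes T by the sequences N·[N ∣ n], which are Dold
-- because Σ_{k ∣ n} μ(k) = [n = 1]; hence T is Dold. If all lᵢ equal l then d Uₙ = U₀ Tₙ, so d U is Dold.
--
-- Conversely let c U be Dold and p a large prime modulo which C is irreducible. The Dold condition at pm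
-- gives V(pm) ≡ V(m) mod p for 0 < m < p and V = U, T, that is, the functionals φ_V : xⁿ ↦ Vₙ on the
-- field 𝔽ₚ[x] / (C) are invariant under Frobenius. Only constants are fixed by Frobenius, so by counting
-- equations the invariant functionals form a line, spanned by φ_T because φ_T(1) = d ≠ 0. Hence
-- d U ≡ U₀ T mod p for infinitely many p, so d U = U₀ T, and the Vandermonde matrix of the αᵢ yields d lᵢ = U₀.
module Submission where

open import Defs
open import Level using (Level; _⊔_)
open import Algebra.Bundles using (CommutativeRing)
import Algebra.Solver.Ring
import Algebra.Solver.Ring.AlmostCommutativeRing as ACR
open import Data.Bool using (true; false; if_then_else_; T)
open import Data.Empty using (⊥; ⊥-elim)
open import Data.Fin as Fin using (Fin; toℕ; punchIn; punchOut)
import Data.Fin.Properties as FinP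
open import Data.Integer as ℤ using (ℤ; +_; -[1+_])
import Data.Integer.Divisibility.Signed as ∣ℤ
import Data.Integer.Properties as ℤP
open import Data.Integer.Solver using (module +-*-Solver)
open import Data.List using (List; []; _∷_; _++_; map; reverse; tabulate; allFin; length)
import Data.List.Properties as ListP
open import Data.List.Membership.Propositional using (_∈_; find; lose)
open import Data.List.Membership.Propositional.Properties using (∈-map⁺; ∈-upTo⁺; ∈-filter⁺; ∈-filter⁻)
open import Data.List.Membership.Propositional.Properties.WithK using (unique∧set⇒bag)
open import Data.List.Relation.Binary.BagAndSetEquality using (∼bag⇒↭)
open import Data.List.Relation.Binary.Permutation.Propositional.Properties using (↭-length)
open import Data.List.Relation.Unary.All using (_∷_)
open import Data.List.Relation.Unary.All.Properties using (¬Any⇒All¬)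
import Data.List.Relation.Unary.AllPairs as AllPairs
open import Data.List.Relation.Unary.Any using (here; there)
open import Data.List.Relation.Unary.Any.Properties using (any⁺; any⁻)
open import Data.List.Relation.Unary.Unique.Propositional using (Unique)
import Data.List.Relation.Unary.Unique.Propositional.Properties as Unique
open import Data.Maybe using (Maybe; just; nothing)
open import Data.Nat as ℕ using (ℕ; zero; suc; _≤_; _<_; z≤n; s≤s; NonZero; _!)
open import Data.Nat.Combinatorics using (nCn≡1; nCk≡n!/k![n-k]!; k![n∸k]!∣n!) renaming (_C_ to _choose_)
open import Data.Nat.Coprimality using (Coprime; coprime-divisor)
import Data.Nat.Coprimality as Coprimality
open import Data.Nat.Divisibility using (_∣_; _∣?_; divides)
import Data.Nat.Divisibility as ∣
open import Data.Nat.DivMod using (_/_)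
import Data.Nat.DivMod as DivMod
open import Data.Nat.Induction using (<-rec)
open import Data.Nat.ListAction using (product)
open import Data.Nat.Primality using (Prime; prime?; euclidsLemma; prime⇒irreducible; prime⇒nonZero; prime⇒nonTrivial)
open import Data.Nat.Primality.Factorisation using (factorise)
import Data.Nat.Properties as ℕP
open import Data.Product using (Σ; ∃; _×_; _,_; proj₁; proj₂)
open import Data.Sum as Sum using (_⊎_; inj₁; inj₂)
open import Function using (_∘_; id)
open import Function.Bundles using (_⇔_; mk⇔)
open import Relation.Binary.Definitions using (tri<; tri≈; tri>)
open import Relation.Binary.PropositionalEquality as ≡ using (_≡_; _≢_; cong; cong₂; subst)
open import Relation.Nullary using (¬_; Dec; yes; no; does)
open import Relation.Nullary.Decidable using (¬?; _×-dec_; dec-true; dec-false)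

-- Dimension and duality are replaced by one count of equations. For fixed j the elements Σ yₘ
-- (x^{pm} - xᵐ), reduced modulo C, are required to have y₀ = 0 and to vanish at all coordinates
-- except 0 and j + 1: these are d - 1 linear conditions on d unknowns, hence a solution y ≠ 0. Both
-- φ_T and φ_w, for w = d U - U₀ T, kill such an element. Since w₀ = 0, a value w(j + 1) prime to p
-- would force its coordinate j + 1 to vanish, and then φ_T(1) = d its coordinate 0; so Σ yₘ xᵐ
-- would be fixed by Frobenius without being constant, which is absurd. Equality is decided only in
-- ℤ and 𝔽ₚ, neither in K nor in 𝔽ₚ[x] / (C). Over the latter two the arguments on roots therefore
-- rest on cancellation of nonzero factors, and the statement that Frobenius fixes only constants is
-- proved in doubly negated form, which is enough for a contradiction.

-- Integers in a commutative ring, and a ring solver with integer coefficients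

module IntegerCoefficients {c ℓ} (R : CommutativeRing c ℓ) where
  open CommutativeRing R
  open import Algebra.Properties.Semiring.Mult semiring using (×-homo-+; ×1-homo-*) renaming (_×_ to _·_)
  open import Algebra.Properties.Ring ring
  open import Relation.Binary.Reasoning.Setoid setoid

  fromℤ : ℤ → Carrier
  fromℤ (+ n)    = n · 1#
  fromℤ -[1+ n ] = - (suc n · 1#)

  fromℤ-⊖ : ∀ m n → fromℤ (m ℤ.⊖ n) ≈ m · 1# - n · 1#
  fromℤ-⊖ m zero = begin
    m · 1#        ≈⟨ +-identityʳ _ ⟨
    m · 1# + 0#   ≈⟨ +-congˡ -0#≈0# ⟨
    m · 1# - 0#   ∎
  fromℤ-⊖ zero (suc n) = sym (+-identityˡ _)
  fromℤ-⊖ (suc m) (suc n) = begin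
    fromℤ (suc m ℤ.⊖ suc n)            ≡⟨ cong fromℤ (ℤP.[1+m]⊖[1+n]≡m⊖n m n) ⟩
    fromℤ (m ℤ.⊖ n)                    ≈⟨ fromℤ-⊖ m n ⟩
    m · 1# - n · 1#                    ≈⟨ +-congʳ (+-identityʳ _) ⟨
    m · 1# + 0# - n · 1#               ≈⟨ +-congʳ (+-congˡ (-‿inverseʳ 1#)) ⟨
    m · 1# + (1# - 1#) - n · 1#        ≈⟨ +-congʳ (+-assoc _ _ _) ⟨
    m · 1# + 1# - 1# - n · 1#          ≈⟨ +-assoc _ _ _ ⟩
    m · 1# + 1# + (- 1# - n · 1#)      ≈⟨ +-cong (+-comm _ _) (-‿+-comm _ _) ⟩
    1# + m · 1# - (1# + n · 1#)        ∎

  fromℤ-+ : ∀ a b → fromℤ (a ℤ.+ b) ≈ fromℤ a + fromℤ b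
  fromℤ-+ (+ m)    (+ n)    = ×-homo-+ 1# m n
  fromℤ-+ (+ m)    -[1+ n ] = fromℤ-⊖ m (suc n)
  fromℤ-+ -[1+ m ] (+ n)    = trans (fromℤ-⊖ n (suc m)) (+-comm _ _)
  fromℤ-+ -[1+ m ] -[1+ n ] = begin
    - (suc (suc (m ℕ.+ n)) · 1#)       ≡⟨ cong (λ k → - (suc k · 1#)) (ℕP.+-suc m n) ⟨
    - ((suc m ℕ.+ suc n) · 1#)         ≈⟨ -‿cong (×-homo-+ 1# (suc m) (suc n)) ⟩
    - (suc m · 1# + suc n · 1#)        ≈⟨ -‿+-comm _ _ ⟨
    - (suc m · 1#) - (suc n · 1#)      ∎

  fromℤ-neg : ∀ a → fromℤ (ℤ.- a) ≈ - fromℤ a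
  fromℤ-neg (+ zero)  = sym -0#≈0#
  fromℤ-neg (+ suc n) = refl
  fromℤ-neg -[1+ n ]  = sym (-‿involutive _)

  fromℤ-*+ : ∀ m a → fromℤ (+ m ℤ.* a) ≈ m · 1# * fromℤ a
  fromℤ-*+ m (+ n) = begin
    fromℤ (+ m ℤ.* + n)  ≡⟨ cong fromℤ (ℤP.pos-* m n) ⟨
    (m ℕ.* n) · 1#       ≈⟨ ×1-homo-* m n ⟩
    m · 1# * n · 1#      ∎
  fromℤ-*+ m -[1+ n ] = begin
    fromℤ (+ m ℤ.* ℤ.- (+ suc n))   ≡⟨ cong fromℤ (ℤP.neg-distribʳ-* (+ m) (+ suc n)) ⟨
    fromℤ (ℤ.- (+ m ℤ.* + suc n))   ≈⟨ fromℤ-neg (+ m ℤ.* + suc n) ⟩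
    - fromℤ (+ m ℤ.* + suc n)       ≈⟨ -‿cong (fromℤ-*+ m (+ suc n)) ⟩
    - (m · 1# * suc n · 1#)         ≈⟨ -‿distribʳ-* _ _ ⟩
    m · 1# * - (suc n · 1#)         ∎

  fromℤ-* : ∀ a b → fromℤ (a ℤ.* b) ≈ fromℤ a * fromℤ b
  fromℤ-* (+ m)    b = fromℤ-*+ m b
  fromℤ-* -[1+ m ] b = begin
    fromℤ (ℤ.- (+ suc m) ℤ.* b)     ≡⟨ cong fromℤ (ℤP.neg-distribˡ-* (+ suc m) b) ⟨
    fromℤ (ℤ.- (+ suc m ℤ.* b))     ≈⟨ fromℤ-neg (+ suc m ℤ.* b) ⟩
    - fromℤ (+ suc m ℤ.* b)         ≈⟨ -‿cong (fromℤ-*+ (suc m) b) ⟩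
    - (suc m · 1# * fromℤ b)        ≈⟨ -‿distribˡ-* _ _ ⟩
    - (suc m · 1#) * fromℤ b        ∎

  almostRing : ACR.AlmostCommutativeRing c ℓ
  almostRing = ACR.fromCommutativeRing R

  -- A copy of fromℤ on which the solver's literal 1 computes to 1#.
  literal : ℤ → Carrier
  literal (+ 1) = 1#
  literal a     = fromℤ a

  literal≈fromℤ : ∀ a → literal a ≈ fromℤ a
  literal≈fromℤ (+ 0)           = refl
  literal≈fromℤ (+ 1)           = sym (+-identityʳ 1#)
  literal≈fromℤ (+ suc (suc n)) = refl
  literal≈fromℤ -[1+ n ]        = refl

  homomorphism : ACR._-Raw-AlmostCommutative⟶_ ℤ.+-*-rawRing almostRing
  homomorphism = record
    { ⟦_⟧    = literal
    ; +-homo = λ a b → trans (literal≈fromℤ (a ℤ.+ b)) (trans (fromℤ-+ a b)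
                 (sym (+-cong (literal≈fromℤ a) (literal≈fromℤ b))))
    ; *-homo = λ a b → trans (literal≈fromℤ (a ℤ.* b)) (trans (fromℤ-* a b)
                 (sym (*-cong (literal≈fromℤ a) (literal≈fromℤ b))))
    ; -‿homo = λ a → trans (literal≈fromℤ (ℤ.- a)) (trans (fromℤ-neg a)
                 (sym (-‿cong (literal≈fromℤ a))))
    ; 0-homo = refl
    ; 1-homo = refl
    }

  literal-≟ : ∀ a b → Maybe (literal a ≈ literal b)
  literal-≟ a b with a ℤ.≟ b
  ... | yes a≡b = just (reflexive (cong literal a≡b))
  ... | no  _   = nothing

  open Algebra.Solver.Ring ℤ.+-*-rawRing almostRing homomorphism literal-≟ public
    using (solve; _:=_; _:+_; _:*_; _:-_; :-_; con)

-- Power series, logarithmic derivatives and Newton's identities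

module Series {a ℓ} (R : CommutativeRing a ℓ) where
  open CommutativeRing R
  open IntegerCoefficients R
  open import Algebra.Properties.Semiring.Mult semiring using () renaming (_×_ to _·_)
  open import Algebra.Properties.Semiring.Exp semiring using (_^_)
  open import Algebra.Properties.Semiring.Sum semiring using (sum; *-distribˡ-sum; ∑-distrib-+; sum-cong-≋; sum-replicate-zero)
  open import Relation.Binary.Reasoning.Setoid setoid

  infix 4 _≐_
  _≐_ : (f g : ℕ → Carrier) → Set ℓ
  f ≐ g = ∀ n → f n ≈ g n

  -- The Cauchy product. Peeling off the constant term of `f` matches the recursion on coefficient
  -- lists `x ∷ f`, so the same laws later serve polynomials.
  conv : (f g : ℕ → Carrier) → ℕ → Carrier
  conv f g zero    = f 0 * g 0
  conv f g (suc n) = f 0 * g (suc n) + conv (f ∘ suc) g n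

  conv-cong : ∀ {f f′ g g′} → f ≐ f′ → g ≐ g′ → conv f g ≐ conv f′ g′
  conv-cong p q zero    = *-cong (p 0) (q 0)
  conv-cong p q (suc n) = +-cong (*-cong (p 0) (q (suc n))) (conv-cong (p ∘ suc) q n)

  conv-zeroˡ : ∀ f g n → (∀ k → k ≤ n → f k ≈ 0#) → conv f g n ≈ 0#
  conv-zeroˡ f g zero    f≈0 = trans (*-congʳ (f≈0 0 z≤n)) (zeroˡ _)
  conv-zeroˡ f g (suc n) f≈0 = trans
    (+-cong (trans (*-congʳ (f≈0 0 z≤n)) (zeroˡ _)) (conv-zeroˡ (f ∘ suc) g n (λ k k≤n → f≈0 (suc k) (s≤s k≤n))))
    (+-identityˡ _)

  conv-constˡ : ∀ f g n → (∀ k → 1 ≤ k → k ≤ n → f k ≈ 0#) → conv f g n ≈ f 0 * g n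
  conv-constˡ f g zero    f≈0 = refl
  conv-constˡ f g (suc n) f≈0 = trans
    (+-congˡ (conv-zeroˡ (f ∘ suc) g n (λ k k≤n → f≈0 (suc k) (s≤s z≤n) (s≤s k≤n)))) (+-identityʳ _)

  conv-distribʳ : ∀ f g h n → conv (λ k → f k + g k) h n ≈ conv f h n + conv g h n
  conv-distribʳ f g h zero    = distribʳ _ _ _
  conv-distribʳ f g h (suc n) = begin
    (f 0 + g 0) * h (suc n) + conv (λ k → f (suc k) + g (suc k)) h n
      ≈⟨ +-congˡ (conv-distribʳ (f ∘ suc) (g ∘ suc) h n) ⟩
    (f 0 + g 0) * h (suc n) + (conv (f ∘ suc) h n + conv (g ∘ suc) h n)
      ≈⟨ solve 5 (λ a b x y z → (a :+ b) :* x :+ (y :+ z) := a :* x :+ y :+ (b :* x :+ z)) refl _ _ _ _ _ ⟩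
    f 0 * h (suc n) + conv (f ∘ suc) h n + (g 0 * h (suc n) + conv (g ∘ suc) h n) ∎

  conv-scaleˡ : ∀ a f g n → conv (λ k → a * f k) g n ≈ a * conv f g n
  conv-scaleˡ a f g zero    = *-assoc _ _ _
  conv-scaleˡ a f g (suc n) = begin
    a * f 0 * g (suc n) + conv (λ k → a * f (suc k)) g n  ≈⟨ +-cong (*-assoc _ _ _) (conv-scaleˡ a (f ∘ suc) g n) ⟩
    a * (f 0 * g (suc n)) + a * conv (f ∘ suc) g n        ≈⟨ distribˡ _ _ _ ⟨
    a * (f 0 * g (suc n) + conv (f ∘ suc) g n)            ∎

  conv-negˡ : ∀ f g n → conv (λ k → - f k) g n ≈ - conv f g n
  conv-negˡ f g zero    = solve 2 (λ x y → (:- x) :* y := :- (x :* y)) refl _ _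
  conv-negˡ f g (suc n) = begin
    - f 0 * g (suc n) + conv (λ k → - f (suc k)) g n  ≈⟨ +-congˡ (conv-negˡ (f ∘ suc) g n) ⟩
    - f 0 * g (suc n) - conv (f ∘ suc) g n            ≈⟨ solve 3 (λ x y z → (:- x) :* y :- z := :- (x :* y :+ z)) refl _ _ _ ⟩
    - (f 0 * g (suc n) + conv (f ∘ suc) g n)          ∎

  conv-sucʳ : ∀ f g n → conv f g (suc n) ≈ conv f (g ∘ suc) n + f (suc n) * g 0
  conv-sucʳ f g zero    = refl
  conv-sucʳ f g (suc n) = begin
    f 0 * g (suc (suc n)) + conv (f ∘ suc) g (suc n)                               ≈⟨ +-congˡ (conv-sucʳ (f ∘ suc) g n) ⟩
    f 0 * g (suc (suc n)) + (conv (f ∘ suc) (g ∘ suc) n + f (suc (suc n)) * g 0)   ≈⟨ +-assoc _ _ _ ⟨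
    f 0 * g (suc (suc n)) + conv (f ∘ suc) (g ∘ suc) n + f (suc (suc n)) * g 0     ∎

  conv-comm : ∀ f g n → conv f g n ≈ conv g f n
  conv-comm f g zero    = *-comm _ _
  conv-comm f g (suc n) = begin
    f 0 * g (suc n) + conv (f ∘ suc) g n   ≈⟨ +-cong (*-comm _ _) (conv-comm (f ∘ suc) g n) ⟩
    g (suc n) * f 0 + conv g (f ∘ suc) n   ≈⟨ +-comm _ _ ⟩
    conv g (f ∘ suc) n + g (suc n) * f 0   ≈⟨ conv-sucʳ g f n ⟨
    conv g f (suc n)                       ∎

  conv-assoc : ∀ f g h n → conv (conv f g) h n ≈ conv f (conv g h) n
  conv-assoc f g h zero    = *-assoc _ _ _
  conv-assoc f g h (suc n) = begin
    f 0 * g 0 * h (suc n) + conv (λ k → f 0 * g (suc k) + conv (f ∘ suc) g k) h n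
      ≈⟨ +-congˡ (conv-distribʳ _ _ h n) ⟩
    f 0 * g 0 * h (suc n) + (conv (λ k → f 0 * g (suc k)) h n + conv (conv (f ∘ suc) g) h n)
      ≈⟨ +-congˡ (+-cong (conv-scaleˡ (f 0) (g ∘ suc) h n) (conv-assoc (f ∘ suc) g h n)) ⟩
    f 0 * g 0 * h (suc n) + (f 0 * conv (g ∘ suc) h n + conv (f ∘ suc) (conv g h) n)
      ≈⟨ solve 5 (λ a b x y z → a :* b :* x :+ (a :* y :+ z) := a :* (b :* x :+ y) :+ z) refl _ _ _ _ _ ⟩
    f 0 * (g 0 * h (suc n) + conv (g ∘ suc) h n) + conv (f ∘ suc) (conv g h) n ∎

  -- As `e 0` is 1, the constant terms agree; removing their contribution leaves the same hypothesis
  -- for the shifted series. No division occurs, so this is valid over ℤ.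
  conv-cancelʳ : ∀ t t′ e → e 0 ≈ 1# → conv t e ≐ conv t′ e → t ≐ t′
  conv-cancelʳ t t′ e e₀ eq zero = begin
    t 0         ≈⟨ *-identityʳ _ ⟨
    t 0 * 1#    ≈⟨ *-congˡ e₀ ⟨
    t 0 * e 0   ≈⟨ eq 0 ⟩
    t′ 0 * e 0  ≈⟨ *-congˡ e₀ ⟩
    t′ 0 * 1#   ≈⟨ *-identityʳ _ ⟩
    t′ 0        ∎
  conv-cancelʳ t t′ e e₀ eq (suc n) = conv-cancelʳ (t ∘ suc) (t′ ∘ suc) e e₀ tails n
    where
    tails : conv (t ∘ suc) e ≐ conv (t′ ∘ suc) e
    tails k = begin
      conv (t ∘ suc) e k                                    ≈⟨ solve 2 (λ x y → y := x :+ y :- x) refl _ _ ⟩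
      conv t e (suc k) - t 0 * e (suc k)                    ≈⟨ +-cong (eq (suc k)) (-‿cong (*-congʳ (conv-cancelʳ t t′ e e₀ eq 0))) ⟩
      conv t′ e (suc k) - t′ 0 * e (suc k)                  ≈⟨ solve 2 (λ x y → y := x :+ y :- x) refl _ _ ⟨
      conv (t′ ∘ suc) e k                                   ∎

  -- The quotient a / e; it is only meaningful when e has constant term 1.
  quotient : (a e : ℕ → Carrier) → ℕ → Carrier
  quotient a e zero    = a 0
  quotient a e (suc n) = quotient (λ k → a (suc k) - a 0 * e (suc k)) e n

  conv-quotient : ∀ a e → e 0 ≈ 1# → conv (quotient a e) e ≐ a
  conv-quotient a e e₀ zero    = trans (*-congˡ e₀) (*-identityʳ _)
  conv-quotient a e e₀ (suc n) = begin
    a 0 * e (suc n) + conv (quotient (λ k → a (suc k) - a 0 * e (suc k)) e) e n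
      ≈⟨ +-congˡ (conv-quotient _ e e₀ n) ⟩
    a 0 * e (suc n) + (a (suc n) - a 0 * e (suc n))
      ≈⟨ solve 2 (λ x y → x :+ (y :- x) := y) refl _ _ ⟩
    a (suc n) ∎

  -- The Euler operator x d/dx, which preserves degrees.
  δ : (ℕ → Carrier) → ℕ → Carrier
  δ f n = n · 1# * f n

  -- The Leibniz rule. Shifting does not commute with `δ`: the tail of `δ f` is `f ∘ suc` plus
  -- `δ (f ∘ suc)`, which accounts for the extra convolution in the chain.
  δ-conv : ∀ f g n → δ (conv f g) n ≈ conv (δ f) g n + conv f (δ g) n
  δ-conv f g zero    = solve 2 (λ x y → con (+ 0) :* (x :* y) := con (+ 0) :* x :* y :+ x :* (con (+ 0) :* y)) refl _ _
  δ-conv f g (suc n) = begin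
    (1# + n · 1#) * (f 0 * g (suc n) + conv (f ∘ suc) g n)
      ≈⟨ solve 4 (λ m a x y → (con (+ 1) :+ m) :* (a :* x :+ y) := a :* ((con (+ 1) :+ m) :* x) :+ (y :+ m :* y)) refl _ _ _ _ ⟩
    f 0 * δ g (suc n) + (conv (f ∘ suc) g n + δ (conv (f ∘ suc) g) n)
      ≈⟨ +-congˡ (+-congˡ (δ-conv (f ∘ suc) g n)) ⟩
    f 0 * δ g (suc n) + (conv (f ∘ suc) g n + (conv (δ (f ∘ suc)) g n + conv (f ∘ suc) (δ g) n))
      ≈⟨ solve 6 (λ a b x y z w → a :+ (x :+ (y :+ z)) := con (+ 0) :* b :* w :+ (x :+ y) :+ (a :+ z)) refl _ _ _ _ _ _ ⟩
    δ f 0 * g (suc n) + (conv (f ∘ suc) g n + conv (δ (f ∘ suc)) g n) + conv f (δ g) (suc n)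
      ≈⟨ +-congʳ (+-congˡ (conv-distribʳ _ _ g n)) ⟨
    δ f 0 * g (suc n) + conv (λ k → f (suc k) + δ (f ∘ suc) k) g n + conv f (δ g) (suc n)
      ≈⟨ +-congʳ (+-congˡ (conv-cong (λ k → solve 2 (λ m x → x :+ m :* x := (con (+ 1) :+ m) :* x) refl _ _) (λ _ → refl) n)) ⟩
    conv (δ f) g (suc n) + conv f (δ g) (suc n) ∎

  -- t = − x E′(x) / E(x)
  LogDerivative : (t E : ℕ → Carrier) → Set ℓ
  LogDerivative t E = ∀ n → conv t E n ≈ - δ E n

  -- After regrouping, t E E′ and t′ E′ E are the two halves of the Leibniz rule for E E′.
  logDerivative-conv : ∀ {t E t′ E′} → LogDerivative t E → LogDerivative t′ E′ →
    LogDerivative (λ n → t n + t′ n) (conv E E′)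
  logDerivative-conv {t} {E} {t′} {E′} p q n = begin
    conv (λ n → t n + t′ n) (conv E E′) n                    ≈⟨ conv-distribʳ t t′ (conv E E′) n ⟩
    conv t (conv E E′) n + conv t′ (conv E E′) n             ≈⟨ +-cong (conv-assoc t E E′ n) (conv-cong (λ _ → refl) (conv-comm E′ E) n) ⟨
    conv (conv t E) E′ n + conv t′ (conv E′ E) n             ≈⟨ +-congˡ (conv-assoc t′ E′ E n) ⟨
    conv (conv t E) E′ n + conv (conv t′ E′) E n             ≈⟨ +-cong (conv-cong p (λ _ → refl) n) (conv-cong q (λ _ → refl) n) ⟩
    conv (λ k → - δ E k) E′ n + conv (λ k → - δ E′ k) E n    ≈⟨ +-cong (conv-negˡ (δ E) E′ n) (conv-negˡ (δ E′) E n) ⟩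
    - conv (δ E) E′ n - conv (δ E′) E n                      ≈⟨ +-congˡ (-‿cong (conv-comm (δ E′) E n)) ⟩
    - conv (δ E) E′ n - conv E (δ E′) n                      ≈⟨ solve 2 (λ x y → (:- x) :- y := :- (x :+ y)) refl _ _ ⟩
    - (conv (δ E) E′ n + conv E (δ E′) n)                    ≈⟨ -‿cong (δ-conv E E′ n) ⟨
    - δ (conv E E′) n                                        ∎

  logDerivative-cong : ∀ {t t′ E E′} → t ≐ t′ → E ≐ E′ → LogDerivative t E → LogDerivative t′ E′
  logDerivative-cong {t} {t′} {E} {E′} p q h n = begin
    conv t′ E′ n  ≈⟨ conv-cong p q n ⟨
    conv t E n    ≈⟨ h n ⟩
    - δ E n       ≈⟨ -‿cong (*-congˡ (q n)) ⟩
    - δ E′ n      ∎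

  logDerivative-unique : ∀ {t t′ E} → E 0 ≈ 1# → LogDerivative t E → LogDerivative t′ E → t ≐ t′
  logDerivative-unique {t} {t′} {E} E₀ p q = conv-cancelʳ t t′ E E₀ (λ n → trans (p n) (sym (q n)))

  -- At n = d this is the value at c of E₀ xᵈ + E₁ xᵈ⁻¹ + ⋯ + E_d; as a series in n it is E(x) / (1 − c x).
  horner : (ℕ → Carrier) → Carrier → ℕ → Carrier
  horner E c zero    = E 0
  horner E c (suc n) = c * horner E c n + E (suc n)

  -- Synthetic division by x - c: the successive Horner values at `c` are the coefficients of the
  -- quotient, and the last one is the remainder.
  horner-factor : ∀ E c x n →
    horner E x (suc n) ≈ (x - c) * horner (horner E c) x n + horner E c (suc n)
  horner-factor E c x zero    =
    solve 4 (λ c x a b → x :* a :+ b := (x :- c) :* a :+ (c :* a :+ b)) refl _ _ _ _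
  horner-factor E c x (suc n) = trans (+-congʳ (*-congˡ (horner-factor E c x n)))
    (solve 5 (λ c x a b e → x :* ((x :- c) :* a :+ b) :+ e := (x :- c) :* (x :* a :+ b) :+ (c :* b :+ e)) refl _ _ _ _ _)

  -- x^{q+2} − x, highest degree first
  fermatSeries : ℕ → ℕ → Carrier
  fermatSeries q zero    = 1#
  fermatSeries q (suc k) = if does (k ℕ.≟ q) then - 1# else 0#

  horner-fermatSeries : ∀ q x → horner (fermatSeries q) x (suc (suc q)) ≈ x ^ suc (suc q) - x
  horner-fermatSeries q x = begin
    x * (x * horner (fermatSeries q) x q + fermatSeries q (suc q)) + fermatSeries q (suc (suc q))
      ≈⟨ +-cong (*-congˡ (+-cong (*-congˡ (low q ℕP.≤-refl)) middle)) (vanish (suc q) ℕP.1+n≢n) ⟩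
    x * (x * x ^ q + - 1#) + 0#
      ≈⟨ solve 2 (λ x u → x :* (x :* u :+ (:- con (+ 1))) :+ con (+ 0) := x :* (x :* u) :- x) refl x (x ^ q) ⟩
    x ^ suc (suc q) - x ∎
    where
    vanish : ∀ k → k ≢ q → fermatSeries q (suc k) ≈ 0#
    vanish k k≢q = reflexive (cong (λ b → if b then - 1# else 0#) (dec-false (k ℕ.≟ q) k≢q))
    middle : fermatSeries q (suc q) ≈ - 1#
    middle = reflexive (cong (λ b → if b then - 1# else 0#) (dec-true (q ℕ.≟ q) ≡.refl))
    low : ∀ n → n ≤ q → horner (fermatSeries q) x n ≈ x ^ n
    low zero    n≤q = refl
    low (suc n) n<q = trans (+-cong (*-congˡ (low n (ℕP.<⇒≤ n<q))) (vanish n (ℕP.<⇒≢ n<q))) (+-identityʳ _)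

  -- The series 1 - c x, reciprocal to the factor x - c of the characteristic polynomial.
  linear : Carrier → ℕ → Carrier
  linear c 0             = 1#
  linear c 1             = - c
  linear c (suc (suc n)) = 0#

  conv-linear : ∀ c f n → conv (linear c) f (suc n) ≈ f (suc n) - c * f n
  conv-linear c f n = trans (+-congˡ (conv-constˡ (linear c ∘ suc) f n (λ { (suc _) _ _ → refl })))
    (solve 3 (λ c x y → con (+ 1) :* x :+ (:- c) :* y := x :- c :* y) refl _ _ _)

  horner-linear : ∀ E c → conv (horner E c) (linear c) ≐ E
  horner-linear E c zero    = *-identityʳ _
  horner-linear E c (suc n) = begin
    conv (horner E c) (linear c) (suc n)                       ≈⟨ conv-comm (horner E c) (linear c) (suc n) ⟩
    conv (linear c) (horner E c) (suc n)                       ≈⟨ conv-linear c (horner E c) n ⟩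
    c * horner E c n + E (suc n) - c * horner E c n            ≈⟨ solve 2 (λ x y → x :+ y :- x := y) refl _ _ ⟩
    E (suc n)                                                  ∎

  -- The series -x d/dx log (1 - c x) = Σ cⁿ xⁿ runs over n ≥ 1 only, so its constant term is 0 and
  -- not c⁰.
  positivePower : Carrier → ℕ → Carrier
  positivePower c zero    = 0#
  positivePower c (suc n) = c ^ suc n

  logDerivative-linear : ∀ c → LogDerivative (positivePower c) (linear c)
  logDerivative-linear c zero          = solve 1 (λ x → con (+ 0) :* x := :- (con (+ 0) :* x)) refl _
  logDerivative-linear c (suc zero)    = solve 1 (λ c → con (+ 0) :* (:- c) :+ c :* con (+ 1) :* con (+ 1) := :- ((con (+ 1) :+ con (+ 0)) :* (:- c))) refl _
  logDerivative-linear c (suc (suc n)) = begin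
    conv (positivePower c) (linear c) (suc (suc n))   ≈⟨ conv-comm (positivePower c) (linear c) (suc (suc n)) ⟩
    conv (linear c) (positivePower c) (suc (suc n))   ≈⟨ conv-linear c (positivePower c) (suc n) ⟩
    c * c ^ suc n - c * c ^ suc n                     ≈⟨ solve 2 (λ x m → x :- x := :- (m :* con (+ 0))) refl _ _ ⟩
    - δ (linear c) (suc (suc n))                      ∎

  powerSum : ∀ {d} → (Fin d → Carrier) → ℕ → Carrier
  powerSum α n = sum (λ i → positivePower (α i) n)

  -- Cancellation is all that is assumed, so that these results apply alike to 𝔽ₚ, to 𝔽ₚ[x] / (C)
  -- and to K.
  module Cancellative (cancel : ∀ x y → ¬ (x ≈ 0#) → x * y ≈ 0# → y ≈ 0#) where

    difference-nonzero : ∀ {x y} → ¬ (x ≈ y) → ¬ (x - y ≈ 0#)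
    difference-nonzero {x} {y} x≉y eq = x≉y (begin
      x          ≈⟨ solve 2 (λ x y → x := x :- y :+ y) refl _ _ ⟩
      x - y + y  ≈⟨ +-congʳ eq ⟩
      0# + y     ≈⟨ +-identityˡ _ ⟩
      y          ∎)

    cancel-unit : ∀ x y → ¬ (x ≈ 0#) → x * y ≈ x → y ≈ 1#
    cancel-unit x y x≉0 xy≈x = begin
      y              ≈⟨ solve 1 (λ y → y := y :- con (+ 1) :+ con (+ 1)) refl y ⟩
      y - 1# + 1#    ≈⟨ +-congʳ (cancel x (y - 1#) x≉0 (begin
        x * (y - 1#)   ≈⟨ solve 2 (λ x y → x :* (y :- con (+ 1)) := x :* y :- x) refl x y ⟩
        x * y - x      ≈⟨ +-congʳ xy≈x ⟩
        x - x          ≈⟨ -‿inverseʳ x ⟩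
        0#             ∎)) ⟩
      0# + 1#        ≈⟨ +-identityˡ 1# ⟩
      1#             ∎

    -- In `horner-factor` the remainder at the root `c` is 0, and x - c cancels.
    deflate : ∀ E c x n → ¬ (x ≈ c) → horner E c (suc n) ≈ 0# → horner E x (suc n) ≈ 0# →
      horner (horner E c) x n ≈ 0#
    deflate E c x n x≉c Ec Ex = cancel (x - c) _ (difference-nonzero x≉c) (begin
      (x - c) * horner (horner E c) x n                        ≈⟨ +-identityʳ _ ⟨
      (x - c) * horner (horner E c) x n + 0#                   ≈⟨ +-congˡ Ec ⟨
      (x - c) * horner (horner E c) x n + horner E c (suc n)   ≈⟨ horner-factor E c x n ⟨
      horner E x (suc n)                                       ≈⟨ Ex ⟩
      0#                                                       ∎)

    private
      suc-distinct : ∀ {d} {α : Fin (suc d) → Carrier} → (∀ i j → α i ≈ α j → i ≡ j) →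
        ∀ i j → α (Fin.suc i) ≈ α (Fin.suc j) → i ≡ j
      suc-distinct dist i j eq with dist (Fin.suc i) (Fin.suc j) eq
      ... | ≡.refl = ≡.refl

      suc≉zero : ∀ {d} {α : Fin (suc d) → Carrier} → (∀ i j → α i ≈ α j → i ≡ j) →
        ∀ i → ¬ (α (Fin.suc i) ≈ α Fin.zero)
      suc≉zero dist i eq with dist (Fin.suc i) Fin.zero eq
      ... | ()

    -- Each deflation uses up one root and one degree but keeps the leading coefficient `E 0`; at
    -- degree 0 the remaining root says that this coefficient is 0.
    tooManyRoots : ∀ d (α : Fin (suc d) → Carrier) → (∀ i j → α i ≈ α j → i ≡ j) →
      ∀ E → (∀ i → horner E (α i) d ≈ 0#) → E 0 ≈ 0#
    tooManyRoots zero    α dist E roots = roots Fin.zero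
    tooManyRoots (suc d) α dist E roots =
      tooManyRoots d (α ∘ Fin.suc) (suc-distinct dist) (horner E (α Fin.zero))
        (λ i → deflate E _ _ d (suc≉zero dist i) (roots Fin.zero) (roots (Fin.suc i)))

    -- Each root `c` splits off a factor 1 - c x, whose logarithmic derivative is the sequence of
    -- powers of `c`; products of factors become sums of powers.
    newton : ∀ d (α : Fin d → Carrier) → (∀ i j → α i ≈ α j → i ≡ j) →
      ∀ E → (∀ k → d < k → E k ≈ 0#) → (∀ i → horner E (α i) d ≈ 0#) →
      LogDerivative (powerSum α) E
    newton zero α dist E deg roots n = begin
      conv (powerSum α) E n   ≈⟨ conv-zeroˡ (powerSum α) E n (λ _ _ → refl) ⟩
      0#                      ≈⟨ vanish n ⟨
      - δ E n                 ∎
      where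
      vanish : ∀ n → - δ E n ≈ 0#
      vanish zero    = solve 1 (λ x → :- (con (+ 0) :* x) := con (+ 0)) refl _
      vanish (suc n) = trans (-‿cong (*-congˡ (deg (suc n) (s≤s z≤n))))
        (solve 1 (λ x → :- (x :* con (+ 0)) := con (+ 0)) refl _)
    newton (suc d) α dist E deg roots =
      logDerivative-cong (λ n → +-comm _ _) (horner-linear E c)
        (logDerivative-conv (newton d (α ∘ Fin.suc) (suc-distinct dist) Q Q-deg
           (λ i → deflate E _ _ d (suc≉zero dist i) (roots Fin.zero) (roots (Fin.suc i))))
           (logDerivative-linear c))
      where
      c = α Fin.zero
      Q = horner E c
      -- The coefficient at index `suc d` is the value of the polynomial at its root `c`, hence 0;
      -- afterwards the recursion only multiplies 0 by `c` and adds vanishing coefficients of `E`.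
      beyond : ∀ k → Q (k ℕ.+ suc d) ≈ 0#
      beyond zero    = roots Fin.zero
      beyond (suc k) = begin
        c * Q (k ℕ.+ suc d) + E (suc (k ℕ.+ suc d))  ≈⟨ +-cong (*-congˡ (beyond k)) (deg _ (s≤s (ℕP.m≤n+m (suc d) k))) ⟩
        c * 0# + 0#                                  ≈⟨ solve 1 (λ x → x :* con (+ 0) :+ con (+ 0) := con (+ 0)) refl _ ⟩
        0#                                           ∎
      Q-deg : ∀ k → d < k → Q k ≈ 0#
      Q-deg k d<k = ≡.subst (λ m → Q m ≈ 0#) (ℕP.m∸n+n≡m d<k) (beyond (k ℕ.∸ suc d))

    -- Subtracting `c` times equation m from equation m + 1 eliminates the first unknown and scales
    -- each other one by αᵢ - c, which is nonzero. Once the others vanish, equation 0 gives the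
    -- first.
    vandermonde : ∀ d (α : Fin d → Carrier) → (∀ i j → α i ≈ α j → i ≡ j) →
      ∀ (l : Fin d → Carrier) → (∀ m → m < d → sum (λ i → l i * α i ^ m) ≈ 0#) → ∀ i → l i ≈ 0#
    vandermonde (suc d) α dist l sums = all
      where
      c = α Fin.zero
      l′ : Fin d → Carrier
      l′ i = (α (Fin.suc i) - c) * l (Fin.suc i)
      sums′ : ∀ m → m < d → sum (λ i → l′ i * α (Fin.suc i) ^ m) ≈ 0#
      sums′ m m<d = begin
        sum (λ i → l′ i * α (Fin.suc i) ^ m)
          ≈⟨ sum-cong-≋ {d} (λ i → solve 4 (λ a c l x → (a :- c) :* l :* x := l :* (a :* x) :+ (:- c) :* (l :* x)) refl _ _ _ _) ⟩
        sum (λ i → l (Fin.suc i) * α (Fin.suc i) ^ suc m + - c * (l (Fin.suc i) * α (Fin.suc i) ^ m))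
          ≈⟨ ∑-distrib-+ {d} _ _ ⟩
        sum (λ i → l (Fin.suc i) * α (Fin.suc i) ^ suc m) + sum (λ i → - c * (l (Fin.suc i) * α (Fin.suc i) ^ m))
          ≈⟨ +-congˡ (*-distribˡ-sum {d} (- c) _) ⟨
        sum (λ i → l (Fin.suc i) * α (Fin.suc i) ^ suc m) + - c * sum (λ i → l (Fin.suc i) * α (Fin.suc i) ^ m)
          ≈⟨ solve 5 (λ c a x u v → u :+ (:- c) :* v := a :* (c :* x) :+ u :+ (:- c) :* (a :* x :+ v)) refl _ (l Fin.zero) (c ^ m) _ _ ⟩
        sum (λ i → l i * α i ^ suc m) + - c * sum (λ i → l i * α i ^ m)
          ≈⟨ +-cong (sums (suc m) (s≤s m<d)) (*-congˡ (sums m (ℕP.m<n⇒m<1+n m<d))) ⟩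
        0# + - c * 0#
          ≈⟨ solve 1 (λ x → con (+ 0) :+ x :* con (+ 0) := con (+ 0)) refl _ ⟩
        0# ∎
      rest : ∀ i → l (Fin.suc i) ≈ 0#
      rest i = cancel (α (Fin.suc i) - c) _ (difference-nonzero (suc≉zero dist i))
        (vandermonde d (α ∘ Fin.suc) (suc-distinct dist) l′ sums′ i)
      all : ∀ i → l i ≈ 0#
      all (Fin.suc i) = rest i
      all Fin.zero    = begin
        l Fin.zero                   ≈⟨ solve 1 (λ x → x := x :* con (+ 1) :+ con (+ 0)) refl _ ⟩
        l Fin.zero * 1# + 0#         ≈⟨ +-congˡ (sum-replicate-zero d) ⟨
        l Fin.zero * 1# + sum {d} (λ _ → 0#)
          ≈⟨ +-congˡ (sum-cong-≋ {d} (λ i → sym (trans (*-congʳ (rest i)) (zeroˡ _)))) ⟩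
        sum (λ i → l i * α i ^ 0)    ≈⟨ sums 0 (s≤s z≤n) ⟩
        0#                           ∎

-- The Möbius function

prime-≥2 : ∀ {p} → Prime p → 2 ≤ p
prime-≥2 {zero}        pr = ⊥-elim (ℕ.NonTrivial.nonTrivial (prime⇒nonTrivial pr))
prime-≥2 {suc zero}    pr = ⊥-elim (ℕ.NonTrivial.nonTrivial (prime⇒nonTrivial pr))
prime-≥2 {suc (suc p)} pr = s≤s (s≤s z≤n)

prime-∤⇒coprime : ∀ {p n} → Prime p → ¬ p ∣ n → Coprime p n
prime-∤⇒coprime pr p∤n (d∣p , d∣n) with prime⇒irreducible pr d∣p
... | inj₁ d≡1    = d≡1
... | inj₂ ≡.refl = ⊥-elim (p∤n d∣n)

∣p*n⇒∣n : ∀ {p k n} → Prime p → ¬ p ∣ k → k ∣ p ℕ.* n → k ∣ n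
∣p*n⇒∣n pr p∤k = coprime-divisor (Coprimality.sym (prime-∤⇒coprime pr p∤k))

prime-∣-prime : ∀ {p q} → Prime p → Prime q → q ∣ p → q ≡ p
prime-∣-prime pr qr q∣p with prime⇒irreducible pr q∣p
... | inj₂ q≡p    = q≡p
... | inj₁ ≡.refl with prime-≥2 qr
...   | s≤s ()

∈-primeDivisors⁻ : ∀ {q n} → q ∈ primeDivisors n → Prime q × q ∣ n
∈-primeDivisors⁻ {n = n} q∈ =
  proj₂ (∈-filter⁻ (λ p → prime? p ×-dec (p ∣? n)) {xs = candidates n} q∈)

∈-primeDivisors⁺ : ∀ {q n} → .{{NonZero n}} → Prime q → q ∣ n → q ∈ primeDivisors n
∈-primeDivisors⁺ {zero}        {n} pr q∣n with prime-≥2 pr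
... | ()
∈-primeDivisors⁺ {suc zero}    {n} pr q∣n with prime-≥2 pr
... | s≤s ()
∈-primeDivisors⁺ {suc (suc k)} {n} pr q∣n =
  ∈-filter⁺ (λ p → prime? p ×-dec (p ∣? n)) {xs = candidates n}
    (∈-map⁺ (λ k → suc (suc k)) (∈-upTo⁺ (ℕP.≤-trans (s≤s (ℕP.n≤1+n k)) (∣.∣⇒≤ q∣n)))) (pr , q∣n)

primeDivisors-unique : ∀ n → Unique (primeDivisors n)
primeDivisors-unique n = Unique.filter⁺ (λ p → prime? p ×-dec (p ∣? n))
  (Unique.map⁺ (λ { ≡.refl → ≡.refl }) (Unique.upTo⁺ n))

-- Both lists are free of duplicates and have the same members, hence are permutations of each
-- other; the place where `p` appears does not matter.
length-primeDivisors-* : ∀ {p k} → .{{NonZero k}} → Prime p → ¬ p ∣ k →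
  length (primeDivisors (p ℕ.* k)) ≡ suc (length (primeDivisors k))
length-primeDivisors-* {p} {k} pr p∤k = ↭-length (∼bag⇒↭ (unique∧set⇒bag
  (primeDivisors-unique (p ℕ.* k)) (fresh AllPairs.∷ primeDivisors-unique k) (mk⇔ to from)))
  where
  instance
    p*k≢0 : NonZero (p ℕ.* k)
    p*k≢0 = ℕP.m*n≢0 p k {{prime⇒nonZero pr}}
  fresh = ¬Any⇒All¬ (primeDivisors k) (λ p∈ → p∤k (proj₂ (∈-primeDivisors⁻ p∈)))
  to : ∀ {q} → q ∈ primeDivisors (p ℕ.* k) → q ∈ p ∷ primeDivisors k
  to {q} q∈ with ∈-primeDivisors⁻ q∈
  ... | qr , q∣pk with euclidsLemma p k qr q∣pk
  ...   | inj₁ q∣p = here (prime-∣-prime pr qr q∣p)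
  ...   | inj₂ q∣k = there (∈-primeDivisors⁺ qr q∣k)
  from : ∀ {q} → q ∈ p ∷ primeDivisors k → q ∈ primeDivisors (p ℕ.* k)
  from (here ≡.refl) = ∈-primeDivisors⁺ pr (∣.m∣m*n k)
  from (there q∈) with ∈-primeDivisors⁻ q∈
  ... | qr , q∣k = ∈-primeDivisors⁺ qr (∣.∣n⇒∣m*n p q∣k)

T-does⁻ : ∀ {P : Set} (P? : Dec P) → T (does P?) → P
T-does⁻ (yes p) _ = p

T-does⁺ : ∀ {P : Set} (P? : Dec P) → P → T (does P?)
T-does⁺ P? p = subst T (≡.sym (dec-true P? p)) _

T-hasSquareFactor⁻ : ∀ n → T (hasSquareFactor n) → ∃ λ q → Prime q × q ℕ.* q ∣ n
T-hasSquareFactor⁻ n h with find (any⁻ (λ p → does ((p ℕ.* p) ∣? n)) (primeDivisors n) h)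
... | q , q∈ , q²∣n = q , proj₁ (∈-primeDivisors⁻ {n = n} q∈) , T-does⁻ ((q ℕ.* q) ∣? n) q²∣n

T-hasSquareFactor⁺ : ∀ n q → .{{NonZero n}} → Prime q → q ℕ.* q ∣ n → T (hasSquareFactor n)
T-hasSquareFactor⁺ n q qr q²∣n = any⁺ (λ p → does ((p ℕ.* p) ∣? n))
  (lose (∈-primeDivisors⁺ qr (∣.∣-trans (∣.m∣m*n q) q²∣n)) (T-does⁺ ((q ℕ.* q) ∣? n) q²∣n))

T-injective : ∀ {a b} → (T a → T b) → (T b → T a) → a ≡ b
T-injective {true}  {true}  f g = ≡.refl
T-injective {true}  {false} f g = ⊥-elim (f _)
T-injective {false} {true}  f g = ⊥-elim (g _)
T-injective {false} {false} f g = ≡.refl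

-- The defining clause of `μ` fires only on a literal successor, which a product such as `p ℕ.* k`
-- is not.
μ-nonZero : ∀ n → .{{NonZero n}} →
  μ n ≡ (if hasSquareFactor n then + 0 else signPow (length (primeDivisors n)))
μ-nonZero (suc n) = ≡.refl

μ-*-∣ : ∀ {p k} → Prime p → p ∣ k → μ (p ℕ.* k) ≡ + 0
μ-*-∣ {p} {zero}  pr p∣k = cong μ (ℕP.*-zeroʳ p)
μ-*-∣ {p} {k@(suc _)} pr p∣k = ≡.trans (μ-nonZero (p ℕ.* k)) (T-true square)
  where
  instance
    p*k≢0 : NonZero (p ℕ.* k)
    p*k≢0 = ℕP.m*n≢0 p k {{prime⇒nonZero pr}}
  square = T-hasSquareFactor⁺ (p ℕ.* k) p pr (∣.*-monoʳ-∣ p p∣k)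
  T-true : ∀ {b} {x y : ℤ} → T b → (if b then x else y) ≡ x
  T-true {true} _ = ≡.refl

-- One new prime divisor flips the sign, and no square factor is created: a prime q with q² ∣ p k is
-- either p, which forces p ∣ k, or prime to p, so that q² ∣ k already.
μ-*-∤ : ∀ {p k} → Prime p → ¬ p ∣ k → μ (p ℕ.* k) ≡ ℤ.- μ k
μ-*-∤ {p} {zero}  pr p∤k = cong μ (ℕP.*-zeroʳ p)
μ-*-∤ {p} {k@(suc _)} pr p∤k = begin
  μ (p ℕ.* k)                                                                      ≡⟨ μ-nonZero (p ℕ.* k) ⟩
  (if hasSquareFactor (p ℕ.* k) then + 0 else signPow (length (primeDivisors (p ℕ.* k))))
    ≡⟨ cong₂ (λ b l → if b then + 0 else signPow l) (T-injective to from) (length-primeDivisors-* pr p∤k) ⟩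
  (if hasSquareFactor k then + 0 else ℤ.- signPow (length (primeDivisors k)))      ≡⟨ neg-if (hasSquareFactor k) ⟩
  ℤ.- μ k                                                                          ∎
  where
  open ≡.≡-Reasoning
  instance
    p*k≢0 : NonZero (p ℕ.* k)
    p*k≢0 = ℕP.m*n≢0 p k {{prime⇒nonZero pr}}
  neg-if : ∀ b {x} → (if b then + 0 else ℤ.- x) ≡ ℤ.- (if b then + 0 else x)
  neg-if true  = ≡.refl
  neg-if false = ≡.refl
  to : T (hasSquareFactor (p ℕ.* k)) → T (hasSquareFactor k)
  to h with T-hasSquareFactor⁻ (p ℕ.* k) h
  ... | q , qr , q²∣pk with p ℕ.≟ q
  ...   | yes ≡.refl = ⊥-elim (p∤k (∣.*-cancelˡ-∣ p {{prime⇒nonZero pr}} q²∣pk))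
  ...   | no p≢q     = T-hasSquareFactor⁺ k q qr (∣p*n⇒∣n pr p∤q² q²∣pk)
    where
    p∤q : ¬ p ∣ q
    p∤q p∣q = p≢q (prime-∣-prime qr pr p∣q)
    p∤q² : ¬ p ∣ q ℕ.* q
    p∤q² p∣q² with euclidsLemma q q pr p∣q²
    ... | inj₁ p∣q = p∤q p∣q
    ... | inj₂ p∣q = p∤q p∣q
  from : T (hasSquareFactor k) → T (hasSquareFactor (p ℕ.* k))
  from h with T-hasSquareFactor⁻ k h
  ... | q , qr , q²∣k = T-hasSquareFactor⁺ (p ℕ.* k) q qr (∣.∣n⇒∣m*n p q²∣k)

-- The Iverson bracket, unfolding to the very conditional used in `doldSum`.
[_]_ : ∀ {P : Set} → Dec P → ℤ → ℤ
[ P? ] x = if does P? then x else + 0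

[]-yes : ∀ {P : Set} (P? : Dec P) {x} → P → [ P? ] x ≡ x
[]-yes P? {x} pf = cong (λ b → if b then x else + 0) (dec-true P? pf)

[]-no : ∀ {P : Set} (P? : Dec P) {x} → ¬ P → [ P? ] x ≡ + 0
[]-no P? {x} pf = cong (λ b → if b then x else + 0) (dec-false P? pf)

∑≤ : (ℕ → ℤ) → ℕ → ℤ
∑≤ f zero    = + 0
∑≤ f (suc n) = f (suc n) ℤ.+ ∑≤ f n

∑≤-cong : ∀ {f g} n → (∀ k → 1 ≤ k → k ≤ n → f k ≡ g k) → ∑≤ f n ≡ ∑≤ g n
∑≤-cong zero    eq = ≡.refl
∑≤-cong (suc n) eq = cong₂ ℤ._+_ (eq (suc n) (s≤s z≤n) ℕP.≤-refl)
  (∑≤-cong n (λ k 1≤k k≤n → eq k 1≤k (ℕP.m≤n⇒m≤1+n k≤n)))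

∑≤-+ : ∀ f g n → ∑≤ (λ k → f k ℤ.+ g k) n ≡ ∑≤ f n ℤ.+ ∑≤ g n
∑≤-+ f g zero    = ≡.refl
∑≤-+ f g (suc n) = ≡.trans (cong (ℤ._+_ ((f (suc n) ℤ.+ g (suc n)))) (∑≤-+ f g n))
  (solve 4 (λ a b x y → a :+ b :+ (x :+ y) := a :+ x :+ (b :+ y)) ≡.refl (f (suc n)) (g (suc n)) (∑≤ f n) (∑≤ g n))
  where open +-*-Solver

∑≤-* : ∀ c f n → ∑≤ (λ k → c ℤ.* f k) n ≡ c ℤ.* ∑≤ f n
∑≤-* c f zero    = ≡.sym (ℤP.*-zeroʳ c)
∑≤-* c f (suc n) = ≡.trans (cong (ℤ._+_ (c ℤ.* f (suc n))) (∑≤-* c f n)) (≡.sym (ℤP.*-distribˡ-+ c (f (suc n)) (∑≤ f n)))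

∑≤-0 : ∀ f n → (∀ k → 1 ≤ k → k ≤ n → f k ≡ + 0) → ∑≤ f n ≡ + 0
∑≤-0 f zero    eq = ≡.refl
∑≤-0 f (suc n) eq = cong₂ ℤ._+_ (eq (suc n) (s≤s z≤n) ℕP.≤-refl)
  (∑≤-0 f n (λ k 1≤k k≤n → eq k 1≤k (ℕP.m≤n⇒m≤1+n k≤n)))

∑≤-++ : ∀ f m n → ∑≤ f (n ℕ.+ m) ≡ ∑≤ (λ k → f (k ℕ.+ m)) n ℤ.+ ∑≤ f m
∑≤-++ f m zero    = ≡.sym (ℤP.+-identityˡ _)
∑≤-++ f m (suc n) = ≡.trans (cong (ℤ._+_ (f (suc n ℕ.+ m))) (∑≤-++ f m n))
  (≡.sym (ℤP.+-assoc (f (suc n ℕ.+ m)) _ _))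

∑≤-extend : ∀ f {m n} → m ≤ n → (∀ k → m < k → f k ≡ + 0) → ∑≤ f n ≡ ∑≤ f m
∑≤-extend f {m} {n} m≤n f≡0 = begin
  ∑≤ f n                                         ≡⟨ cong (∑≤ f) (ℕP.m∸n+n≡m m≤n) ⟨
  ∑≤ f (n ℕ.∸ m ℕ.+ m)                           ≡⟨ ∑≤-++ f m (n ℕ.∸ m) ⟩
  ∑≤ (λ k → f (k ℕ.+ m)) (n ℕ.∸ m) ℤ.+ ∑≤ f m    ≡⟨ cong (ℤ._+ ∑≤ f m) (∑≤-0 _ (n ℕ.∸ m) (λ k 1≤k _ → f≡0 _ (ℕP.+-monoˡ-≤ m 1≤k))) ⟩
  + 0 ℤ.+ ∑≤ f m                                 ≡⟨ ℤP.+-identityˡ _ ⟩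
  ∑≤ f m                                         ∎
  where open ≡.≡-Reasoning

∑≤-∣ : ∀ {p f} n → (∀ k → 1 ≤ k → k ≤ n → p ∣ℤ.∣ f k) → p ∣ℤ.∣ ∑≤ f n
∑≤-∣ {p} zero    p∣f = ∣ℤ.divides (+ 0) ≡.refl
∑≤-∣ {p} (suc n) p∣f = ∣ℤ.∣m∣n⇒∣m+n (p∣f (suc n) (s≤s z≤n) ℕP.≤-refl)
  (∑≤-∣ n (λ k 1≤k k≤n → p∣f k 1≤k (ℕP.m≤n⇒m≤1+n k≤n)))

-- Of each block of `p` consecutive indices only the last is a multiple of `p`.
∑≤-multiples : ∀ p .{{_ : NonZero p}} f → (∀ k → ¬ p ∣ k → f k ≡ + 0) →
  ∀ m → ∑≤ f (m ℕ.* p) ≡ ∑≤ (λ k → f (k ℕ.* p)) m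
∑≤-multiples p@(suc q) f f≡0 zero    = ≡.refl
∑≤-multiples p@(suc q) f f≡0 (suc m) = begin
  f (p ℕ.+ m ℕ.* p) ℤ.+ ∑≤ f (q ℕ.+ m ℕ.* p)
    ≡⟨ cong (ℤ._+_ (f (p ℕ.+ m ℕ.* p))) (∑≤-++ f (m ℕ.* p) q) ⟩
  f (p ℕ.+ m ℕ.* p) ℤ.+ (∑≤ (λ k → f (k ℕ.+ m ℕ.* p)) q ℤ.+ ∑≤ f (m ℕ.* p))
    ≡⟨ cong (λ s → f (p ℕ.+ m ℕ.* p) ℤ.+ (s ℤ.+ ∑≤ f (m ℕ.* p))) (∑≤-0 _ q (λ k 1≤k k≤q → f≡0 _ (λ p∣ →
         ∣.>⇒∤ {{ℕ.>-nonZero 1≤k}} (s≤s k≤q) (∣.∣m+n∣m⇒∣n (subst (p ∣_) (ℕP.+-comm k (m ℕ.* p)) p∣) (∣.n∣m*n m))))) ⟩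
  f (p ℕ.+ m ℕ.* p) ℤ.+ (+ 0 ℤ.+ ∑≤ f (m ℕ.* p))
    ≡⟨ cong (ℤ._+_ (f (p ℕ.+ m ℕ.* p))) (≡.trans (ℤP.+-identityˡ _) (∑≤-multiples p f f≡0 m)) ⟩
  f (p ℕ.+ m ℕ.* p) ℤ.+ ∑≤ (λ k → f (k ℕ.* p)) m ∎
  where open ≡.≡-Reasoning

möbiusTerm : (ℕ → ℤ) → ℕ → ℕ → ℤ
möbiusTerm F n k = [ k ∣? n ] (μ k ℤ.* F k)

-- The weight is a function of the divisor k itself, so that both F = 1 and F k = A (n / k) are
-- instances.
∑∣ : (ℕ → ℤ) → ℕ → ℤ
∑∣ F n = ∑≤ (möbiusTerm F n) n

-- Pairing k with p k: only the k prime to p survive, since μ(p k) is − μ(k) or 0.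
∑∣-prime-* : ∀ {p} → Prime p → ∀ F n →
  ∑∣ F (n ℕ.* p) ≡ ∑≤ (λ k → if does (p ∣? k) then + 0 else möbiusTerm (λ k → F k ℤ.- F (p ℕ.* k)) n k) n
∑∣-prime-* {p} pr F zero = ≡.refl
∑∣-prime-* {p} pr F n@(suc _) = begin
  ∑≤ h (n ℕ.* p)                                        ≡⟨ ∑≤-cong (n ℕ.* p) (λ k _ _ → split k) ⟩
  ∑≤ (λ k → away k ℤ.+ multiple k) (n ℕ.* p)            ≡⟨ ∑≤-+ away multiple (n ℕ.* p) ⟩
  ∑≤ away (n ℕ.* p) ℤ.+ ∑≤ multiple (n ℕ.* p)           ≡⟨ cong₂ ℤ._+_ (∑≤-extend away (ℕP.m≤m*n n p) away-0) (∑≤-multiples p multiple multiple-0 n) ⟩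
  ∑≤ away n ℤ.+ ∑≤ (λ k → multiple (k ℕ.* p)) n         ≡⟨ ∑≤-+ away (λ k → multiple (k ℕ.* p)) n ⟨
  ∑≤ (λ k → away k ℤ.+ multiple (k ℕ.* p)) n            ≡⟨ ∑≤-cong n (λ k _ _ → combine k) ⟩
  ∑≤ (λ k → if does (p ∣? k) then + 0 else möbiusTerm (λ k → F k ℤ.- F (p ℕ.* k)) n k) n ∎
  where
  open ≡.≡-Reasoning
  instance
    p≢0 : NonZero p
    p≢0 = prime⇒nonZero pr
  h = möbiusTerm F (n ℕ.* p)
  away multiple : ℕ → ℤ
  away k     = if does (p ∣? k) then + 0 else h k
  multiple k = if does (p ∣? k) then h k else + 0
  split : ∀ k → h k ≡ away k ℤ.+ multiple k
  split k with does (p ∣? k)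
  ... | true  = ≡.sym (ℤP.+-identityˡ _)
  ... | false = ≡.sym (ℤP.+-identityʳ _)
  multiple-0 : ∀ k → ¬ p ∣ k → multiple k ≡ + 0
  multiple-0 k = []-no (p ∣? k)
  ∣n*p⇒∣n : ∀ {k} → ¬ p ∣ k → k ∣ n ℕ.* p → k ∣ n
  ∣n*p⇒∣n {k} p∤k k∣ = ∣p*n⇒∣n pr p∤k (subst (k ∣_) (ℕP.*-comm n p) k∣)
  away-0 : ∀ k → n < k → away k ≡ + 0
  away-0 k n<k with p ∣? k
  ... | yes _   = ≡.refl
  ... | no  p∤k = []-no (k ∣? (n ℕ.* p)) (λ k∣ → ∣.>⇒∤ n<k (∣n*p⇒∣n p∤k k∣))
  combine : ∀ k → away k ℤ.+ multiple (k ℕ.* p) ≡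
    (if does (p ∣? k) then + 0 else möbiusTerm (λ k → F k ℤ.- F (p ℕ.* k)) n k)
  combine k with []-yes (p ∣? (k ℕ.* p)) {h (k ℕ.* p)} (∣.n∣m*n k) | p ∣? k
  ... | eq | yes p∣k = begin
    + 0 ℤ.+ multiple (k ℕ.* p)                        ≡⟨ cong (ℤ._+_ (+ 0)) eq ⟩
    + 0 ℤ.+ h (k ℕ.* p)                               ≡⟨ ℤP.+-identityˡ _ ⟩
    [ (k ℕ.* p) ∣? (n ℕ.* p) ] (μ (k ℕ.* p) ℤ.* F (k ℕ.* p))
      ≡⟨ cong (λ m → [ (k ℕ.* p) ∣? (n ℕ.* p) ] (m ℤ.* F (k ℕ.* p))) (≡.trans (cong μ (ℕP.*-comm k p)) (μ-*-∣ pr p∣k)) ⟩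
    [ (k ℕ.* p) ∣? (n ℕ.* p) ] (+ 0)                  ≡⟨ if-0 (does ((k ℕ.* p) ∣? (n ℕ.* p))) ⟩
    + 0                                               ∎
    where
    if-0 : ∀ b → (if b then + 0 else + 0) ≡ + 0
    if-0 true  = ≡.refl
    if-0 false = ≡.refl
  ... | eq | no p∤k with k ∣? n
  ...   | yes k∣n = begin
    h k ℤ.+ multiple (k ℕ.* p)
      ≡⟨ cong₂ ℤ._+_ ([]-yes (k ∣? (n ℕ.* p)) (∣.∣m⇒∣m*n p k∣n)) (≡.trans eq ([]-yes ((k ℕ.* p) ∣? (n ℕ.* p)) (∣.*-monoˡ-∣ p k∣n))) ⟩
    μ k ℤ.* F k ℤ.+ μ (k ℕ.* p) ℤ.* F (k ℕ.* p)
      ≡⟨ cong (λ m → μ k ℤ.* F k ℤ.+ μ m ℤ.* F m) (ℕP.*-comm k p) ⟩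
    μ k ℤ.* F k ℤ.+ μ (p ℕ.* k) ℤ.* F (p ℕ.* k)
      ≡⟨ cong (λ m → μ k ℤ.* F k ℤ.+ m ℤ.* F (p ℕ.* k)) (μ-*-∤ pr p∤k) ⟩
    μ k ℤ.* F k ℤ.+ ℤ.- μ k ℤ.* F (p ℕ.* k)
      ≡⟨ solve 3 (λ m x y → m :* x :+ (:- m) :* y := m :* (x :- y)) ≡.refl (μ k) (F k) (F (p ℕ.* k)) ⟩
    μ k ℤ.* (F k ℤ.- F (p ℕ.* k)) ∎
    where open +-*-Solver
  ...   | no k∤n = cong₂ ℤ._+_ ([]-no (k ∣? (n ℕ.* p)) (λ k∣ → k∤n (∣n*p⇒∣n p∤k k∣)))
    (≡.trans eq ([]-no ((k ℕ.* p) ∣? (n ℕ.* p)) (λ k∣ → k∤n (∣.*-cancelʳ-∣ p k∣))))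

primeDivisor : ∀ n → 2 ≤ n → ∃ λ p → Prime p × p ∣ n
primeDivisor n@(suc _) 2≤n with factorise n
... | record { factors = []     ; isFactorisation = ≡.refl } with 2≤n
...   | s≤s ()
primeDivisor n@(suc _) 2≤n | record { factors = p ∷ ps ; isFactorisation = eq ; factorsPrime = pr ∷ _ } =
  p , pr , divides (product ps) (≡.trans eq (ℕP.*-comm p (product ps)))

-- For a prime p dividing n, the differences F k - F (p k) left by `∑∣-prime-*` vanish because F is
-- constant.
∑∣-μ : ∀ n → 2 ≤ n → ∑∣ (λ _ → + 1) n ≡ + 0
∑∣-μ n 2≤n with primeDivisor n 2≤n
... | p , pr , divides m ≡.refl = ≡.trans (∑∣-prime-* pr (λ _ → + 1) m) (∑≤-0 _ m (λ k _ _ → zero-term k))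
  where
  zero-term : ∀ k → (if does (p ∣? k) then + 0 else möbiusTerm (λ k → + 1 ℤ.- + 1) m k) ≡ + 0
  zero-term k with does (p ∣? k) | does (k ∣? m)
  ... | true  | _     = ≡.refl
  ... | false | true  = ℤP.*-zeroʳ (μ k)
  ... | false | false = ≡.refl

-- Dold sums

-- The summation loop local to doldSum, exposed as doldPartial by unification.
mutual
  doldPartialDiagonal : (ℕ → ℤ) → ℕ → ℤ
  doldPartialDiagonal = _

  doldSum-suc : ∀ A m → doldSum A (suc m) ≡ [ suc m ∣? suc m ] (μ (suc m) ℤ.* A (suc m / suc m)) ℤ.+ doldPartialDiagonal A m
  doldSum-suc A m = ≡.refl

mutual
  doldPartial : (ℕ → ℤ) → ℕ → ℕ → ℤ
  doldPartial = _

  doldPartial-diagonal : ∀ A m → doldPartialDiagonal A m ≡ doldPartial A (suc m) m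
  -- On the diagonal the bound and the loop counter are tied; replacing `suc m` by a variable
  -- separates them, so that unification determines the loop with a free bound.
  doldPartial-diagonal A m with suc m
  ... | n = ≡.refl

-- Division made total, so that it can stand under a sum over a bare index; the sums start at 1, so
-- the default at 0 is never a summand.
_div_ : ℕ → ℕ → ℕ
n div zero      = 0
n div k@(suc _) = n / k

doldSum≡∑∣ : ∀ A n → doldSum A n ≡ ∑∣ (λ k → A (n div k)) n
doldSum≡∑∣ A n = partial n
  where
  partial : ∀ j → doldPartial A n j ≡ ∑≤ (möbiusTerm (λ k → A (n div k)) n) j
  partial zero    = ≡.refl
  partial (suc j) = cong (ℤ._+_ ([ suc j ∣? n ] (μ (suc j) ℤ.* A (n / suc j)))) (partial j)

möbiusTerm-elim : ∀ (Q : ℤ → Set) F n k → (k ∣ n → Q (μ k ℤ.* F k)) → (¬ k ∣ n → Q (+ 0)) → Q (möbiusTerm F n k)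
möbiusTerm-elim Q F n k y n′ with k ∣? n
... | yes k∣n = y k∣n
... | no  k∤n = n′ k∤n

möbiusTerm-cong : ∀ F G n k → (k ∣ n → F k ≡ G k) → möbiusTerm F n k ≡ möbiusTerm G n k
möbiusTerm-cong F G n k eq with k ∣? n
... | yes k∣n = cong (μ k ℤ.*_) (eq k∣n)
... | no  _   = ≡.refl

div-* : ∀ m k .{{_ : NonZero k}} → (m ℕ.* k) div k ≡ m
div-* m k@(suc _) = DivMod.m*n/n≡m m k

-- For a divisor k of n the quotient n / k lies between 1 and n. In particular the value at 0 may be
-- changed freely.
doldSum-cong : ∀ {A B} n → (∀ m → 1 ≤ m → m ≤ n → A m ≡ B m) → doldSum A n ≡ doldSum B n
doldSum-cong {A} {B} n eq = begin
  doldSum A n                      ≡⟨ doldSum≡∑∣ A n ⟩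
  ∑∣ (λ k → A (n div k)) n         ≡⟨ ∑≤-cong n (λ k 1≤k k≤n → möbiusTerm-cong (λ k → A (n div k)) (λ k → B (n div k)) n k (term k 1≤k k≤n)) ⟩
  ∑∣ (λ k → B (n div k)) n         ≡⟨ doldSum≡∑∣ B n ⟨
  doldSum B n                      ∎
  where
  open ≡.≡-Reasoning
  term : ∀ k → 1 ≤ k → k ≤ n → k ∣ n → A (n div k) ≡ B (n div k)
  term k@(suc _) 1≤k k≤n k∣n = eq (n / k) (DivMod.m≥n⇒m/n>0 k≤n) (DivMod.m/n≤m n k)

doldSum-+ : ∀ A B n → doldSum (λ m → A m ℤ.+ B m) n ≡ doldSum A n ℤ.+ doldSum B n
doldSum-+ A B n = begin
  doldSum (λ m → A m ℤ.+ B m) n                            ≡⟨ doldSum≡∑∣ _ n ⟩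
  ∑∣ (λ k → A (n div k) ℤ.+ B (n div k)) n                 ≡⟨ ∑≤-cong n (λ k _ _ → term k) ⟩
  ∑≤ (λ k → möbiusTerm (λ k → A (n div k)) n k ℤ.+ möbiusTerm (λ k → B (n div k)) n k) n
                                                           ≡⟨ ∑≤-+ _ _ n ⟩
  ∑∣ (λ k → A (n div k)) n ℤ.+ ∑∣ (λ k → B (n div k)) n    ≡⟨ cong₂ ℤ._+_ (doldSum≡∑∣ A n) (doldSum≡∑∣ B n) ⟨
  doldSum A n ℤ.+ doldSum B n                              ∎
  where
  open ≡.≡-Reasoning
  term : ∀ k → möbiusTerm (λ k → A (n div k) ℤ.+ B (n div k)) n k ≡
    möbiusTerm (λ k → A (n div k)) n k ℤ.+ möbiusTerm (λ k → B (n div k)) n k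
  term k with does (k ∣? n)
  ... | true  = ℤP.*-distribˡ-+ (μ k) _ _
  ... | false = ≡.refl

doldSum-* : ∀ c A n → doldSum (λ m → c ℤ.* A m) n ≡ c ℤ.* doldSum A n
doldSum-* c A n = begin
  doldSum (λ m → c ℤ.* A m) n                          ≡⟨ doldSum≡∑∣ _ n ⟩
  ∑∣ (λ k → c ℤ.* A (n div k)) n                       ≡⟨ ∑≤-cong n (λ k _ _ → term k) ⟩
  ∑≤ (λ k → c ℤ.* möbiusTerm (λ k → A (n div k)) n k) n ≡⟨ ∑≤-* c _ n ⟩
  c ℤ.* ∑∣ (λ k → A (n div k)) n                       ≡⟨ cong (c ℤ.*_) (doldSum≡∑∣ A n) ⟨
  c ℤ.* doldSum A n                                    ∎
  where
  open ≡.≡-Reasoning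
  open +-*-Solver
  term : ∀ k → möbiusTerm (λ k → c ℤ.* A (n div k)) n k ≡ c ℤ.* möbiusTerm (λ k → A (n div k)) n k
  term k with does (k ∣? n)
  ... | true  = solve 3 (λ m c x → m :* (c :* x) := c :* (m :* x)) ≡.refl (μ k) c (A (n div k))
  ... | false = ≡.sym (ℤP.*-zeroʳ c)

-- As p ∤ m, every divisor k of m survives the condition p ∤ k in `∑∣-prime-*`; dividing m p by k
-- and by p k gives the arguments (m / k) p and m / k of the difference.
doldSum-prime-* : ∀ {p m} → Prime p → ¬ p ∣ m → ∀ A →
  doldSum A (m ℕ.* p) ≡ doldSum (λ j → A (j ℕ.* p) ℤ.- A j) m
doldSum-prime-* {p} {m} pr p∤m A = begin
  doldSum A (m ℕ.* p)                                          ≡⟨ doldSum≡∑∣ A (m ℕ.* p) ⟩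
  ∑∣ F (m ℕ.* p)                                               ≡⟨ ∑∣-prime-* pr F m ⟩
  ∑≤ (λ k → if does (p ∣? k) then + 0 else möbiusTerm (λ k → F k ℤ.- F (p ℕ.* k)) m k) m
                                                               ≡⟨ ∑≤-cong m (λ k 1≤k _ → term k {{ℕ.>-nonZero 1≤k}}) ⟩
  ∑∣ (λ k → A ((m div k) ℕ.* p) ℤ.- A (m div k)) m             ≡⟨ doldSum≡∑∣ _ m ⟨
  doldSum (λ j → A (j ℕ.* p) ℤ.- A j) m                        ∎
  where
  open ≡.≡-Reasoning
  instance
    p≢0 : NonZero p
    p≢0 = prime⇒nonZero pr
  F : ℕ → ℤ
  F k = A ((m ℕ.* p) div k)
  term : ∀ k .{{_ : NonZero k}} → (if does (p ∣? k) then + 0 else möbiusTerm (λ k → F k ℤ.- F (p ℕ.* k)) m k) ≡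
    möbiusTerm (λ k → A ((m div k) ℕ.* p) ℤ.- A (m div k)) m k
  term k with k ∣? m
  ... | no _ with does (p ∣? k)
  ...   | true  = ≡.refl
  ...   | false = ≡.refl
  term k | yes (divides q ≡.refl) = begin
    (if does (p ∣? k) then + 0 else μ k ℤ.* (F k ℤ.- F (p ℕ.* k)))
      ≡⟨ cong (λ b → if b then + 0 else μ k ℤ.* (F k ℤ.- F (p ℕ.* k))) (dec-false (p ∣? k) (λ p∣k → p∤m (∣.∣n⇒∣m*n q p∣k))) ⟩
    μ k ℤ.* (A ((q ℕ.* k ℕ.* p) div k) ℤ.- A ((q ℕ.* k ℕ.* p) div (p ℕ.* k)))
      ≡⟨ cong₂ (λ x y → μ k ℤ.* (A x ℤ.- A y)) div₁ div₂ ⟩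
    μ k ℤ.* (A (q ℕ.* p) ℤ.- A q)
      ≡⟨ cong (λ x → μ k ℤ.* (A (x ℕ.* p) ℤ.- A x)) (div-* q k) ⟨
    μ k ℤ.* (A (((q ℕ.* k) div k) ℕ.* p) ℤ.- A ((q ℕ.* k) div k)) ∎
    where
    div₁ : (q ℕ.* k ℕ.* p) div k ≡ q ℕ.* p
    div₁ = ≡.trans (cong (_div k) (≡.trans (ℕP.*-assoc q k p) (≡.trans (cong (q ℕ.*_) (ℕP.*-comm k p)) (≡.sym (ℕP.*-assoc q p k)))))
      (div-* (q ℕ.* p) k)
    div₂ : (q ℕ.* k ℕ.* p) div (p ℕ.* k) ≡ q
    div₂ = ≡.trans (cong (_div (p ℕ.* k)) (≡.trans (ℕP.*-assoc q k p) (cong (q ℕ.*_) (ℕP.*-comm k p))))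
      (div-* q (p ℕ.* k) {{ℕP.m*n≢0 p k}})

-- Strong induction on m. The number p divides Σ μ(k) B(m / k) over k ∣ m, where B j = A(j p) -
-- A(j), and by induction every term with k ≥ 2; what remains is B m.
dold⇒prime-congruence : ∀ {A p} → Prime p → Dold A → ∀ m → 1 ≤ m → m < p →
  + p ∣ℤ.∣ A (m ℕ.* p) ℤ.- A m
dold⇒prime-congruence {A} {p} pr dold = <-rec _ step
  where
  B : ℕ → ℤ
  B j = A (j ℕ.* p) ℤ.- A j
  step : ∀ m → (∀ {j} → j < m → 1 ≤ j → j < p → + p ∣ℤ.∣ B j) → 1 ≤ m → m < p → + p ∣ℤ.∣ B m
  step m@(suc m-1) rec 1≤m m<p = subst (+ p ∣ℤ.∣_) f1≡Bm
    (∣ℤ.∣m+n∣m⇒∣n (subst (+ p ∣ℤ.∣_) expand p∣∑) (∑≤-∣ m-1 (λ k 1≤k _ → small (k ℕ.+ 1) (ℕP.+-monoˡ-≤ 1 1≤k))))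
    where
    open ≡.≡-Reasoning
    f = möbiusTerm (λ k → B (m div k)) m
    p∣∑ : + p ∣ℤ.∣ doldSum B m
    p∣∑ = subst (+ p ∣ℤ.∣_) (doldSum-prime-* pr (∣.>⇒∤ m<p) A)
      (∣ℤ.∣-trans (∣ℤ.divides (+ m) (ℤP.pos-* m p)) (∣ℤ.∣ᵤ⇒∣ (dold (m ℕ.* p) (ℕP.m*n≢0 m p {{_}} {{prime⇒nonZero pr}}))))
    expand : doldSum B m ≡ ∑≤ (λ k → f (k ℕ.+ 1)) m-1 ℤ.+ (f 1 ℤ.+ + 0)
    expand = ≡.trans (doldSum≡∑∣ B m) (≡.trans (cong (∑≤ f) (ℕP.+-comm 1 m-1)) (∑≤-++ f 1 m-1))
    f1≡Bm : f 1 ℤ.+ + 0 ≡ B m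
    f1≡Bm = begin
      f 1 ℤ.+ + 0       ≡⟨ ℤP.+-identityʳ _ ⟩
      f 1               ≡⟨ []-yes (1 ∣? m) (∣.1∣ m) ⟩
      + 1 ℤ.* B (m / 1) ≡⟨ ℤP.*-identityˡ _ ⟩
      B (m / 1)         ≡⟨ cong B (DivMod.n/1≡n m) ⟩
      B m               ∎
    small : ∀ k → 2 ≤ k → + p ∣ℤ.∣ f k
    small k@(suc _) 2≤k = möbiusTerm-elim (+ p ∣ℤ.∣_) (λ k → B (m div k)) m k
      (λ k∣m → ∣ℤ.∣n⇒∣m*n (μ k) (rec m/k<m (DivMod.m≥n⇒m/n>0 (∣.∣⇒≤ k∣m)) (ℕP.<-trans m/k<m m<p)))
      (λ _ → ∣ℤ.divides (+ 0) ≡.refl)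
      where
      m/k<m = DivMod.m/n<m m k 2≤k

-- −x d/dx log (1 − xᴺ) = Σ_{j ≥ 1} N x^{jN}
cyclic : ℕ → ℕ → ℤ
cyclic N zero      = + 0
cyclic N n@(suc _) = [ N ∣? n ] (+ N)

cyclic-nonZero : ∀ N n .{{_ : NonZero n}} → cyclic N n ≡ [ N ∣? n ] (+ N)
cyclic-nonZero N (suc n) = ≡.refl

-- If N ∤ n, no n / k is a multiple of N. If n = q N, the surviving k are the divisors of q, so the
-- Dold sum is N Σ μ(k) over k ∣ q: this is N = n for q = 1 and 0 for q ≥ 2.
cyclic-dold : ∀ N .{{_ : NonZero N}} n .{{_ : NonZero n}} → + n ∣ℤ.∣ doldSum (cyclic N) n
cyclic-dold N n with N ∣? n
... | no N∤n = ∣ℤ.divides (+ 0) (≡.trans (doldSum≡∑∣ (cyclic N) n) (∑≤-0 _ n term))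
  where
  term : ∀ k → 1 ≤ k → k ≤ n → möbiusTerm (λ k → cyclic N (n div k)) n k ≡ + 0
  term k@(suc _) _ k≤n = möbiusTerm-elim (_≡ + 0) (λ k → cyclic N (n div k)) n k
    (λ k∣n → ≡.trans (cong (μ k ℤ.*_) (≡.trans (cyclic-nonZero N (n / k) {{ℕ.>-nonZero (DivMod.m≥n⇒m/n>0 k≤n)}})
    ([]-no (N ∣? (n / k)) (λ N∣ → N∤n (∣.∣-trans N∣ (∣.m/n∣m k∣n)))))) (ℤP.*-zeroʳ (μ k)))
    (λ _ → ≡.refl)
... | yes (divides q ≡.refl) = final q ≡.refl
  where
  term : ∀ k → 1 ≤ k → k ≤ q ℕ.* N → möbiusTerm (λ k → cyclic N ((q ℕ.* N) div k)) (q ℕ.* N) k ≡ + N ℤ.* möbiusTerm (λ _ → + 1) q k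
  term k@(suc _) _ k≤n = möbiusTerm-elim
    (λ x → möbiusTerm (λ k → cyclic N ((q ℕ.* N) div k)) (q ℕ.* N) k ≡ + N ℤ.* x) (λ _ → + 1) q k
    (λ k∣q → begin
      [ k ∣? (q ℕ.* N) ] (μ k ℤ.* cyclic N (q ℕ.* N / k))
        ≡⟨ []-yes (k ∣? (q ℕ.* N)) (∣.∣m⇒∣m*n N k∣q) ⟩
      μ k ℤ.* cyclic N (q ℕ.* N / k)
        ≡⟨ cong (μ k ℤ.*_) (≡.trans cyclic-n/k ([]-yes (N ∣? _) (∣.m*n∣o⇒n∣o/m k N (∣.*-monoˡ-∣ N k∣q)))) ⟩
      μ k ℤ.* + N
        ≡⟨ solve 2 (λ m n → m :* n := n :* (m :* con (+ 1))) ≡.refl (μ k) (+ N) ⟩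
      + N ℤ.* (μ k ℤ.* + 1) ∎)
    (λ k∤q → ≡.trans (möbiusTerm-elim (_≡ + 0) (λ k → cyclic N ((q ℕ.* N) div k)) (q ℕ.* N) k
      (λ k∣n → ≡.trans (cong (μ k ℤ.*_) (≡.trans cyclic-n/k
        ([]-no (N ∣? _) (λ N∣ → k∤q (∣.*-cancelʳ-∣ N (∣.m∣n/o⇒o*m∣n k∣n N∣))))))
        (ℤP.*-zeroʳ (μ k)))
      (λ _ → ≡.refl)) (≡.sym (ℤP.*-zeroʳ (+ N))))
    where
    open ≡.≡-Reasoning
    open +-*-Solver
    cyclic-n/k : cyclic N (q ℕ.* N / k) ≡ [ N ∣? (q ℕ.* N / k) ] (+ N)
    cyclic-n/k = cyclic-nonZero N _ {{ℕ.>-nonZero (DivMod.m≥n⇒m/n>0 k≤n)}}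
  sum-eq : .{{_ : NonZero q}} → doldSum (cyclic N) (q ℕ.* N) ≡ + N ℤ.* ∑∣ (λ _ → + 1) q
  sum-eq = begin
    doldSum (cyclic N) (q ℕ.* N)                                ≡⟨ doldSum≡∑∣ (cyclic N) (q ℕ.* N) ⟩
    ∑∣ (λ k → cyclic N ((q ℕ.* N) div k)) (q ℕ.* N)             ≡⟨ ∑≤-cong (q ℕ.* N) term ⟩
    ∑≤ (λ k → + N ℤ.* möbiusTerm (λ _ → + 1) q k) (q ℕ.* N)     ≡⟨ ∑≤-* (+ N) _ (q ℕ.* N) ⟩
    + N ℤ.* ∑≤ (möbiusTerm (λ _ → + 1) q) (q ℕ.* N)             ≡⟨ cong (+ N ℤ.*_) (∑≤-extend _ (ℕP.m≤m*n q N) (λ k q<k → []-no (k ∣? q) (∣.>⇒∤ q<k))) ⟩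
    + N ℤ.* ∑∣ (λ _ → + 1) q                                    ∎
    where open ≡.≡-Reasoning
  final : ∀ q′ → q′ ≡ q → + (q ℕ.* N) ∣ℤ.∣ doldSum (cyclic N) (q ℕ.* N)
  final zero          ≡.refl = ∣ℤ.divides (+ 0) ≡.refl
  final (suc zero)    ≡.refl = ∣ℤ.divides (+ 1) (≡.trans sum-eq (≡.trans (ℤP.*-comm (+ N) (+ 1)) (cong (λ n → + 1 ℤ.* + n) (≡.sym (ℕP.*-identityˡ N)))))
  final (suc (suc _)) ≡.refl = ∣ℤ.divides (+ 0) (≡.trans sum-eq (≡.trans (cong (+ N ℤ.*_) (∑∣-μ q (s≤s (s≤s z≤n)))) (ℤP.*-zeroʳ (+ N))))

-- Dold congruences for logarithmic derivatives of integral series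

module ℤSeries = Series ℤP.+-*-commutativeRing

module GaussCongruence where
  open ℤSeries using (conv; δ; LogDerivative)

  open import Algebra.Properties.Semiring.Mult ℤP.+-*-semiring using () renaming (_×_ to _·_)

  n·1≡n : ∀ n → n · (+ 1) ≡ + n
  n·1≡n zero    = ≡.refl
  n·1≡n (suc n) = cong (ℤ._+_ (+ 1)) (n·1≡n n)

  -- Multiplication of a series by xᴺ.
  shiftBy : ℕ → (ℕ → ℤ) → ℕ → ℤ
  shiftBy zero    f n       = f n
  shiftBy (suc N) f zero    = + 0
  shiftBy (suc N) f (suc n) = shiftBy N f n

  shiftBy-< : ∀ {N n} f → n < N → shiftBy N f n ≡ + 0
  shiftBy-< {suc N} {zero}  f n<N       = ≡.refl
  shiftBy-< {suc N} {suc n} f (s≤s n<N) = shiftBy-< f n<N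

  shiftBy-+ : ∀ N f m → shiftBy N f (N ℕ.+ m) ≡ f m
  shiftBy-+ zero    f m = ≡.refl
  shiftBy-+ (suc N) f m = shiftBy-+ N f m

  one : ℕ → ℤ
  one zero    = + 1
  one (suc _) = + 0

  conv-one : ∀ f n → conv one f n ≡ f n
  conv-one f n = ≡.trans (ℤSeries.conv-constˡ one f n (λ { (suc _) _ _ → ≡.refl })) (ℤP.*-identityˡ (f n))

  conv-shiftBy-one : ∀ N f n → conv (shiftBy N one) f n ≡ shiftBy N f n
  conv-shiftBy-one zero    f n       = conv-one f n
  conv-shiftBy-one (suc N) f zero    = ≡.refl
  conv-shiftBy-one (suc N) f (suc n) = ≡.trans (ℤP.+-identityˡ _) (conv-shiftBy-one N f n)

  oneMinusPower : ℕ → ℕ → ℤ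
  oneMinusPower N n = one n ℤ.+ ℤ.- shiftBy N one n

  conv-oneMinusPower : ∀ N f n → conv f (oneMinusPower N) n ≡ f n ℤ.- shiftBy N f n
  conv-oneMinusPower N f n = begin
    conv f (oneMinusPower N) n                                 ≡⟨ ℤSeries.conv-comm f (oneMinusPower N) n ⟩
    conv (oneMinusPower N) f n                                 ≡⟨ ℤSeries.conv-distribʳ one (λ k → ℤ.- shiftBy N one k) f n ⟩
    conv one f n ℤ.+ conv (λ k → ℤ.- shiftBy N one k) f n      ≡⟨ cong₂ ℤ._+_ (conv-one f n) (ℤSeries.conv-negˡ (shiftBy N one) f n) ⟩
    f n ℤ.- conv (shiftBy N one) f n                           ≡⟨ cong (λ x → f n ℤ.- x) (conv-shiftBy-one N f n) ⟩
    f n ℤ.- shiftBy N f n                                      ∎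
    where open ≡.≡-Reasoning

  -- Multiplying by 1 - xᴺ subtracts the shift by N. As `cyclic N` vanishes below N and has period N
  -- on positive indices, only the coefficient at N survives.
  logDerivative-oneMinusPower : ∀ N .{{_ : NonZero N}} → LogDerivative (cyclic N) (oneMinusPower N)
  logDerivative-oneMinusPower N n = begin
    conv (cyclic N) (oneMinusPower N) n       ≡⟨ conv-oneMinusPower N (cyclic N) n ⟩
    cyclic N n ℤ.- shiftBy N (cyclic N) n     ≡⟨ pointwise n (ℕP.<-≤-connex n N) ⟩
    ℤ.- (+ n ℤ.* oneMinusPower N n)           ≡⟨ cong (λ x → ℤ.- (x ℤ.* oneMinusPower N n)) (n·1≡n n) ⟨
    ℤ.- δ (oneMinusPower N) n                 ∎
    where
    open ≡.≡-Reasoning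
    open +-*-Solver
    -- At m = 0 periodicity fails, because `cyclic N 0` is 0 and not N; this produces the one
    -- nonzero coefficient.
    above : ∀ N .{{_ : NonZero N}} m → cyclic N (N ℕ.+ m) ℤ.- cyclic N m ≡ ℤ.- (+ (N ℕ.+ m) ℤ.* (one (N ℕ.+ m) ℤ.- one m))
    above N@(suc _) zero    = begin
      [ N ∣? (N ℕ.+ 0) ] (+ N) ℤ.- + 0                    ≡⟨ cong (ℤ._- + 0) ([]-yes (N ∣? (N ℕ.+ 0)) (∣.∣-reflexive (≡.sym (ℕP.+-identityʳ N)))) ⟩
      + N ℤ.- + 0                                         ≡⟨ solve 1 (λ x → x :- con (+ 0) := :- (x :* con (ℤ.- (+ 1)))) ≡.refl (+ N) ⟩
      ℤ.- (+ N ℤ.* ℤ.- (+ 1))                             ≡⟨ cong (λ k → ℤ.- (+ k ℤ.* ℤ.- (+ 1))) (ℕP.+-identityʳ N) ⟨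
      ℤ.- (+ (N ℕ.+ 0) ℤ.* ℤ.- (+ 1))                     ∎
    above N@(suc _) m@(suc _) = ≡.trans (ℤP.i≡j⇒i-j≡0 periodic)
      (≡.sym (cong ℤ.-_ (ℤP.*-zeroʳ (+ (N ℕ.+ m)))))
      where
      periodic : [ N ∣? (N ℕ.+ m) ] (+ N) ≡ [ N ∣? m ] (+ N)
      periodic = by (N ∣? m)
        where
        by : Dec (N ∣ m) → [ N ∣? (N ℕ.+ m) ] (+ N) ≡ [ N ∣? m ] (+ N)
        by (yes N∣m) = ≡.trans ([]-yes (N ∣? (N ℕ.+ m)) (∣.∣m∣n⇒∣m+n ∣.∣-refl N∣m)) (≡.sym ([]-yes (N ∣? m) N∣m))
        by (no  N∤m) = ≡.trans ([]-no (N ∣? (N ℕ.+ m)) (λ d → N∤m (∣.∣m+n∣m⇒∣n d ∣.∣-refl))) (≡.sym ([]-no (N ∣? m) N∤m))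
    cyclic-< : ∀ n → n < N → cyclic N n ≡ + 0
    cyclic-< zero      n<N = ≡.refl
    cyclic-< n@(suc _) n<N = []-no (N ∣? n) (∣.>⇒∤ n<N)
    one-< : ∀ n → + n ℤ.* (one n ℤ.+ + 0) ≡ + 0
    one-< zero    = ≡.refl
    one-< (suc n) = ℤP.*-zeroʳ (+ suc n)
    pointwise : ∀ n → n < N ⊎ N ≤ n → cyclic N n ℤ.- shiftBy N (cyclic N) n ≡ ℤ.- (+ n ℤ.* oneMinusPower N n)
    pointwise n (inj₁ n<N) = begin
      cyclic N n ℤ.- shiftBy N (cyclic N) n    ≡⟨ cong₂ ℤ._-_ (cyclic-< n n<N) (shiftBy-< (cyclic N) n<N) ⟩
      ℤ.- (+ 0)                                ≡⟨ cong ℤ.-_ (one-< n) ⟨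
      ℤ.- (+ n ℤ.* (one n ℤ.- + 0))            ≡⟨ cong (λ x → ℤ.- (+ n ℤ.* (one n ℤ.- x))) (shiftBy-< one n<N) ⟨
      ℤ.- (+ n ℤ.* oneMinusPower N n)          ∎
    pointwise n (inj₂ N≤n) = subst (λ n → cyclic N n ℤ.- shiftBy N (cyclic N) n ≡ ℤ.- (+ n ℤ.* oneMinusPower N n))
      (ℕP.m+[n∸m]≡n N≤n) (begin
      cyclic N (N ℕ.+ m) ℤ.- shiftBy N (cyclic N) (N ℕ.+ m)        ≡⟨ cong (λ x → cyclic N (N ℕ.+ m) ℤ.- x) (shiftBy-+ N (cyclic N) m) ⟩
      cyclic N (N ℕ.+ m) ℤ.- cyclic N m                            ≡⟨ above N m ⟩
      ℤ.- (+ (N ℕ.+ m) ℤ.* (one (N ℕ.+ m) ℤ.- one m))              ≡⟨ cong (λ x → ℤ.- (+ (N ℕ.+ m) ℤ.* (one (N ℕ.+ m) ℤ.- x))) (shiftBy-+ N one m) ⟨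
      ℤ.- (+ (N ℕ.+ m) ℤ.* oneMinusPower N (N ℕ.+ m))              ∎)
      where m = n ℕ.∸ N

  -- Multiplying or dividing E by 1 − xᴺ changes t by ± cyclic N, a Dold sequence, and moves the
  -- coefficient of xᴺ by one; so the coefficients of E can be cleared in turn up to degree n.
  module _ (n : ℕ) .{{_ : NonZero n}} where

    private
      Goal : (ℕ → ℤ) → Set
      Goal t = + n ∣ℤ.∣ doldSum t n

      CleanBelow : ℕ → (ℕ → ℤ) → Set
      CleanBelow N E = ∀ k → 1 ≤ k → k < N → E k ≡ + 0

      shiftBy-at-N : ∀ N f → shiftBy N f N ≡ f 0
      shiftBy-at-N N f = ≡.trans (cong (shiftBy N f) (≡.sym (ℕP.+-identityʳ N))) (shiftBy-+ N f 0)

      -- `f` counts the degrees still to be cleared, so the process stops at N = n + 1; within one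
      -- degree `clear-at` descends on the absolute value `m` of the coefficient.
      clear : ∀ f N → N ℕ.+ f ≡ suc n → 1 ≤ N → ∀ t E → E 0 ≡ + 1 → CleanBelow N E → LogDerivative t E → Goal t
      clear-at : ∀ f N → suc N ℕ.+ f ≡ suc n → 1 ≤ N → ∀ m t E → ℤ.∣ E N ∣ ≡ m → E 0 ≡ + 1 → CleanBelow N E →
        LogDerivative t E → Goal t

      -- Here E is 1 up to degree n, so t vanishes at 1, ..., n. Written as t = 0 · t, this gives a
      -- zero Dold sum by linearity.
      clear zero N N≡ 1≤N t E E₀ clean h = ∣ℤ.divides (+ 0) (≡.trans (doldSum-cong n t≡0) (doldSum-* (+ 0) t n))
        where
        open ≡.≡-Reasoning
        N≡1+n = ≡.trans (≡.sym (ℕP.+-identityʳ N)) N≡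
        t≡0 : ∀ k → 1 ≤ k → k ≤ n → t k ≡ + 0 ℤ.* t k
        t≡0 k 1≤k k≤n = begin
          t k                         ≡⟨ ℤP.*-identityˡ _ ⟨
          + 1 ℤ.* t k                 ≡⟨ cong (ℤ._* t k) E₀ ⟨
          E 0 ℤ.* t k                 ≡⟨ ℤSeries.conv-constˡ E t k (λ j 1≤j j≤k → E≡0 j 1≤j (ℕP.≤-trans j≤k k≤n)) ⟨
          conv E t k                  ≡⟨ ℤSeries.conv-comm E t k ⟩
          conv t E k                  ≡⟨ h k ⟩
          ℤ.- δ E k                   ≡⟨ cong (λ x → ℤ.- (k · (+ 1) ℤ.* x)) (E≡0 k 1≤k k≤n) ⟩
          ℤ.- (k · (+ 1) ℤ.* + 0)     ≡⟨ cong ℤ.-_ (ℤP.*-zeroʳ (k · (+ 1))) ⟩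
          + 0                         ∎
          where
          E≡0 : ∀ j → 1 ≤ j → j ≤ n → E j ≡ + 0
          E≡0 j 1≤j j≤n = clean j 1≤j (subst (j <_) (≡.sym N≡1+n) (s≤s j≤n))
      clear (suc f) N N≡ 1≤N t E = clear-at f N (≡.trans (≡.sym (ℕP.+-suc N f)) N≡) 1≤N _ t E ≡.refl

      clear-at f N N≡ 1≤N zero t E EN E₀ clean h = clear f (suc N) N≡ (s≤s z≤n) t E E₀ clean′ h
        where
        clean′ : CleanBelow (suc N) E
        clean′ k 1≤k (s≤s k≤N) with ℕP.m≤n⇒m<n∨m≡n k≤N
        ... | inj₁ k<N    = clean k 1≤k k<N
        ... | inj₂ ≡.refl = ℤP.∣i∣≡0⇒i≡0 EN
      clear-at f N N≡ 1≤N (suc m) t E EN E₀ clean h with E N in EN≡ | EN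
      -- As `E 0` is 1, multiplying by 1 - xᴺ lowers the coefficient m + 1 at N to m and leaves
      -- smaller degrees alone.
      ... | + suc .m | ≡.refl = subst (+ n ∣ℤ.∣_) cancel-cyclic
        (∣ℤ.∣m∣n⇒∣m-n (clear-at f N N≡ 1≤N m t′ E′ E′N E′₀ clean′ (ℤSeries.logDerivative-conv h (logDerivative-oneMinusPower N)))
          (cyclic-dold N n))
        where
        instance
          N≢0 : NonZero N
          N≢0 = ℕ.>-nonZero 1≤N
        E′ t′ : ℕ → ℤ
        E′ = conv E (oneMinusPower N)
        t′ k = t k ℤ.+ cyclic N k
        cancel-cyclic : doldSum t′ n ℤ.- doldSum (cyclic N) n ≡ doldSum t n
        cancel-cyclic = ≡.trans (cong (ℤ._- doldSum (cyclic N) n) (doldSum-+ t (cyclic N) n))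
          (solve 2 (λ x y → x :+ y :- y := x) ≡.refl (doldSum t n) (doldSum (cyclic N) n))
          where open +-*-Solver
        E′N : ℤ.∣ E′ N ∣ ≡ m
        E′N = cong ℤ.∣_∣ (≡.trans (conv-oneMinusPower N E N) (cong₂ ℤ._-_ EN≡ (≡.trans (shiftBy-at-N N E) E₀)))
        E′-< : ∀ k → k < N → E′ k ≡ E k
        E′-< k k<N = ≡.trans (conv-oneMinusPower N E k) (≡.trans (cong (λ x → E k ℤ.- x) (shiftBy-< E k<N)) (ℤP.+-identityʳ (E k)))
        E′₀ : E′ 0 ≡ + 1
        E′₀ = ≡.trans (E′-< 0 1≤N) E₀
        clean′ : CleanBelow N E′
        clean′ k 1≤k k<N = ≡.trans (E′-< k k<N) (clean k 1≤k k<N)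
      -- A negative coefficient is raised by dividing instead. The quotient stays integral because 1
      -- - xᴺ has constant term 1, and uniqueness of logarithmic derivatives gives t′ + `cyclic N` =
      -- t.
      ... | -[1+ .m ] | ≡.refl = subst (+ n ∣ℤ.∣_) (≡.trans (≡.sym (doldSum-+ t′ (cyclic N) n)) (doldSum-cong n (λ k _ _ → t′+cyclic≡t k)))
        (∣ℤ.∣m∣n⇒∣m+n (clear-at f N N≡ 1≤N m t′ E′ E′N E′₀ clean′ h′) (cyclic-dold N n))
        where
        open ≡.≡-Reasoning
        instance
          N≢0 : NonZero N
          N≢0 = ℕ.>-nonZero 1≤N
        E′ t′ : ℕ → ℤ
        E′ = ℤSeries.quotient E (oneMinusPower N)
        t′ = ℤSeries.quotient (λ k → ℤ.- δ E′ k) E′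
        constant : oneMinusPower N 0 ≡ + 1
        constant = cong (λ x → + 1 ℤ.- x) (shiftBy-< one 1≤N)
        E≡ : ∀ k → conv E′ (oneMinusPower N) k ≡ E k
        E≡ = ℤSeries.conv-quotient E (oneMinusPower N) constant
        E≡E′- : ∀ k → E′ k ≡ E k ℤ.+ shiftBy N E′ k
        E≡E′- k = begin
          E′ k                                        ≡⟨ solve 2 (λ x y → x := x :- y :+ y) ≡.refl (E′ k) (shiftBy N E′ k) ⟩
          E′ k ℤ.- shiftBy N E′ k ℤ.+ shiftBy N E′ k  ≡⟨ cong (ℤ._+ shiftBy N E′ k) (≡.trans (≡.sym (conv-oneMinusPower N E′ k)) (E≡ k)) ⟩
          E k ℤ.+ shiftBy N E′ k                      ∎
          where open +-*-Solver
        E′-< : ∀ k → k < N → E′ k ≡ E k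
        E′-< k k<N = ≡.trans (E≡E′- k) (≡.trans (cong (ℤ._+_ (E k)) (shiftBy-< E′ k<N)) (ℤP.+-identityʳ (E k)))
        E′₀ : E′ 0 ≡ + 1
        E′₀ = ≡.trans (E′-< 0 1≤N) E₀
        clean′ : CleanBelow N E′
        clean′ k 1≤k k<N = ≡.trans (E′-< k k<N) (clean k 1≤k k<N)
        E′N : ℤ.∣ E′ N ∣ ≡ m
        E′N = ≡.trans (cong ℤ.∣_∣ (≡.trans (E≡E′- N) (cong₂ ℤ._+_ EN≡ (≡.trans (shiftBy-at-N N E′) E′₀)))) (ℤP.∣m⊖n∣≡∣n⊖m∣ 1 (suc m))
        h′ : LogDerivative t′ E′
        h′ = ℤSeries.conv-quotient (λ k → ℤ.- δ E′ k) E′ E′₀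
        t′+cyclic≡t : ∀ k → t′ k ℤ.+ cyclic N k ≡ t k
        t′+cyclic≡t = ℤSeries.logDerivative-unique E₀
          (ℤSeries.logDerivative-cong (λ _ → ≡.refl) E≡ (ℤSeries.logDerivative-conv h′ (logDerivative-oneMinusPower N))) h

    logDerivative-dold : ∀ {t E} → E 0 ≡ + 1 → LogDerivative t E → + n ∣ℤ.∣ doldSum t n
    logDerivative-dold {t} {E} E₀ = clear n 1 ≡.refl (s≤s z≤n) t E E₀ (λ { (suc _) _ (s≤s ()) })

open GaussCongruence using (logDerivative-dold)

-- Residue rings and polynomials

module Quotient {a ℓ} (R : CommutativeRing a ℓ) (m : CommutativeRing.Carrier R) where
  open CommutativeRing R
  open IntegerCoefficients R

  infix 4 _≈ₘ_ _by_
  -- The carrier is kept and only equality is coarsened. Hence one integer list can be read over ℤ,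
  -- over 𝔽ₚ and as a residue modulo C, and functionals defined on integer lists apply to all three.
  record _≈ₘ_ (x y : Carrier) : Set (a ⊔ ℓ) where
    constructor _by_
    field
      multiplier : Carrier
      equation   : x - y ≈ multiplier * m

  ≈⇒≈ₘ : ∀ {x y} → x ≈ y → x ≈ₘ y
  ≈⇒≈ₘ {x} {y} x≈y = 0# by trans (+-congʳ x≈y) (solve 2 (λ y m → y :- y := con (+ 0) :* m) refl _ _)

  private
    ≈ₘ-sym : ∀ {x y} → x ≈ₘ y → y ≈ₘ x
    ≈ₘ-sym {x} {y} (q by eq) = - q by trans (solve 2 (λ x y → y :- x := :- (x :- y)) refl x y)
      (trans (-‿cong eq) (solve 2 (λ q m → :- (q :* m) := (:- q) :* m) refl q m))

    ≈ₘ-trans : ∀ {x y z} → x ≈ₘ y → y ≈ₘ z → x ≈ₘ z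
    ≈ₘ-trans {x} {y} {z} (q by eq) (q′ by eq′) = q + q′ by
      trans (solve 3 (λ x y z → x :- z := (x :- y) :+ (y :- z)) refl x y z)
        (trans (+-cong eq eq′) (sym (distribʳ m q q′)))

    +-congₘ : ∀ {x y u v} → x ≈ₘ y → u ≈ₘ v → x + u ≈ₘ y + v
    +-congₘ {x} {y} {u} {v} (q by eq) (q′ by eq′) = q + q′ by
      trans (solve 4 (λ x y u v → (x :+ u) :- (y :+ v) := (x :- y) :+ (u :- v)) refl x y u v)
        (trans (+-cong eq eq′) (sym (distribʳ m q q′)))

    *-congₘ : ∀ {x y u v} → x ≈ₘ y → u ≈ₘ v → x * u ≈ₘ y * v
    *-congₘ {x} {y} {u} {v} (q by eq) (q′ by eq′) = q * u + y * q′ by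
      trans (solve 4 (λ x y u v → x :* u :- y :* v := (x :- y) :* u :+ y :* (u :- v)) refl x y u v)
        (trans (+-cong (*-congʳ eq) (*-congˡ eq′))
          (solve 5 (λ q m u y r → q :* m :* u :+ y :* (r :* m) := (q :* u :+ y :* r) :* m) refl q m u y q′))

    -‿congₘ : ∀ {x y} → x ≈ₘ y → - x ≈ₘ - y
    -‿congₘ {x} {y} (q by eq) = - q by
      trans (solve 2 (λ x y → (:- x) :- (:- y) := :- (x :- y)) refl x y)
        (trans (-‿cong eq) (solve 2 (λ q m → :- (q :* m) := (:- q) :* m) refl q m))

  commutativeRingₘ : CommutativeRing a (a ⊔ ℓ)
  commutativeRingₘ = record
    { Carrier = Carrier ; _≈_ = _≈ₘ_ ; _+_ = _+_ ; _*_ = _*_ ; -_ = -_ ; 0# = 0# ; 1# = 1#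
    ; isCommutativeRing = record
      { isRing = record
        { +-isAbelianGroup = record
          { isGroup = record
            { isMonoid = record
              { isSemigroup = record
                { isMagma = record
                  { isEquivalence = record { refl = ≈⇒≈ₘ refl ; sym = ≈ₘ-sym ; trans = ≈ₘ-trans }
                  ; ∙-cong = +-congₘ }
                ; assoc = λ x y z → ≈⇒≈ₘ (+-assoc x y z) }
              ; identity = (λ x → ≈⇒≈ₘ (+-identityˡ x)) , (λ x → ≈⇒≈ₘ (+-identityʳ x)) }
            ; inverse = (λ x → ≈⇒≈ₘ (-‿inverseˡ x)) , (λ x → ≈⇒≈ₘ (-‿inverseʳ x))
            ; ⁻¹-cong = -‿congₘ }
          ; comm = λ x y → ≈⇒≈ₘ (+-comm x y) }
        ; *-cong = *-congₘ
        ; *-assoc = λ x y z → ≈⇒≈ₘ (*-assoc x y z)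
        ; *-identity = (λ x → ≈⇒≈ₘ (*-identityˡ x)) , (λ x → ≈⇒≈ₘ (*-identityʳ x))
        ; distrib = (λ x y z → ≈⇒≈ₘ (distribˡ x y z)) , (λ x y z → ≈⇒≈ₘ (distribʳ x y z)) }
      ; *-comm = λ x y → ≈⇒≈ₘ (*-comm x y) } }

module Polynomial {a ℓ} (R : CommutativeRing a ℓ) where
  open CommutativeRing R
  open IntegerCoefficients R
  open Series R
  open import Relation.Binary.Reasoning.Setoid setoid

  coef : List Carrier → ℕ → Carrier
  coef []      k       = 0#
  coef (x ∷ f) zero    = x
  coef (x ∷ f) (suc k) = coef f k

  infix 4 _≋_
  -- Trailing zeros are ignored, so a list has no length to be read as a degree; degrees enter
  -- through bounds such as `DegreeBelow`.
  record _≋_ (f g : List Carrier) : Set ℓ where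
    constructor mk
    field at : ∀ k → coef f k ≈ coef g k
  open _≋_ public

  add : List Carrier → List Carrier → List Carrier
  add []       g        = g
  add (x ∷ f)  []       = x ∷ f
  add (x ∷ f)  (y ∷ g)  = (x + y) ∷ add f g

  scale : Carrier → List Carrier → List Carrier
  scale x = map (x *_)

  mul : List Carrier → List Carrier → List Carrier
  mul []      g = []
  mul (x ∷ f) g = add (scale x g) (0# ∷ mul f g)

  neg : List Carrier → List Carrier
  neg = map (λ x → - x)

  coef-add : ∀ f g k → coef (add f g) k ≈ coef f k + coef g k
  coef-add []       g        k       = sym (+-identityˡ _)
  coef-add (x ∷ f)  []       k       = sym (+-identityʳ _)
  coef-add (x ∷ f)  (y ∷ g)  zero    = refl
  coef-add (x ∷ f)  (y ∷ g)  (suc k) = coef-add f g k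

  coef-scale : ∀ x f k → coef (scale x f) k ≈ x * coef f k
  coef-scale x []      k       = sym (zeroʳ x)
  coef-scale x (y ∷ f) zero    = refl
  coef-scale x (y ∷ f) (suc k) = coef-scale x f k

  coef-neg : ∀ f k → coef (neg f) k ≈ - coef f k
  coef-neg []      k       = solve 0 (con (+ 0) := :- con (+ 0)) refl
  coef-neg (y ∷ f) zero    = refl
  coef-neg (y ∷ f) (suc k) = coef-neg f k

  coef-mul : ∀ f g k → coef (mul f g) k ≈ conv (coef f) (coef g) k
  coef-mul []      g k       = sym (conv-zeroˡ (coef []) (coef g) k (λ _ _ → refl))
  coef-mul (x ∷ f) g zero    = begin
    coef (mul (x ∷ f) g) 0           ≈⟨ coef-add (scale x g) (0# ∷ mul f g) 0 ⟩
    coef (scale x g) 0 + 0#          ≈⟨ +-identityʳ _ ⟩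
    coef (scale x g) 0               ≈⟨ coef-scale x g 0 ⟩
    x * coef g 0                     ∎
  coef-mul (x ∷ f) g (suc k) = begin
    coef (mul (x ∷ f) g) (suc k)                      ≈⟨ coef-add (scale x g) (0# ∷ mul f g) (suc k) ⟩
    coef (scale x g) (suc k) + coef (mul f g) k       ≈⟨ +-cong (coef-scale x g (suc k)) (coef-mul f g k) ⟩
    x * coef g (suc k) + conv (coef f) (coef g) k     ∎

  private
    coef-1 : ∀ f k → conv (coef (1# ∷ [])) f k ≈ f k
    coef-1 f k = trans (conv-constˡ (coef (1# ∷ [])) f k (λ { (suc _) _ _ → refl })) (*-identityˡ _)

    mul-cong : ∀ {f f′ g g′} → f ≋ f′ → g ≋ g′ → mul f g ≋ mul f′ g′
    mul-cong {f} {f′} {g} {g′} p q = mk λ k →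
      trans (coef-mul f g k) (trans (conv-cong (at p) (at q) k) (sym (coef-mul f′ g′ k)))

    mul-assoc : ∀ f g h → mul (mul f g) h ≋ mul f (mul g h)
    mul-assoc f g h = mk λ k → begin
      coef (mul (mul f g) h) k                      ≈⟨ coef-mul (mul f g) h k ⟩
      conv (coef (mul f g)) (coef h) k              ≈⟨ conv-cong (coef-mul f g) (λ _ → refl) k ⟩
      conv (conv (coef f) (coef g)) (coef h) k      ≈⟨ conv-assoc (coef f) (coef g) (coef h) k ⟩
      conv (coef f) (conv (coef g) (coef h)) k      ≈⟨ conv-cong (λ _ → refl) (coef-mul g h) k ⟨
      conv (coef f) (coef (mul g h)) k              ≈⟨ coef-mul f (mul g h) k ⟨
      coef (mul f (mul g h)) k                      ∎

    mul-comm : ∀ f g → mul f g ≋ mul g f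
    mul-comm f g = mk λ k → trans (coef-mul f g k) (trans (conv-comm (coef f) (coef g) k) (sym (coef-mul g f k)))

    mul-identityˡ : ∀ f → mul (1# ∷ []) f ≋ f
    mul-identityˡ f = mk λ k → trans (coef-mul (1# ∷ []) f k) (coef-1 (coef f) k)

    ≋-trans : ∀ {f g h} → f ≋ g → g ≋ h → f ≋ h
    ≋-trans p q = mk λ k → trans (at p k) (at q k)

    add-cong : ∀ {f f′ g g′} → f ≋ f′ → g ≋ g′ → add f g ≋ add f′ g′
    add-cong {f} {f′} {g} {g′} p q = mk λ k →
      trans (coef-add f g k) (trans (+-cong (at p k) (at q k)) (sym (coef-add f′ g′ k)))

    add-assoc : ∀ f g h → add (add f g) h ≋ add f (add g h)
    add-assoc f g h = mk λ k → begin
      coef (add (add f g) h) k              ≈⟨ trans (coef-add (add f g) h k) (+-congʳ (coef-add f g k)) ⟩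
      coef f k + coef g k + coef h k        ≈⟨ +-assoc _ _ _ ⟩
      coef f k + (coef g k + coef h k)      ≈⟨ trans (coef-add f (add g h) k) (+-congˡ (coef-add g h k)) ⟨
      coef (add f (add g h)) k              ∎

    add-comm : ∀ f g → add f g ≋ add g f
    add-comm f g = mk λ k → trans (coef-add f g k) (trans (+-comm _ _) (sym (coef-add g f k)))

    add-neg : ∀ f → add f (neg f) ≋ []
    add-neg f = mk λ k → trans (coef-add f (neg f) k) (trans (+-congˡ (coef-neg f k)) (-‿inverseʳ _))

    mul-distribʳ : ∀ h f g → mul (add f g) h ≋ add (mul f h) (mul g h)
    mul-distribʳ h f g = mk λ k → begin
      coef (mul (add f g) h) k                                     ≈⟨ coef-mul (add f g) h k ⟩
      conv (coef (add f g)) (coef h) k                             ≈⟨ conv-cong (coef-add f g) (λ _ → refl) k ⟩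
      conv (λ k → coef f k + coef g k) (coef h) k                  ≈⟨ conv-distribʳ (coef f) (coef g) (coef h) k ⟩
      conv (coef f) (coef h) k + conv (coef g) (coef h) k          ≈⟨ +-cong (coef-mul f h k) (coef-mul g h k) ⟨
      coef (mul f h) k + coef (mul g h) k                          ≈⟨ coef-add (mul f h) (mul g h) k ⟨
      coef (add (mul f h) (mul g h)) k                             ∎

  polynomialRing : CommutativeRing a ℓ
  polynomialRing = record
    { Carrier = List Carrier ; _≈_ = _≋_ ; _+_ = add ; _*_ = mul ; -_ = neg ; 0# = [] ; 1# = 1# ∷ []
    ; isCommutativeRing = record
      { isRing = record
        { +-isAbelianGroup = record
          { isGroup = record
            { isMonoid = record
              { isSemigroup = record
                { isMagma = record
                  { isEquivalence = record { refl = mk λ _ → refl ; sym = λ p → mk λ k → sym (at p k) ; trans = ≋-trans }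
                  ; ∙-cong = add-cong }
                ; assoc = add-assoc }
              ; identity = (λ f → mk λ _ → refl) , (λ f → ≋-trans (add-comm f []) (mk λ _ → refl)) }
            ; inverse = (λ f → ≋-trans (add-comm (neg f) f) (add-neg f)) , add-neg
            ; ⁻¹-cong = λ {f} {g} p → mk λ k → trans (coef-neg f k) (trans (-‿cong (at p k)) (sym (coef-neg g k))) }
          ; comm = add-comm }
        ; *-cong = mul-cong
        ; *-assoc = mul-assoc
        ; *-identity = mul-identityˡ , (λ f → ≋-trans (mul-comm f (1# ∷ [])) (mul-identityˡ f))
        ; distrib = (λ h f g → ≋-trans (mul-comm h (add f g)) (≋-trans (mul-distribʳ h f g)
                       (add-cong (mul-comm f h) (mul-comm g h)))) , mul-distribʳ }
      ; *-comm = mul-comm } }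

  module P = CommutativeRing polynomialRing
  open IntegerCoefficients polynomialRing using () renaming (solve to solveₚ; _:+_ to _⊕_; _:*_ to _⊛_; _:-_ to _⊖_; _:=_ to _⊜_)

  scale-constant : ∀ x f → mul (x ∷ []) f ≋ scale x f
  scale-constant x f = mk λ k → trans (coef-add (scale x f) (0# ∷ []) k)
    (trans (+-congˡ (zero-coef k)) (+-identityʳ _))
    where
    zero-coef : ∀ k → coef (0# ∷ []) k ≈ 0#
    zero-coef zero    = refl
    zero-coef (suc k) = refl

  DegreeBelow : ℕ → List Carrier → Set ℓ
  DegreeBelow n f = ∀ k → n ≤ k → coef f k ≈ 0#

  record Monic (n : ℕ) (m : List Carrier) : Set ℓ where
    field
      leading : coef m n ≈ 1#
      bounded : DegreeBelow (suc n) m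
  open Monic public

  -- If f = q m + s, then x + X f = (X q) m + (x + X s). The new remainder has degree at most n;
  -- with `c` its coefficient at n, moving c m into the quotient restores the bound.
  divide : ∀ {n m} → Monic n m → ∀ f →
    Σ (List Carrier) λ q → Σ (List Carrier) λ s → (f ≋ add (mul q m) s) × DegreeBelow n s
  divide mon []      = [] , [] , mk (λ _ → refl) , (λ _ _ → refl)
  divide {n} {m} mon (x ∷ f) with divide mon f
  ... | q , s , f≋ , s-deg = (c ∷ q) , s′ , mk eq , deg
    where
    c = coef (x ∷ s) n
    s′ = add (x ∷ s) (scale (- c) m)
    coef-s′ : ∀ k → coef s′ k ≈ coef (x ∷ s) k + - c * coef m k
    coef-s′ k = trans (coef-add (x ∷ s) (scale (- c) m) k) (+-congˡ (coef-scale (- c) m k))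
    shifted : ∀ k → coef (0# ∷ mul q m) k + coef (x ∷ s) k ≈ coef (x ∷ f) k
    shifted zero    = +-identityˡ _
    shifted (suc k) = trans (sym (coef-add (mul q m) s k)) (sym (at f≋ k))
    eq : ∀ k → coef (x ∷ f) k ≈ coef (add (mul (c ∷ q) m) s′) k
    eq k = begin
      coef (x ∷ f) k                                                               ≈⟨ shifted k ⟨
      coef (0# ∷ mul q m) k + coef (x ∷ s) k
        ≈⟨ solve 4 (λ c m u v → u :+ v := c :* m :+ u :+ (v :+ (:- c) :* m)) refl c (coef m k) _ _ ⟩
      c * coef m k + coef (0# ∷ mul q m) k + (coef (x ∷ s) k + - c * coef m k)
        ≈⟨ +-cong (trans (coef-add (scale c m) (0# ∷ mul q m) k) (+-congʳ (coef-scale c m k))) (coef-s′ k) ⟨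
      coef (mul (c ∷ q) m) k + coef s′ k                                           ≈⟨ coef-add (mul (c ∷ q) m) s′ k ⟨
      coef (add (mul (c ∷ q) m) s′) k                                              ∎
    deg : DegreeBelow n s′
    deg k n≤k with ℕP.m≤n⇒m<n∨m≡n n≤k
    ... | inj₂ ≡.refl = begin
      coef s′ n                    ≈⟨ coef-s′ n ⟩
      c + - c * coef m n           ≈⟨ +-congˡ (*-congˡ (leading mon)) ⟩
      c + - c * 1#                 ≈⟨ solve 1 (λ c → c :+ (:- c) :* con (+ 1) := con (+ 0)) refl c ⟩
      0#                           ∎
    deg (suc k) n≤k | inj₁ (s≤s n≤k′) = begin
      coef s′ (suc k)                       ≈⟨ coef-s′ (suc k) ⟩
      coef s k + - c * coef m (suc k)       ≈⟨ +-cong (s-deg k n≤k′) (*-congˡ (bounded mon (suc k) (s≤s n≤k′))) ⟩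
      0# + - c * 0#                         ≈⟨ solve 1 (λ c → con (+ 0) :+ (:- c) :* con (+ 0) := con (+ 0)) refl c ⟩
      0#                                    ∎

  IsUnit : List Carrier → Set ℓ
  IsUnit f = ¬ (coef f 0 ≈ 0#) × (∀ k → 0 < k → coef f k ≈ 0#)

  module Euclid
    (zero? : ∀ x → Dec (x ≈ 0#)) (1≉0 : ¬ (1# ≈ 0#))
    (inverse : ∀ x → ¬ (x ≈ 0#) → Σ Carrier λ y → x * y ≈ 1#)
    {d : ℕ} {C : List Carrier} (C-monic : Monic d C)
    (C-irreducible : ∀ g h → C ≋ mul g h → IsUnit g ⊎ IsUnit h)
    where

    -- A list may end in zeros, so the leading coefficient is found by testing from the far end; `b`
    -- is its inverse.
    normalise : ∀ f → f ≋ [] ⊎ (Σ ℕ λ n → Σ Carrier λ b → Monic n (scale b f))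
    normalise []      = inj₁ (mk λ _ → refl)
    normalise (x ∷ f) with normalise f
    ... | inj₂ (n , b , mon) = inj₂ (suc n , b , record
      { leading = leading mon ; bounded = λ { (suc k) (s≤s le) → bounded mon k le } })
    ... | inj₁ f≋0 with zero? x
    ...   | yes x≈0 = inj₁ (mk λ { zero → x≈0 ; (suc k) → at f≋0 k })
    ...   | no  x≉0 with inverse x x≉0
    ...     | b , xb≈1 = inj₂ (0 , b , record
      { leading = trans (*-comm b x) xb≈1
      ; bounded = λ { (suc k) _ → trans (coef-scale b f k) (trans (*-congˡ (at f≋0 k)) (zeroʳ b)) } })

    infix 4 C∣_
    C∣_ : List Carrier → Set (a ⊔ ℓ)
    C∣ f = Σ (List Carrier) λ q → f ≋ mul q C

    -- If C ∣ g h with 0 ≠ g of degree below d, then also C ∣ s h for the remainder s of C modulo g.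
    euclid : ∀ N → N ≤ d → ∀ g h → DegreeBelow N g → ¬ (g ≋ []) → C∣ (mul g h) → C∣ h
    euclid zero    N≤d g h g-deg g≉0 _ = ⊥-elim (g≉0 (mk λ k → g-deg k z≤n))
    euclid (suc N) N≤d g h g-deg g≉0 (u , gh≋) with normalise g
    ... | inj₁ g≋0 = ⊥-elim (g≉0 g≋0)
    ... | inj₂ (n , b , mon) = remainder (divide mon C)
      where
      m = scale b g
      n≤N : n ≤ N
      n≤N with ℕP.≤-<-connex n N
      ... | inj₁ n≤N = n≤N
      ... | inj₂ N<n = ⊥-elim (1≉0 (begin
        1#             ≈⟨ leading mon ⟨
        coef m n       ≈⟨ coef-scale b g n ⟩
        b * coef g n   ≈⟨ *-congˡ (g-deg n N<n) ⟩
        b * 0#         ≈⟨ zeroʳ b ⟩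
        0#             ∎))
      mh≋ : mul m h ≋ mul (mul (b ∷ []) u) C
      mh≋ = P.trans (P.*-congʳ {h} (P.sym (scale-constant b g)))
        (P.trans (P.*-assoc (b ∷ []) g h) (P.trans (P.*-congˡ {b ∷ []} gh≋) (P.sym (P.*-assoc (b ∷ []) u C))))
      remainder : (Σ (List Carrier) λ q → Σ (List Carrier) λ s → (C ≋ add (mul q m) s) × DegreeBelow n s) → C∣ h
      remainder (q , s , C≋ , s-deg) with normalise s
      ... | inj₂ (k , b′ , s-mon) = euclid N (ℕP.≤-trans (ℕP.n≤1+n N) N≤d) s h
        (λ k N≤k → s-deg k (ℕP.≤-trans n≤N N≤k)) s≉0 (add h (neg (mul q (mul (b ∷ []) u))) , sh≋)
        where
        s≉0 : ¬ (s ≋ [])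
        s≉0 s≋0 = 1≉0 (trans (sym (leading s-mon)) (trans (coef-scale b′ s k) (trans (*-congˡ (at s≋0 k)) (zeroʳ b′))))
        sh≋ : mul s h ≋ mul (add h (neg (mul q (mul (b ∷ []) u)))) C
        sh≋ = P.trans
          (solveₚ 4 (λ s h q m → s ⊛ h ⊜ (q ⊛ m ⊕ s) ⊛ h ⊖ q ⊛ (m ⊛ h)) P.refl s h q m)
          (P.trans (P.+-cong (P.*-congʳ {h} (P.sym C≋)) (P.-‿cong (P.*-congˡ {q} mh≋)))
            (solveₚ 4 (λ C h q v → C ⊛ h ⊖ q ⊛ (v ⊛ C) ⊜ (h ⊖ q ⊛ v) ⊛ C) P.refl C h q (mul (b ∷ []) u)))
      -- A zero remainder means C = q m, so one factor is constant. It cannot be `q`, since m has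
      -- degree at most N < d; and if it is the monic `m`, then m = 1 and C ∣ m h is the claim.
      ... | inj₁ s≋0 with C-irreducible q m C≋qm
        where
        C≋qm : C ≋ mul q m
        C≋qm = P.trans C≋ (P.trans (P.+-congˡ {mul q m} s≋0) (P.+-identityʳ (mul q m)))
      ...   | inj₁ (_ , q-const) = ⊥-elim (1≉0 (begin
        1#                                 ≈⟨ leading C-monic ⟨
        coef C d                           ≈⟨ at C≋ d ⟩
        coef (add (mul q m) s) d           ≈⟨ coef-add (mul q m) s d ⟩
        coef (mul q m) d + coef s d        ≈⟨ +-cong (coef-mul q m d) (at s≋0 d) ⟩
        conv (coef q) (coef m) d + 0#      ≈⟨ +-identityʳ _ ⟩
        conv (coef q) (coef m) d           ≈⟨ conv-constˡ (coef q) (coef m) d (λ k 1≤k _ → q-const k 1≤k) ⟩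
        coef q 0 * coef m d                ≈⟨ *-congˡ (bounded mon d (ℕP.≤-trans (s≤s n≤N) N≤d)) ⟩
        coef q 0 * 0#                      ≈⟨ zeroʳ _ ⟩
        0#                                 ∎))
      ...   | inj₂ (_ , m-const) = mul (b ∷ []) u , P.trans (P.sym (P.trans (P.*-congʳ {h} m≋1) (P.*-identityˡ h))) mh≋
        where
        constant : ∀ n → Monic n m → m ≋ (1# ∷ [])
        constant zero    mon = mk λ { zero → leading mon ; (suc k) → m-const (suc k) (s≤s z≤n) }
        constant (suc n) mon = ⊥-elim (1≉0 (trans (sym (leading mon)) (m-const (suc n) (s≤s z≤n))))
        m≋1 = constant n mon

    open Quotient polynomialRing C using (_≈ₘ_; _by_; commutativeRingₘ) public

    C∣⇒≈0 : ∀ {f} → C∣ f → f ≈ₘ []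
    C∣⇒≈0 {f} (q , eq) = q by P.trans (P.+-identityʳ f) eq

    ≈0⇒C∣ : ∀ {f} → f ≈ₘ [] → C∣ f
    ≈0⇒C∣ {f} (q by eq) = q , P.trans (P.sym (P.+-identityʳ f)) eq

    -- The remainder of f modulo C is nonzero of degree below d and may replace f; then `euclid`
    -- moves divisibility to g.
    residue-cancel : ∀ f g → ¬ (f ≈ₘ []) → mul f g ≈ₘ [] → g ≈ₘ []
    residue-cancel f g f≉0 fg≈0 with divide C-monic f | ≈0⇒C∣ fg≈0
    ... | q , s , f≋ , s-deg | u , fg≋ = C∣⇒≈0 (euclid d ℕP.≤-refl s g s-deg
      (λ s≋0 → f≉0 (C∣⇒≈0 (q , P.trans f≋ (P.trans (P.+-congˡ {mul q C} s≋0) (P.+-identityʳ (mul q C))))))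
      (add u (neg (mul q g)) , P.trans
        (solveₚ 4 (λ s g q C → s ⊛ g ⊜ (q ⊛ C ⊕ s) ⊛ g ⊖ (q ⊛ g) ⊛ C) P.refl s g q C)
        (P.trans (P.+-congʳ {neg (mul (mul q g) C)} (P.trans (P.*-congʳ {g} (P.sym f≋)) fg≋))
          (solveₚ 3 (λ u v C → u ⊛ C ⊖ v ⊛ C ⊜ (u ⊖ v) ⊛ C) P.refl u (mul q g) C))))

    -- A nonzero multiple of C of degree below d would, by `euclid` with cofactor 1, make C divide
    -- 1.
    residue-independent : ¬ ((1# ∷ []) ≈ₘ []) → ∀ f → DegreeBelow d f → f ≈ₘ [] → f ≋ []
    residue-independent 1≉ₘ0 f f-deg f≈0 with normalise f
    ... | inj₁ f≋0 = f≋0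
    ... | inj₂ (n , b , mon) = ⊥-elim (1≉ₘ0 (C∣⇒≈0 (euclid d ℕP.≤-refl f (1# ∷ []) f-deg f≉0 (q , P.trans (P.*-identityʳ f) eq))))
      where
      q = proj₁ (≈0⇒C∣ f≈0)
      eq = proj₂ (≈0⇒C∣ f≈0)
      f≉0 : ¬ (f ≋ [])
      f≉0 f≋0 = 1≉0 (trans (sym (leading mon)) (trans (coef-scale b f n) (trans (*-congˡ (at f≋0 n)) (zeroʳ b))))

-- Frobenius endomorphism

prime∤! : ∀ {p} → Prime p → ∀ k → k < p → ¬ p ∣ k !
prime∤! pr zero    _   p∣1 with ∣.∣1⇒≡1 p∣1
... | ≡.refl with prime-≥2 pr
...   | s≤s ()
prime∤! pr (suc k) k<p p∣ with euclidsLemma (suc k) (k !) pr p∣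
... | inj₁ p∣1+k = ∣.>⇒∤ k<p p∣1+k
... | inj₂ p∣k!  = prime∤! pr k (ℕP.<-trans (ℕP.n<1+n k) k<p) p∣k!

-- p divides p!, the product of the binomial coefficient with k! and (p - k)!, but neither of these
-- factorials.
prime∣C : ∀ {p k} → Prime p → 0 < k → k < p → p ∣ p choose k
prime∣C {p@(suc q)} {k} pr 0<k k<p with euclidsLemma (p choose k) (k ! ℕ.* (p ℕ.∸ k) !) pr p∣product
  where
  instance _ = k ℕP.!* (p ℕ.∸ k) !≢0
  p∣product : p ∣ (p choose k) ℕ.* (k ! ℕ.* (p ℕ.∸ k) !)
  p∣product = subst (p ∣_) (≡.trans (≡.sym (DivMod.m/n*n≡m (k![n∸k]!∣n! (ℕP.<⇒≤ k<p))))
    (cong (ℕ._* (k ! ℕ.* (p ℕ.∸ k) !)) (≡.sym (nCk≡n!/k![n-k]! (ℕP.<⇒≤ k<p))))) (∣.m∣m*n (q !))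
... | inj₁ p∣C = p∣C
... | inj₂ p∣k!m! with euclidsLemma (k !) ((p ℕ.∸ k) !) pr p∣k!m!
...   | inj₁ p∣k! = ⊥-elim (prime∤! pr k k<p p∣k!)
...   | inj₂ p∣m! = ⊥-elim (prime∤! pr (p ℕ.∸ k) (ℕP.∸-monoʳ-< 0<k (ℕP.<⇒≤ k<p)) p∣m!)

module Frobenius {a ℓ} (R : CommutativeRing a ℓ) {p : ℕ} (pr : Prime p) where
  open CommutativeRing R
  open IntegerCoefficients R
  open import Algebra.Properties.Semiring.Mult semiring using (×-assocˡ; ×-assoc-*; ×-congʳ; ×-homo-+) renaming (_×_ to _·_)
  open import Algebra.Properties.CommutativeSemiring.Exp commutativeSemiring using (_^_; ^-congˡ; ^-distrib-*; ^-assocʳ)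
  open import Algebra.Properties.Semiring.Sum semiring using (sum; sum-cong-≋; sum-replicate-zero; sum-init-last)
  import Algebra.Properties.CommutativeSemiring.Binomial commutativeSemiring as Binomial
  open import Relation.Binary.Reasoning.Setoid setoid

  module _ (p≈0 : p · 1# ≈ 0#) where

    ·-multiple : ∀ {n} x → p ∣ n → n · x ≈ 0#
    ·-multiple x (divides q ≡.refl) = begin
      (q ℕ.* p) · x          ≡⟨ cong (_· x) (ℕP.*-comm q p) ⟩
      (p ℕ.* q) · x          ≈⟨ ×-assocˡ x p q ⟨
      p · (q · x)            ≈⟨ ×-congʳ p (*-identityˡ _) ⟨
      p · (1# * q · x)       ≈⟨ ×-assoc-* p 1# (q · x) ⟨
      p · 1# * q · x         ≈⟨ *-congʳ p≈0 ⟩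
      0# * q · x             ≈⟨ zeroˡ _ ⟩
      0#                     ∎

    -- The inner binomial coefficients are multiples of p. The exponent is generalised to n ≡ p so
    -- that it can be matched as a successor and both end terms split off.
    frobenius-+ : ∀ x y → (x + y) ^ p ≈ x ^ p + y ^ p
    frobenius-+ x y = expand p ≡.refl
      where
      expand : ∀ n → n ≡ p → (x + y) ^ n ≈ x ^ n + y ^ n
      expand zero    ≡.refl = ⊥-elim (ℕP.<⇒≱ (prime-≥2 pr) z≤n)
      expand (suc n) ≡.refl = begin
        (x + y) ^ suc n                                     ≈⟨ Binomial.theorem (suc n) x y ⟩
        t Fin.zero + sum (t ∘ Fin.suc)                      ≈⟨ +-congˡ (sum-init-last (t ∘ Fin.suc)) ⟩
        t Fin.zero + (sum (λ i → t (Fin.suc (Fin.inject₁ i))) + t (Fin.suc (Fin.fromℕ n)))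
          ≈⟨ +-congˡ (+-congʳ (trans (sum-cong-≋ {n} middle) (sum-replicate-zero n))) ⟩
        t Fin.zero + (0# + t (Fin.suc (Fin.fromℕ n)))       ≈⟨ +-cong first (+-congˡ last) ⟩
        y ^ suc n + (0# + x ^ suc n)                        ≈⟨ solve 2 (λ x y → y :+ (con (+ 0) :+ x) := x :+ y) refl _ _ ⟩
        x ^ suc n + y ^ suc n                               ∎
        where
        t : Fin (suc (suc n)) → Carrier
        t = Binomial.binomialTerm x y (suc n)
        middle : ∀ (i : Fin n) → t (Fin.suc (Fin.inject₁ i)) ≈ 0#
        middle i = ·-multiple _ (prime∣C pr (s≤s z≤n) (s≤s (subst (_< n) (≡.sym (FinP.toℕ-inject₁ i)) (FinP.toℕ<n i))))
        first : t Fin.zero ≈ y ^ suc n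
        first = solve 1 (λ y → con (+ 1) :* y :+ con (+ 0) := y) refl (y ^ suc n)
        last : t (Fin.suc (Fin.fromℕ n)) ≈ x ^ suc n
        last = begin
          (suc n choose suc (toℕ (Fin.fromℕ n))) · (x ^ suc (toℕ (Fin.fromℕ n)) * y ^ (n ℕ.∸ toℕ (Fin.fromℕ n)))
            ≡⟨ cong (λ k → (suc n choose suc k) · (x ^ suc k * y ^ (n ℕ.∸ k))) (FinP.toℕ-fromℕ n) ⟩
          (suc n choose suc n) · (x ^ suc n * y ^ (n ℕ.∸ n))
            ≡⟨ cong₂ (λ c k → c · (x ^ suc n * y ^ k)) (nCn≡1 (suc n)) (ℕP.n∸n≡0 n) ⟩
          x ^ suc n * 1# + 0#
            ≈⟨ solve 1 (λ x → x :* con (+ 1) :+ con (+ 0) := x) refl (x ^ suc n) ⟩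
          x ^ suc n ∎

    frobenius-0 : 0# ^ p ≈ 0#
    frobenius-0 = begin
      0# ^ p                          ≈⟨ solve 1 (λ x → x := x :+ x :- x) refl (0# ^ p) ⟩
      0# ^ p + 0# ^ p - 0# ^ p        ≈⟨ +-congʳ (frobenius-+ 0# 0#) ⟨
      (0# + 0#) ^ p - 0# ^ p          ≈⟨ +-congʳ (^-congˡ p (+-identityˡ 0#)) ⟩
      0# ^ p - 0# ^ p                 ≈⟨ -‿inverseʳ _ ⟩
      0#                              ∎

    frobenius-neg : ∀ x → (- x) ^ p ≈ - x ^ p
    frobenius-neg x = begin
      (- x) ^ p                          ≈⟨ solve 2 (λ u v → v := u :+ v :- u) refl (x ^ p) ((- x) ^ p) ⟩
      x ^ p + (- x) ^ p - x ^ p          ≈⟨ +-congʳ (frobenius-+ x (- x)) ⟨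
      (x - x) ^ p - x ^ p                ≈⟨ +-congʳ (trans (^-congˡ p (-‿inverseʳ x)) frobenius-0) ⟩
      0# - x ^ p                         ≈⟨ +-identityˡ _ ⟩
      - x ^ p                            ∎

    1^ : ∀ n → 1# ^ n ≈ 1#
    1^ zero    = refl
    1^ (suc n) = trans (*-identityˡ _) (1^ n)

    frobenius-ℕ : ∀ n → (n · 1#) ^ p ≈ n · 1#
    frobenius-ℕ zero    = frobenius-0
    frobenius-ℕ (suc n) = trans (frobenius-+ 1# (n · 1#)) (+-cong (1^ p) (frobenius-ℕ n))

    frobenius-fromℤ : ∀ n → fromℤ n ^ p ≈ fromℤ n
    frobenius-fromℤ (+ n)    = frobenius-ℕ n
    frobenius-fromℤ -[1+ n ] = trans (frobenius-neg (suc n · 1#)) (-‿cong (frobenius-ℕ (suc n)))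

    frobenius-sum : ∀ n (f : Fin n → Carrier) → sum f ^ p ≈ sum (λ i → f i ^ p)
    frobenius-sum zero    f = frobenius-0
    frobenius-sum (suc n) f = trans (frobenius-+ _ _) (+-congˡ (frobenius-sum n (f ∘ Fin.suc)))

    -- Frobenius is additive and multiplicative and fixes the image of ℤ, so it acts on the powers
    -- of `x` alone.
    frobenius-combination : ∀ n (y : Fin n → ℤ) x →
      sum (λ i → fromℤ (y i) * x ^ toℕ i) ^ p ≈ sum (λ i → fromℤ (y i) * x ^ (toℕ i ℕ.* p))
    frobenius-combination n y x = trans (frobenius-sum n _) (sum-cong-≋ {n} (λ i →
      trans (^-distrib-* _ _ p) (*-cong (frobenius-fromℤ (y i)) (^-assocʳ x (toℕ i) p))))

  private
    ·1-distinct : (∀ n → 1 ≤ n → n < p → ¬ (n · 1# ≈ 0#)) → ∀ m n → n < p → m < n → ¬ (m · 1# ≈ n · 1#)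
    ·1-distinct small m n n<p m<n eq = small (n ℕ.∸ m) (ℕP.m<n⇒0<n∸m m<n) (ℕP.≤-<-trans (ℕP.m∸n≤m n m) n<p) (begin
      (n ℕ.∸ m) · 1#                        ≈⟨ solve 2 (λ u v → u := v :+ u :- v) refl _ (m · 1#) ⟩
      m · 1# + (n ℕ.∸ m) · 1# - m · 1#      ≈⟨ +-congʳ (×-homo-+ 1# m (n ℕ.∸ m)) ⟨
      (m ℕ.+ (n ℕ.∸ m)) · 1# - m · 1#       ≡⟨ cong (λ k → k · 1# - m · 1#) (ℕP.m+[n∸m]≡n (ℕP.<⇒≤ m<n)) ⟩
      n · 1# - m · 1#                       ≈⟨ +-congʳ eq ⟨
      m · 1# - m · 1#                       ≈⟨ -‿inverseʳ _ ⟩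
      0#                                    ∎)

  ·1-injective : (∀ n → 1 ≤ n → n < p → ¬ (n · 1# ≈ 0#)) → ∀ m n → m < p → n < p → m · 1# ≈ n · 1# → m ≡ n
  ·1-injective small m n m<p n<p eq with ℕP.<-cmp m n
  ... | tri≈ _ m≡n _ = m≡n
  ... | tri< m<n _ _ = ⊥-elim (·1-distinct small m n n<p m<n eq)
  ... | tri> _ _ n<m = ⊥-elim (·1-distinct small n m m<p n<m (sym eq))

  -- Otherwise Yᵖ − Y would have the p + 1 roots 0, 1, …, p − 1 and g.
  frobenius-fixed : (∀ x y → ¬ (x ≈ 0#) → x * y ≈ 0# → y ≈ 0#) → ¬ (1# ≈ 0#) → p · 1# ≈ 0# →
    (∀ n → 1 ≤ n → n < p → ¬ (n · 1# ≈ 0#)) → ∀ g → g ^ p ≈ g → ¬ (∀ (i : Fin p) → ¬ (g ≈ toℕ i · 1#))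
  frobenius-fixed cancel 1≉0 p≈0 small g fixed nonconstant = contradiction p ≡.refl
    where
    open Series R using (horner; fermatSeries; horner-fermatSeries; module Cancellative)
    open Cancellative cancel using (tooManyRoots)
    α : Fin (suc p) → Carrier
    α Fin.zero    = g
    α (Fin.suc i) = toℕ i · 1#
    α-distinct : ∀ i j → α i ≈ α j → i ≡ j
    α-distinct Fin.zero    Fin.zero    eq = ≡.refl
    α-distinct Fin.zero    (Fin.suc j) eq = ⊥-elim (nonconstant j eq)
    α-distinct (Fin.suc i) Fin.zero    eq = ⊥-elim (nonconstant i (sym eq))
    α-distinct (Fin.suc i) (Fin.suc j) eq =
      cong Fin.suc (FinP.toℕ-injective (·1-injective small (toℕ i) (toℕ j) (FinP.toℕ<n i) (FinP.toℕ<n j) eq))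
    α-fixed : ∀ i → α i ^ p ≈ α i
    α-fixed Fin.zero    = fixed
    α-fixed (Fin.suc i) = frobenius-ℕ p≈0 (toℕ i)
    contradiction : ∀ n → n ≡ p → ⊥
    contradiction zero          eq = ℕP.<⇒≱ (prime-≥2 pr) (subst (_≤ 1) eq z≤n)
    contradiction (suc zero)    eq = ℕP.<⇒≱ (prime-≥2 pr) (subst (_≤ 1) eq (s≤s z≤n))
    contradiction (suc (suc q)) eq = 1≉0 (tooManyRoots p α α-distinct (fermatSeries q) roots)
      where
      roots : ∀ i → horner (fermatSeries q) (α i) p ≈ 0#
      roots i = begin
        horner (fermatSeries q) (α i) p                 ≡⟨ cong (horner (fermatSeries q) (α i)) eq ⟨
        horner (fermatSeries q) (α i) (suc (suc q))     ≈⟨ horner-fermatSeries q (α i) ⟩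
        α i ^ suc (suc q) - α i                         ≡⟨ cong (λ n → α i ^ n - α i) eq ⟩
        α i ^ p - α i                                   ≈⟨ +-congʳ (α-fixed i) ⟩
        α i - α i                                       ≈⟨ -‿inverseʳ _ ⟩
        0#                                              ∎

-- Homogeneous linear systems with more unknowns than equations

module LinearSystem {a ℓ} (R : CommutativeRing a ℓ) where
  open CommutativeRing R
  open IntegerCoefficients R
  open import Algebra.Properties.Semiring.Sum semiring using (sum; sum-cong-≋; sum-replicate-zero; *-distribˡ-sum; ∑-distrib-+)
  open import Relation.Binary.Reasoning.Setoid setoid

  -- Fraction-free elimination along the first column.
  nontrivialSolution : (∀ x → Dec (x ≈ 0#)) → ¬ (1# ≈ 0#) → (∀ x y → ¬ (x ≈ 0#) → x * y ≈ 0# → y ≈ 0#) →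
    ∀ m n → m < n → (A : Fin m → Fin n → Carrier) →
    Σ (Fin n → Carrier) λ y → (∃ λ j → ¬ (y j ≈ 0#)) × (∀ i → sum (λ j → A i j * y j) ≈ 0#)
  nontrivialSolution zero? 1≉0 cancel = go
    where
    go : ∀ m n → m < n → (A : Fin m → Fin n → Carrier) →
      Σ (Fin n → Carrier) λ y → (∃ λ j → ¬ (y j ≈ 0#)) × (∀ i → sum (λ j → A i j * y j) ≈ 0#)
    go m (suc n) m<n A with FinP.any? (λ i → ¬? (zero? (A i Fin.zero)))
    ... | no none = unit , (Fin.zero , 1≉0) , λ i → begin
      A i Fin.zero * 1# + sum (λ j → A i (Fin.suc j) * 0#)
        ≈⟨ +-cong (*-congʳ (column i)) (trans (sum-cong-≋ {n} (λ j → zeroʳ _)) (sum-replicate-zero n)) ⟩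
      0# * 1# + 0#   ≈⟨ solve 0 (con (+ 0) :* con (+ 1) :+ con (+ 0) := con (+ 0)) refl ⟩
      0#             ∎
      where
      unit : Fin (suc n) → Carrier
      unit Fin.zero    = 1#
      unit (Fin.suc _) = 0#
      column : ∀ i → A i Fin.zero ≈ 0#
      column i with zero? (A i Fin.zero)
      ... | yes eq = eq
      ... | no neq = ⊥-elim (none (i , neq))
    go (suc m) (suc n) (s≤s m<n) A | yes (i₀ , pivot≉0) = y , (Fin.suc j₀ , (λ eq → y′≉0 (cancel _ _ pivot≉0 eq))) , rows
      where
      b = A i₀ Fin.zero
      A′ : Fin m → Fin n → Carrier
      A′ i j = b * A (punchIn i₀ i) (Fin.suc j) - A (punchIn i₀ i) Fin.zero * A i₀ (Fin.suc j)
      solution = go m n m<n A′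
      y′ = proj₁ solution
      j₀ = proj₁ (proj₁ (proj₂ solution))
      y′≉0 = proj₂ (proj₁ (proj₂ solution))
      y′-rows = proj₂ (proj₂ solution)
      s : Carrier
      s = sum (λ j → A i₀ (Fin.suc j) * y′ j)
      -- Scaling `y′` by the pivot `b` makes -s the right first coordinate without dividing: the
      -- pivot row then reads b (-s) + b s = 0.
      y : Fin (suc n) → Carrier
      y Fin.zero    = - s
      y (Fin.suc j) = b * y′ j
      pull : ∀ i → sum (λ j → A i (Fin.suc j) * (b * y′ j)) ≈ b * sum (λ j → A i (Fin.suc j) * y′ j)
      pull i = trans (sum-cong-≋ {n} (λ j → solve 3 (λ x b y → x :* (b :* y) := b :* (x :* y)) refl (A i (Fin.suc j)) b (y′ j)))
        (sym (*-distribˡ-sum {n} b _))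
      other : ∀ i → sum (λ j → A (punchIn i₀ i) j * y j) ≈ 0#
      other i = begin
        e * - s + sum (λ j → A i′ (Fin.suc j) * (b * y′ j))
          ≈⟨ solve 3 (λ e s u → e :* (:- s) :+ u := u :+ (:- e) :* s) refl e s _ ⟩
        sum (λ j → A i′ (Fin.suc j) * (b * y′ j)) + - e * s
          ≈⟨ +-congˡ (*-distribˡ-sum {n} (- e) _) ⟩
        sum (λ j → A i′ (Fin.suc j) * (b * y′ j)) + sum (λ j → - e * (A i₀ (Fin.suc j) * y′ j))
          ≈⟨ ∑-distrib-+ {n} _ _ ⟨
        sum (λ j → A i′ (Fin.suc j) * (b * y′ j) + - e * (A i₀ (Fin.suc j) * y′ j))
          ≈⟨ sum-cong-≋ {n} (λ j → solve 5 (λ x b y e z → x :* (b :* y) :+ (:- e) :* (z :* y) := (b :* x :- e :* z) :* y) refl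
               (A i′ (Fin.suc j)) b (y′ j) e (A i₀ (Fin.suc j))) ⟩
        sum (λ j → A′ i j * y′ j)
          ≈⟨ y′-rows i ⟩
        0# ∎
        where
        i′ = punchIn i₀ i
        e = A i′ Fin.zero
      rows : ∀ i → sum (λ j → A i j * y j) ≈ 0#
      rows i with i₀ FinP.≟ i
      ... | no i₀≢i = subst (λ i → sum (λ j → A i j * y j) ≈ 0#) (FinP.punchIn-punchOut i₀≢i) (other (punchOut i₀≢i))
      ... | yes ≡.refl = begin
        b * - s + sum (λ j → A i₀ (Fin.suc j) * (b * y′ j))   ≈⟨ +-congˡ (pull i₀) ⟩
        b * - s + b * s                                       ≈⟨ solve 2 (λ b s → b :* (:- s) :+ b :* s := con (+ 0)) refl b s ⟩
        0#                                                    ∎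

-- The functionals xⁿ ↦ Vₙ on 𝔽ₚ[x] / (C)

φ : (ℕ → ℤ) → List ℤ → ℤ
φ V []      = + 0
φ V (x ∷ f) = x ℤ.* V 0 ℤ.+ φ (V ∘ suc) f

φ-++ : ∀ V f x → φ V (f ++ x ∷ []) ≡ φ V f ℤ.+ x ℤ.* V (length f)
φ-++ V []      x = ℤP.+-comm (x ℤ.* V 0) (+ 0)
φ-++ V (y ∷ f) x = ≡.trans (cong (ℤ._+_ (y ℤ.* V 0)) (φ-++ (V ∘ suc) f x)) (≡.sym (ℤP.+-assoc (y ℤ.* V 0) _ _))

φ-reverse : ∀ {d} V (g : Fin d → ℤ) → φ V (reverse (tabulate g)) ≡ sumFinℤ (λ i → g i ℤ.* V (d ℕ.∸ suc (toℕ i)))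
φ-reverse {zero}  V g = ≡.refl
φ-reverse {suc d} V g = begin
  φ V (reverse (g Fin.zero ∷ rest))                    ≡⟨ cong (φ V) (ListP.unfold-reverse (g Fin.zero) rest) ⟩
  φ V (reverse rest ++ g Fin.zero ∷ [])                ≡⟨ φ-++ V (reverse rest) (g Fin.zero) ⟩
  φ V (reverse rest) ℤ.+ g Fin.zero ℤ.* V (length (reverse rest))
    ≡⟨ cong₂ (λ x n → x ℤ.+ g Fin.zero ℤ.* V n) (φ-reverse V (g ∘ Fin.suc))
         (≡.trans (ListP.length-reverse rest) (ListP.length-tabulate (g ∘ Fin.suc))) ⟩
  sumFinℤ (λ i → g (Fin.suc i) ℤ.* V (d ℕ.∸ suc (toℕ i))) ℤ.+ g Fin.zero ℤ.* V d
    ≡⟨ ℤP.+-comm _ (g Fin.zero ℤ.* V d) ⟩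
  g Fin.zero ℤ.* V d ℤ.+ sumFinℤ (λ i → g (Fin.suc i) ℤ.* V (d ℕ.∸ suc (toℕ i))) ∎
  where
  open ≡.≡-Reasoning
  rest = tabulate (g ∘ Fin.suc)

sumFinℤ-cong : ∀ {d} {f g : Fin d → ℤ} → (∀ i → f i ≡ g i) → sumFinℤ f ≡ sumFinℤ g
sumFinℤ-cong {zero}  eq = ≡.refl
sumFinℤ-cong {suc d} eq = cong₂ ℤ._+_ (eq Fin.zero) (sumFinℤ-cong (eq ∘ Fin.suc))

sumFinℤ-neg : ∀ {d} (f : Fin d → ℤ) → sumFinℤ (λ i → ℤ.- f i) ≡ ℤ.- sumFinℤ f
sumFinℤ-neg {zero}  f = ≡.refl
sumFinℤ-neg {suc d} f = ≡.trans (cong (ℤ._+_ (ℤ.- f Fin.zero)) (sumFinℤ-neg (f ∘ Fin.suc)))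
  (≡.sym (ℤP.neg-distrib-+ (f Fin.zero) _))

charPoly-++ : ∀ d (r : Fin d → ℤ) → charPoly d r ≡ reverse (tabulate (λ i → ℤ.- r i)) ++ + 1 ∷ []
charPoly-++ d r = ≡.trans (ListP.unfold-reverse (+ 1) (map (λ i → ℤ.- r i) (allFin d)))
  (cong (λ xs → reverse xs ++ + 1 ∷ []) (ListP.map-tabulate id (λ i → ℤ.- r i)))

charPoly-lower-length : ∀ d (r : Fin d → ℤ) → length (reverse (tabulate {n = d} (λ i → ℤ.- r i))) ≡ d
charPoly-lower-length d r = ≡.trans (ListP.length-reverse (tabulate (λ i → ℤ.- r i))) (ListP.length-tabulate (λ i → ℤ.- r i))

-- The value of φ_V at C is V(d) minus the right side of the recurrence at n = d.
φ-charPoly : ∀ d r V → Recurrence d r V → φ V (charPoly d r) ≡ + 0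
φ-charPoly d r V rec = begin
  φ V (charPoly d r)                                    ≡⟨ cong (φ V) (charPoly-++ d r) ⟩
  φ V (B ++ + 1 ∷ [])                                   ≡⟨ φ-++ V B (+ 1) ⟩
  φ V B ℤ.+ + 1 ℤ.* V (length B)                        ≡⟨ cong₂ ℤ._+_ φ-B (≡.trans (ℤP.*-identityˡ _) (≡.trans (cong V (charPoly-lower-length d r)) (rec d ℕP.≤-refl))) ⟩
  ℤ.- Σr ℤ.+ Σr                                         ≡⟨ ℤP.+-inverseˡ Σr ⟩
  + 0                                                   ∎
  where
  open ≡.≡-Reasoning
  B = reverse (tabulate (λ i → ℤ.- r i))
  Σr = sumFinℤ (λ i → r i ℤ.* V (d ℕ.∸ suc (toℕ i)))
  φ-B : φ V B ≡ ℤ.- Σr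
  φ-B = ≡.trans (φ-reverse V (λ i → ℤ.- r i)) (≡.trans (sumFinℤ-cong (λ i → ≡.sym (ℤP.neg-distribˡ-* (r i) _))) (sumFinℤ-neg {d} _))

-- Shifting V amounts to multiplying the argument of φ_V by x. Closure under shifts is what makes
-- φ_V vanish on all multiples of C and not on C alone.
Recurrence-suc : ∀ {d r V} → Recurrence d r V → Recurrence d r (V ∘ suc)
Recurrence-suc {d} {r} {V} rec n d≤n = ≡.trans (rec (suc n) (ℕP.m≤n⇒m≤1+n d≤n))
  (sumFinℤ-cong (λ i → cong (λ k → r i ℤ.* V k) (ℕP.+-∸-assoc 1 (ℕP.≤-trans (FinP.toℕ<n i) d≤n))))

monomial : ℕ → List ℤ
monomial zero    = + 1 ∷ []
monomial (suc m) = + 0 ∷ monomial m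

φ-monomial : ∀ V m → φ V (monomial m) ≡ V m
φ-monomial V zero    = ≡.trans (ℤP.+-identityʳ _) (ℤP.*-identityˡ (V 0))
φ-monomial V (suc m) = ≡.trans (ℤP.+-identityˡ _) (φ-monomial (V ∘ suc) m)

-- The field 𝔽ₚ and its polynomials, as integers and integer lists modulo p

module ModPrime {p : ℕ} (pr : Prime p) where
  module Zp = Quotient ℤP.+-*-commutativeRing (+ p)

  Rp : CommutativeRing _ _
  Rp = Zp.commutativeRingₘ

  module R = CommutativeRing Rp
  module Poly = Polynomial Rp
  open Poly
  open R using (_≈_)

  ∣⇒≈0 : ∀ {x} → + p ∣ℤ.∣ x → x ≈ + 0
  ∣⇒≈0 {x} (∣ℤ.divides q eq) = q Zp.by ≡.trans (ℤP.+-identityʳ x) eq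

  ≈0⇒∣ : ∀ {x} → x ≈ + 0 → + p ∣ℤ.∣ x
  ≈0⇒∣ {x} (q Zp.by eq) = ∣ℤ.divides q (≡.trans (≡.sym (ℤP.+-identityʳ x)) eq)

  ∣⇒≈ : ∀ {x y} → + p ∣ℤ.∣ x ℤ.- y → x ≈ y
  ∣⇒≈ (∣ℤ.divides q eq) = q Zp.by eq

  zero? : ∀ x → Dec (x ≈ + 0)
  zero? x with + p ∣ℤ.∣? x
  ... | yes p∣x = yes (∣⇒≈0 p∣x)
  ... | no  p∤x = no (λ eq → p∤x (≈0⇒∣ eq))

  prime-∣-* : ∀ x y → + p ∣ℤ.∣ x ℤ.* y → + p ∣ℤ.∣ x ⊎ + p ∣ℤ.∣ y
  prime-∣-* x y p∣xy with euclidsLemma ℤ.∣ x ∣ ℤ.∣ y ∣ pr (subst (p ∣_) (ℤP.abs-* x y) (∣ℤ.∣⇒∣ᵤ p∣xy))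
  ... | inj₁ p∣x = inj₁ (∣ℤ.∣ᵤ⇒∣ p∣x)
  ... | inj₂ p∣y = inj₂ (∣ℤ.∣ᵤ⇒∣ p∣y)

  cancel : ∀ x y → ¬ (x ≈ + 0) → x ℤ.* y ≈ + 0 → y ≈ + 0
  cancel x y x≉0 xy≈0 with prime-∣-* x y (≈0⇒∣ xy≈0)
  ... | inj₁ p∣x = ⊥-elim (x≉0 (∣⇒≈0 p∣x))
  ... | inj₂ p∣y = ∣⇒≈0 p∣y

  <⇒≉0 : ∀ {n} → 1 ≤ n → n < p → ¬ (+ n ≈ + 0)
  <⇒≉0 {n} 1≤n n<p eq = ∣.>⇒∤ {{ℕ.>-nonZero 1≤n}} n<p (∣ℤ.∣⇒∣ᵤ (≈0⇒∣ {+ n} eq))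

  1≉0 : ¬ (+ 1 ≈ + 0)
  1≉0 = <⇒≉0 (s≤s z≤n) (prime-≥2 pr)

  open import Algebra.Properties.Semiring.Mult R.semiring using () renaming (_×_ to _·_)
  open import Algebra.Properties.Semiring.Exp R.semiring using (_^_; ^-congˡ)

  n·1≡n : ∀ n → n · (+ 1) ≡ + n
  n·1≡n zero    = ≡.refl
  n·1≡n (suc n) = cong (ℤ._+_ (+ 1)) (n·1≡n n)

  p≈0 : + p ≈ + 0
  p≈0 = ∣⇒≈0 (∣ℤ.divides (+ 1) (≡.sym (ℤP.*-identityˡ (+ p))))

  module RInt = IntegerCoefficients Rp

  fromℤ≡id : ∀ x → RInt.fromℤ x ≡ x
  fromℤ≡id (+ n)    = n·1≡n n
  fromℤ≡id -[1+ n ] = cong ℤ.-_ (n·1≡n (suc n))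

  -- Frobenius on ℤ modulo p fixes every integer multiple of 1.
  fermat : ∀ x → x ^ p ≈ x
  fermat x = R.trans (^-congˡ p (R.reflexive (≡.sym (fromℤ≡id x))))
    (R.trans (Frobenius.frobenius-fromℤ Rp pr (R.trans (R.reflexive (n·1≡n p)) p≈0) x) (R.reflexive (fromℤ≡id x)))

  -- The inverse is x^{p - 2}: one factor x cancels from Fermat's xᵖ = x.
  inverse : ∀ x → ¬ (x ≈ + 0) → Σ ℤ λ y → x ℤ.* y ≈ + 1
  inverse x x≉0 = go p ≡.refl
    where
    go : ∀ n → n ≡ p → Σ ℤ λ y → x ℤ.* y ≈ + 1
    go zero          eq = ⊥-elim (ℕP.<⇒≱ (prime-≥2 pr) (subst (_≤ 1) eq z≤n))
    go (suc zero)    eq = ⊥-elim (ℕP.<⇒≱ (prime-≥2 pr) (subst (_≤ 1) eq (s≤s z≤n)))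
    go (suc (suc k)) eq = x ^ k ,
      Series.Cancellative.cancel-unit Rp cancel x (x ℤ.* x ^ k) x≉0 (subst (λ n → x ^ n ≈ x) (≡.sym eq) (fermat x))

  coef≡coeff : ∀ f k → coef f k ≡ coeff f k
  coef≡coeff []      k       = ≡.refl
  coef≡coeff (x ∷ f) zero    = ≡.refl
  coef≡coeff (x ∷ f) (suc k) = coef≡coeff f k

  add≡polyAdd : ∀ f g → add f g ≡ polyAdd f g
  add≡polyAdd []      g       = ≡.refl
  add≡polyAdd (x ∷ f) []      = ≡.refl
  add≡polyAdd (x ∷ f) (y ∷ g) = cong (x ℤ.+ y ∷_) (add≡polyAdd f g)

  mul≡polyMul : ∀ f g → mul f g ≡ polyMul f g
  mul≡polyMul []      g = ≡.refl
  mul≡polyMul (x ∷ f) g = ≡.trans (cong (λ h → add (map (x ℤ.*_) g) (+ 0 ∷ h)) (mul≡polyMul f g))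
    (add≡polyAdd (map (x ℤ.*_) g) (+ 0 ∷ polyMul f g))

  unit : ∀ {g} → IsUnitModP p g → IsUnit g
  unit {g} (u , v) = (λ eq → u (∣ℤ.∣⇒∣ᵤ (subst (+ p ∣ℤ.∣_) (coef≡coeff g 0) (≈0⇒∣ eq)))) ,
    (λ k 0<k → ∣⇒≈0 (subst (+ p ∣ℤ.∣_) (≡.sym (coef≡coeff g k)) (∣ℤ.∣ᵤ⇒∣ (v k 0<k))))

  ≈⇒∣ : ∀ {x y} → x ≈ y → + p ∣ℤ.∣ x ℤ.- y
  ≈⇒∣ (q Zp.by eq) = ∣ℤ.divides q eq

  irreducible : ∀ {f} → IrreducibleModP p f → ∀ g h → f ≋ mul g h → IsUnit g ⊎ IsUnit h
  irreducible {f} (_ , _ , irr) g h eq = Sum.map (unit {g}) (unit {h}) (irr g h λ k → ∣ℤ.∣⇒∣ᵤ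
    (subst (+ p ∣ℤ.∣_) (cong₂ ℤ._-_ (coef≡coeff f k)
      (≡.trans (coef≡coeff (mul g h) k) (cong (λ u → coeff u k) (mul≡polyMul g h)))) (≈⇒∣ (at eq k))))

  monic-++ : ∀ f {n} → length f ≡ n → Monic n (f ++ + 1 ∷ [])
  monic-++ []      ≡.refl = record { leading = R.refl ; bounded = λ { (suc k) _ → R.refl } }
  monic-++ (x ∷ f) ≡.refl = record
    { leading = leading (monic-++ f ≡.refl)
    ; bounded = λ { (suc k) (s≤s le) → bounded (monic-++ f ≡.refl) k le } }

  charPoly-monic : ∀ d r → Monic d (charPoly d r)
  charPoly-monic d r = subst (Monic d) (≡.sym (charPoly-++ d r)) (monic-++ _ (charPoly-lower-length d r))

  φ-add : ∀ V f g → φ V (add f g) ≡ φ V f ℤ.+ φ V g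
  φ-add V []      g       = ≡.sym (ℤP.+-identityˡ _)
  φ-add V (x ∷ f) []      = ≡.sym (ℤP.+-identityʳ _)
  φ-add V (x ∷ f) (y ∷ g) = ≡.trans (cong (ℤ._+_ ((x ℤ.+ y) ℤ.* V 0)) (φ-add (V ∘ suc) f g))
    (S.solve 5 (λ x y v a b → (x S.:+ y) S.:* v S.:+ (a S.:+ b) S.:= x S.:* v S.:+ a S.:+ (y S.:* v S.:+ b)) ≡.refl x y (V 0) _ _)
    where module S = +-*-Solver

  φ-scale : ∀ V x f → φ V (scale x f) ≡ x ℤ.* φ V f
  φ-scale V x []      = ≡.sym (ℤP.*-zeroʳ x)
  φ-scale V x (y ∷ f) = ≡.trans (cong (ℤ._+_ ((x ℤ.* y) ℤ.* V 0)) (φ-scale (V ∘ suc) x f))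
    (S.solve 4 (λ x y v a → (x S.:* y) S.:* v S.:+ x S.:* a S.:= x S.:* (y S.:* v S.:+ a)) ≡.refl x y (V 0) _)
    where module S = +-*-Solver

  φ-neg : ∀ V f → φ V (neg f) ≡ ℤ.- φ V f
  φ-neg V []      = ≡.refl
  φ-neg V (x ∷ f) = ≡.trans (cong₂ ℤ._+_ (≡.sym (ℤP.neg-distribˡ-* x (V 0))) (φ-neg (V ∘ suc) f))
    (≡.sym (ℤP.neg-distrib-+ (x ℤ.* V 0) _))

  φ-≋0 : ∀ V f → f ≋ [] → + p ∣ℤ.∣ φ V f
  φ-≋0 V []      eq = ∣ℤ.divides (+ 0) ≡.refl
  φ-≋0 V (x ∷ f) eq = ∣ℤ.∣m∣n⇒∣m+n (∣ℤ.∣m⇒∣m*n (V 0) (≈0⇒∣ (at eq 0))) (φ-≋0 (V ∘ suc) f (mk (at eq ∘ suc)))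

  φ-≋ : ∀ V {f g} → f ≋ g → + p ∣ℤ.∣ φ V f ℤ.- φ V g
  φ-≋ V {f} {g} eq = subst (+ p ∣ℤ.∣_) (≡.trans (φ-add V f (neg g)) (cong (ℤ._+_ (φ V f)) (φ-neg V g)))
    (φ-≋0 V (add f (neg g)) (P.trans (P.+-congʳ {neg g} eq) (P.-‿inverseʳ g)))

  φ-mul-charPoly : ∀ d r V → Recurrence d r V → ∀ q → φ V (mul q (charPoly d r)) ≡ + 0
  φ-mul-charPoly d r V rec []      = ≡.refl
  φ-mul-charPoly d r V rec (x ∷ q) = begin
    φ V (add (scale x C) (+ 0 ∷ mul q C))                           ≡⟨ φ-add V (scale x C) (+ 0 ∷ mul q C) ⟩
    φ V (scale x C) ℤ.+ (+ 0 ℤ.* V 0 ℤ.+ φ (V ∘ suc) (mul q C))     ≡⟨ cong₂ ℤ._+_ (φ-scale V x C) (ℤP.+-identityˡ _) ⟩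
    x ℤ.* φ V C ℤ.+ φ (V ∘ suc) (mul q C)                           ≡⟨ cong₂ (λ u v → x ℤ.* u ℤ.+ v) (φ-charPoly d r V rec) (φ-mul-charPoly d r (V ∘ suc) (Recurrence-suc {r = r} {V} rec) q) ⟩
    x ℤ.* + 0 ℤ.+ + 0                                               ≡⟨ ≡.trans (ℤP.+-identityʳ _) (ℤP.*-zeroʳ x) ⟩
    + 0                                                             ∎
    where
    open ≡.≡-Reasoning
    C = charPoly d r

-- Frobenius-invariant functionals on the residue ring

module Residues (d′ : ℕ) (r : Fin (suc d′) → ℤ) {p : ℕ} (pr : Prime p)
  (irr : IrreducibleModP p (charPoly (suc d′) r)) where

  open ModPrime pr
  open Poly
  open R using (_≈_)

  d : ℕ
  d = suc d′

  C : List ℤ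
  C = charPoly d r

  module E = Euclid zero? 1≉0 inverse (charPoly-monic d r) (irreducible {charPoly d r} irr)
  open E using (_≈ₘ_; _by_) renaming (commutativeRingₘ to F)
  module F = CommutativeRing F
  module FInt = IntegerCoefficients F

  open import Algebra.Properties.Semiring.Mult F.semiring using () renaming (_×_ to _·_)
  open import Algebra.Properties.Semiring.Exp F.semiring using (_^_)
  open import Algebra.Properties.Semiring.Sum F.semiring using (sum; sum-cong-≋; ∑-distrib-+)
  import Algebra.Properties.Semiring.Sum R.semiring as RSum

  ≋⇒≈ₘ : ∀ {f g} → f ≋ g → f ≈ₘ g
  ≋⇒≈ₘ = Quotient.≈⇒≈ₘ polynomialRing C

  ·1≋constant : ∀ n → n · (+ 1 ∷ []) ≋ (+ n ∷ [])
  ·1≋constant zero    = mk λ { zero → R.refl ; (suc k) → R.refl }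
  ·1≋constant (suc n) = P.+-congˡ {+ 1 ∷ []} (·1≋constant n)

  fromℤ≋constant : ∀ x → FInt.fromℤ x ≋ (x ∷ [])
  fromℤ≋constant (+ n)    = ·1≋constant n
  fromℤ≋constant -[1+ n ] = P.-‿cong (·1≋constant (suc n))

  X : List ℤ
  X = + 0 ∷ + 1 ∷ []

  X*f≋ : ∀ f → mul X f ≋ (+ 0 ∷ f)
  X*f≋ f = mk λ k → R.trans (coef-add (scale (+ 0) f) (+ 0 ∷ mul (+ 1 ∷ []) f) k)
    (R.trans (R.+-congʳ (R.trans (coef-scale (+ 0) f k) (R.zeroˡ (coef f k)))) (R.trans (R.+-identityˡ _) (shifted k)))
    where
    shifted : ∀ k → coef (+ 0 ∷ mul (+ 1 ∷ []) f) k ≈ coef (+ 0 ∷ f) k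
    shifted zero    = R.refl
    shifted (suc k) = at (P.*-identityˡ f) k

  X^≋monomial : ∀ m → X ^ m ≋ monomial m
  X^≋monomial zero    = P.refl
  X^≋monomial (suc m) = P.trans (P.*-congˡ {X} (X^≋monomial m)) (X*f≋ (monomial m))

  coef-monomial : ∀ m → coef (monomial m) m ≡ + 1
  coef-monomial zero    = ≡.refl
  coef-monomial (suc m) = coef-monomial m

  coef-monomial-≢ : ∀ m k → k ≢ m → coef (monomial m) k ≡ + 0
  coef-monomial-≢ zero    zero    k≢m = ⊥-elim (k≢m ≡.refl)
  coef-monomial-≢ zero    (suc k) k≢m = ≡.refl
  coef-monomial-≢ (suc m) zero    k≢m = ≡.refl
  coef-monomial-≢ (suc m) (suc k) k≢m = coef-monomial-≢ m k (λ eq → k≢m (cong suc eq))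

  coef-sum : ∀ {n} (f : Fin n → List ℤ) k → coef (sum f) k ≈ RSum.sum (λ i → coef (f i) k)
  coef-sum {zero}  f k = R.refl
  coef-sum {suc n} f k = R.trans (coef-add (f Fin.zero) _ k) (R.+-congˡ {coef (f Fin.zero) k} (coef-sum (f ∘ Fin.suc) k))

  φ-sum-∣ : ∀ V {n} (f : Fin n → List ℤ) → (∀ i → + p ∣ℤ.∣ φ V (f i)) → + p ∣ℤ.∣ φ V (sum f)
  φ-sum-∣ V {zero}  f p∣ = ∣ℤ.divides (+ 0) ≡.refl
  φ-sum-∣ V {suc n} f p∣ = subst (+ p ∣ℤ.∣_) (≡.sym (φ-add V (f Fin.zero) _))
    (∣ℤ.∣m∣n⇒∣m+n (p∣ Fin.zero) (φ-sum-∣ V (f ∘ Fin.suc) (p∣ ∘ Fin.suc)))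

  -- Multiples of C are sent exactly to 0, and changing coefficients by multiples of p changes the
  -- value by a multiple of p.
  φ-≈ₘ : ∀ V → Recurrence d r V → ∀ {f g} → f ≈ₘ g → + p ∣ℤ.∣ φ V f ℤ.- φ V g
  φ-≈ₘ V rec {f} {g} (q by eq) = subst (+ p ∣ℤ.∣_) (begin
    φ V (add f (neg g)) ℤ.- φ V (mul q C)   ≡⟨ cong₂ ℤ._-_ (φ-add V f (neg g)) (φ-mul-charPoly d r V rec q) ⟩
    φ V f ℤ.+ φ V (neg g) ℤ.+ + 0           ≡⟨ ℤP.+-identityʳ _ ⟩
    φ V f ℤ.+ φ V (neg g)                   ≡⟨ cong (ℤ._+_ (φ V f)) (φ-neg V g) ⟩
    φ V f ℤ.- φ V g                         ∎) (φ-≋ V eq)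
    where open ≡.≡-Reasoning

  combination : ∀ {n} (y : Fin n → ℤ) → sum (λ i → scale (y i) (monomial (toℕ i))) ≋ tabulate y
  combination {zero}  y = P.refl
  combination {suc n} y = mk coefs
    where
    f : Fin n → List ℤ
    f i = scale (y (Fin.suc i)) (+ 0 ∷ monomial (toℕ i))
    coefs : ∀ k → coef (add (scale (y Fin.zero) (+ 1 ∷ [])) (sum f)) k ≈ coef (y Fin.zero ∷ tabulate (y ∘ Fin.suc)) k
    coefs zero = R.trans (coef-add (scale (y Fin.zero) (+ 1 ∷ [])) (sum f) 0)
      (R.trans (R.+-cong (R.*-identityʳ (y Fin.zero)) (R.trans (coef-sum f 0)
        (R.trans (RSum.sum-cong-≋ {n} (λ i → R.zeroʳ (y (Fin.suc i)))) (RSum.sum-replicate-zero n)))) (R.+-identityʳ _))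
    coefs (suc k) = R.trans (coef-add (scale (y Fin.zero) (+ 1 ∷ [])) (sum f) (suc k))
      (R.trans (R.+-identityˡ _) (R.trans (coef-sum f (suc k))
        (R.trans (R.sym (coef-sum (λ i → scale (y (Fin.suc i)) (monomial (toℕ i))) k)) (at (combination (y ∘ Fin.suc)) k))))

  tabulate-degree : ∀ {n} (y : Fin n → ℤ) → DegreeBelow n (tabulate y)
  tabulate-degree {zero}  y k       _         = R.refl
  tabulate-degree {suc n} y (suc k) (s≤s n≤k) = tabulate-degree (y ∘ Fin.suc) k n≤k

  coef-tabulate : ∀ {n} (y : Fin n → ℤ) i → coef (tabulate y) (toℕ i) ≡ y i
  coef-tabulate y Fin.zero    = ≡.refl
  coef-tabulate y (Fin.suc i) = coef-tabulate (y ∘ Fin.suc) i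

  twoTerms : ∀ z j → (∀ k → k ≢ j → coef z (suc k) ≈ + 0) →
    z ≋ add (coef z 0 ∷ []) (scale (coef z (suc j)) (monomial (suc j)))
  twoTerms z j others = mk λ k → R.trans (pointwise k) (R.sym (R.trans
    (coef-add (coef z 0 ∷ []) (scale zⱼ (monomial (suc j))) k)
    (R.+-congˡ {coef (coef z 0 ∷ []) k} (coef-scale zⱼ (monomial (suc j)) k))))
    where
    zⱼ = coef z (suc j)
    higher : ∀ k → Dec (k ≡ j) → coef z (suc k) ≈ zⱼ R.* coef (monomial j) k
    higher k (yes ≡.refl) = R.sym (R.trans (R.*-congˡ {zⱼ} (R.reflexive (coef-monomial k))) (R.*-identityʳ zⱼ))
    higher k (no  k≢j)    = R.trans (others k k≢j)
      (R.sym (R.trans (R.*-congˡ {zⱼ} (R.reflexive (coef-monomial-≢ j k k≢j))) (R.zeroʳ zⱼ)))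
    pointwise : ∀ k → coef z k ≈ coef (coef z 0 ∷ []) k R.+ zⱼ R.* coef (monomial (suc j)) k
    pointwise zero    = R.sym (R.trans (R.+-congˡ {coef z 0} (R.zeroʳ zⱼ)) (R.+-identityʳ (coef z 0)))
    pointwise (suc k) = R.trans (higher k (k ℕ.≟ j)) (R.sym (R.+-identityˡ _))

  φ-twoTerms : ∀ V z j → (∀ k → k ≢ j → coef z (suc k) ≈ + 0) →
    φ V z ≈ coef z 0 ℤ.* V 0 ℤ.+ coef z (suc j) ℤ.* V (suc j)
  φ-twoTerms V z j others = R.trans (∣⇒≈ (φ-≋ V (twoTerms z j others))) (R.reflexive
    (≡.trans (φ-add V (coef z 0 ∷ []) (scale (coef z (suc j)) (monomial (suc j))))
      (cong₂ ℤ._+_ (ℤP.+-identityʳ (coef z 0 ℤ.* V 0)) (≡.trans (φ-scale V (coef z (suc j)) (monomial (suc j)))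
        (cong (coef z (suc j) ℤ.*_) (φ-monomial V (suc j)))))))

  module _ (d<p : d < p) {T : ℕ → ℤ} (T-rec : Recurrence d r T) (T₀ : T 0 ≡ + d) where

    -- If 1 were zero as a residue, p would divide φ_T(1) = d, although 0 < d < p.
    1≉ₘ0 : ¬ ((+ 1 ∷ []) ≈ₘ [])
    1≉ₘ0 eq = <⇒≉0 (s≤s z≤n) d<p (∣⇒≈0 (subst (+ p ∣ℤ.∣_) φ1≡d (φ-≈ₘ T T-rec eq)))
      where
      φ1≡d : φ T (+ 1 ∷ []) ℤ.- + 0 ≡ + d
      φ1≡d = ≡.trans (ℤP.+-identityʳ _) (≡.trans (φ-monomial T 0) T₀)

    independent : ∀ f → DegreeBelow d f → f ≈ₘ [] → f ≋ []
    independent = E.residue-independent 1≉ₘ0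

    constant-≉0 : ∀ n → 1 ≤ n → n < p → ¬ (n · (+ 1 ∷ []) ≈ₘ [])
    constant-≉0 n 1≤n n<p eq = <⇒≉0 1≤n n<p
      (at (independent (+ n ∷ []) degree (F.trans (F.sym (≋⇒≈ₘ (·1≋constant n))) eq)) 0)
      where
      degree : DegreeBelow d (+ n ∷ [])
      degree (suc k) _ = R.refl

    p≈ₘ0 : p · (+ 1 ∷ []) ≈ₘ []
    p≈ₘ0 = ≋⇒≈ₘ (P.trans (·1≋constant p) (mk λ { zero → p≈0 ; (suc k) → R.refl }))

    open Frobenius F pr using (frobenius-combination; frobenius-fixed)

    -- Written in the shape to which `frobenius-combination` applies; it is the residue of the
    -- coefficient list of `y`.
    evaluate : (Fin d → ℤ) → List ℤ
    evaluate y = sum (λ i → FInt.fromℤ (y i) F.* X ^ toℕ i)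

    evaluate≈tabulate : ∀ y → evaluate y ≈ₘ tabulate y
    evaluate≈tabulate y = F.trans (sum-cong-≋ {d} term) (≋⇒≈ₘ (combination y))
      where
      term : ∀ i → FInt.fromℤ (y i) F.* X ^ toℕ i ≈ₘ scale (y i) (monomial (toℕ i))
      term i = F.trans (F.*-cong (≋⇒≈ₘ (fromℤ≋constant (y i))) (≋⇒≈ₘ (X^≋monomial (toℕ i))))
        (≋⇒≈ₘ (scale-constant (y i) (monomial (toℕ i))))

    -- The difference of the two sides has degree below d, so if it vanishes as a residue it
    -- vanishes as a polynomial.
    evaluate-constant : ∀ y n → evaluate y ≈ₘ n · (+ 1 ∷ []) → ∀ i → y (Fin.suc i) ≈ + 0
    evaluate-constant y n eq i = R.trans (R.reflexive (≡.sym (coef-tabulate y (Fin.suc i))))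
        (R.trans (R.sym (coef-difference (toℕ i))) (at (independent difference degree difference≈0) (suc (toℕ i))))
      where
      difference = add (tabulate y) (neg (+ n ∷ []))
      coef-difference : ∀ k → coef difference (suc k) ≈ coef (tabulate y) (suc k)
      coef-difference k = R.trans (coef-add (tabulate y) (neg (+ n ∷ [])) (suc k)) (R.+-identityʳ (coef (tabulate y) (suc k)))
      degree : DegreeBelow d difference
      degree (suc k) d≤k = R.trans (coef-difference k) (tabulate-degree y (suc k) d≤k)
      difference≈0 : difference ≈ₘ []
      difference≈0 = F.trans (F.+-congʳ {neg (+ n ∷ [])} {tabulate y} {+ n ∷ []}
        (F.trans (F.sym (evaluate≈tabulate y)) (F.trans eq (≋⇒≈ₘ (·1≋constant n)))))
        (F.-‿inverseʳ (+ n ∷ []))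

    fixed-combination : ∀ (y : Fin d → ℤ) →
      sum (λ i → FInt.fromℤ (y i) F.* X ^ (toℕ i ℕ.* p)) ≈ₘ evaluate y → ¬ (∀ n → ¬ (evaluate y ≈ₘ n · (+ 1 ∷ [])))
    fixed-combination y fixed nonconstant = frobenius-fixed E.residue-cancel 1≉ₘ0 p≈ₘ0 constant-≉0 (evaluate y)
      (F.trans (frobenius-combination p≈ₘ0 d y X) fixed) (λ n → nonconstant (toℕ n))

    private
      division : ∀ m → Σ (List ℤ) λ q → Σ (List ℤ) λ s → (monomial (m ℕ.* p) ≋ add (mul q C) s) × DegreeBelow d s
      division m = divide (charPoly-monic d r) (monomial (m ℕ.* p))

    remainder : ℕ → List ℤ
    remainder m = proj₁ (proj₂ (division m))

    remainder≈monomial : ∀ m → remainder m ≈ₘ monomial (m ℕ.* p)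
    remainder≈monomial m = F.sym (proj₁ (division m) by P.trans
      (P.+-congʳ {neg (remainder m)} (proj₁ (proj₂ (proj₂ (division m)))))
      (P.trans (P.+-assoc (mul (proj₁ (division m)) C) (remainder m) (neg (remainder m)))
        (P.trans (P.+-congˡ {mul (proj₁ (division m)) C} (P.-‿inverseʳ (remainder m))) (P.+-identityʳ _))))

    -- The residue of x^{pm} − x^m in degree below d.
    L : ℕ → List ℤ
    L m = add (remainder m) (neg (monomial m))

    L-degree : ∀ m → m < d → DegreeBelow d (L m)
    L-degree m m<d k d≤k = R.trans (coef-add (remainder m) (neg (monomial m)) k)
      (R.trans (R.+-cong (proj₂ (proj₂ (proj₂ (division m))) k d≤k)
        (R.trans (coef-neg (monomial m) k) (R.reflexive (cong ℤ.-_ (coef-monomial-≢ m k (ℕP.>⇒≢ (ℕP.≤-trans m<d d≤k)))))))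
        (R.+-identityˡ (+ 0)))

    Periodic : (ℕ → ℤ) → Set
    Periodic V = ∀ m → 1 ≤ m → m < p → + p ∣ℤ.∣ V (m ℕ.* p) ℤ.- V m

    -- φ_V sends x^{pm} - xᵐ to V(p m) - V(m). As d < p, each positive m below d is in the range of
    -- `Periodic`; at m = 0 the difference is 0.
    φ-L : ∀ V → Recurrence d r V → Periodic V → ∀ m → m < d → + p ∣ℤ.∣ φ V (L m)
    φ-L V rec per m m<d = subst (+ p ∣ℤ.∣_) eq
      (∣ℤ.∣m∣n⇒∣m+n (φ-≈ₘ V rec (remainder≈monomial m)) (periodic m m<d))
      where
      open ≡.≡-Reasoning
      periodic : ∀ m → m < d → + p ∣ℤ.∣ V (m ℕ.* p) ℤ.- V m
      periodic zero    _   = ∣ℤ.divides (+ 0) (ℤP.+-inverseʳ (V 0))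
      periodic (suc m) m<d = per (suc m) (s≤s z≤n) (ℕP.<-trans m<d d<p)
      eq : (φ V (remainder m) ℤ.- φ V (monomial (m ℕ.* p))) ℤ.+ (V (m ℕ.* p) ℤ.- V m) ≡ φ V (L m)
      eq = begin
        (φ V (remainder m) ℤ.- φ V (monomial (m ℕ.* p))) ℤ.+ (V (m ℕ.* p) ℤ.- V m)
          ≡⟨ cong (λ x → (φ V (remainder m) ℤ.- x) ℤ.+ (V (m ℕ.* p) ℤ.- V m)) (φ-monomial V (m ℕ.* p)) ⟩
        (φ V (remainder m) ℤ.- V (m ℕ.* p)) ℤ.+ (V (m ℕ.* p) ℤ.- V m)
          ≡⟨ S.solve 3 (λ a b c → (a S.:- b) S.:+ (b S.:- c) S.:= a S.:+ (S.:- c)) ≡.refl (φ V (remainder m)) (V (m ℕ.* p)) (V m) ⟩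
        φ V (remainder m) ℤ.- V m
          ≡⟨ cong (λ x → φ V (remainder m) ℤ.- x) (φ-monomial V m) ⟨
        φ V (remainder m) ℤ.- φ V (monomial m)
          ≡⟨ cong (ℤ._+_ (φ V (remainder m))) (φ-neg V (monomial m)) ⟨
        φ V (remainder m) ℤ.+ φ V (neg (monomial m))
          ≡⟨ φ-add V (remainder m) (neg (monomial m)) ⟨
        φ V (L m) ∎
        where module S = +-*-Solver

    -- Frobenius minus the identity, applied to Σ yₘ xᵐ and reduced to degree below d.
    image : (Fin d → ℤ) → List ℤ
    image y = sum (λ m → scale (y m) (L (toℕ m)))

    image-degree : ∀ y → DegreeBelow d (image y)
    image-degree y k d≤k = R.trans (coef-sum (λ m → scale (y m) (L (toℕ m))) k)
      (R.trans (RSum.sum-cong-≋ {d} (λ m → R.trans (coef-scale (y m) (L (toℕ m)) k)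
        (R.trans (R.*-congˡ {y m} (L-degree (toℕ m) (FinP.toℕ<n m) k d≤k)) (R.zeroʳ (y m))))) (RSum.sum-replicate-zero d))

    φ-image : ∀ V → Recurrence d r V → Periodic V → ∀ y → + p ∣ℤ.∣ φ V (image y)
    φ-image V rec per y = φ-sum-∣ V (λ m → scale (y m) (L (toℕ m)))
      (λ m → subst (+ p ∣ℤ.∣_) (≡.sym (φ-scale V (y m) (L (toℕ m))))
        (∣ℤ.∣n⇒∣m*n (y m) (φ-L V rec per (toℕ m) (FinP.toℕ<n m))))

    image≈0⇒fixed : ∀ y → image y ≈ₘ [] → sum (λ i → FInt.fromℤ (y i) F.* X ^ (toℕ i ℕ.* p)) ≈ₘ evaluate y
    image≈0⇒fixed y eq = F.trans (sum-cong-≋ {d} term) (F.trans (∑-distrib-+ {d} (λ i → scale (y i) (L (toℕ i))) (λ i → FInt.fromℤ (y i) F.* X ^ toℕ i))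
      (F.trans (F.+-congʳ {evaluate y} eq) (F.+-identityˡ (evaluate y))))
      where
      split : ∀ c l q m → l ≈ₘ q F.- m → c F.* q ≈ₘ c F.* l F.+ c F.* m
      split c l q m eq = F.trans (F.*-congˡ {c} (F.trans (F.sym (F.+-identityʳ q))
        (F.trans (F.+-congˡ {q} (F.sym (F.-‿inverseˡ m)))
          (F.trans (F.sym (F.+-assoc q (F.- m) m)) (F.+-congʳ {m} (F.sym eq))))))
        (F.distribˡ c l m)
      term : ∀ i → FInt.fromℤ (y i) F.* X ^ (toℕ i ℕ.* p) ≈ₘ
        scale (y i) (L (toℕ i)) F.+ FInt.fromℤ (y i) F.* X ^ toℕ i
      term i = F.trans (split (FInt.fromℤ (y i)) (L (toℕ i)) (X ^ (toℕ i ℕ.* p)) (X ^ toℕ i) L≈)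
        (F.+-congʳ {FInt.fromℤ (y i) F.* X ^ toℕ i} (F.trans (F.*-congʳ {L (toℕ i)} (≋⇒≈ₘ (fromℤ≋constant (y i)))) (≋⇒≈ₘ (scale-constant (y i) (L (toℕ i))))))
        where
        L≈ : L (toℕ i) ≈ₘ X ^ (toℕ i ℕ.* p) F.- X ^ toℕ i
        L≈ = F.+-cong (F.trans (remainder≈monomial (toℕ i)) (F.sym (≋⇒≈ₘ (X^≋monomial (toℕ i ℕ.* p)))))
          (F.-‿cong (F.sym (≋⇒≈ₘ (X^≋monomial (toℕ i)))))

    -- Otherwise Σ yₘ xᵐ would be fixed by Frobenius, hence constant, and its nonzero coefficient,
    -- which is not y₀, would vanish.
    image≉0 : ∀ y → y Fin.zero ≈ + 0 → (∃ λ i → ¬ (y i ≈ + 0)) → ¬ (image y ≋ [])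
    image≉0 y y₀≈0 (Fin.zero  , y≉0) _       = y≉0 y₀≈0
    image≉0 y y₀≈0 (Fin.suc i , y≉0) image≋0 = fixed-combination y (image≈0⇒fixed y (≋⇒≈ₘ image≋0))
      (λ n eq → y≉0 (evaluate-constant y n eq i))

    module _ {w : ℕ → ℤ} (w-rec : Recurrence d r w) (w₀ : w 0 ≡ + 0) (T-per : Periodic T) (w-per : Periodic w) where

      -- If only the coordinates 0 and j + 1 of z can be nonzero, φ w kills the latter and then φ T the former.
      vanishing : ∀ z j → ¬ (w (suc j) ≈ + 0) → (∀ k → k ≢ j → coef z (suc k) ≈ + 0) →
        φ T z ≈ + 0 → φ w z ≈ + 0 → z ≋ []
      vanishing z j w≉0 others φT≈0 φw≈0 = mk λ { zero → z₀≈0 ; (suc k) → higher k (k ℕ.≟ j) }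
        where
        zⱼ = coef z (suc j)
        z₀ = coef z 0
        zⱼ≈0 : zⱼ ≈ + 0
        zⱼ≈0 = cancel (w (suc j)) zⱼ w≉0 (R.trans (R.reflexive (≡.trans (ℤP.*-comm (w (suc j)) zⱼ) (≡.sym (≡.trans
            (cong (λ x → z₀ ℤ.* x ℤ.+ zⱼ ℤ.* w (suc j)) w₀)
            (≡.trans (cong (ℤ._+ zⱼ ℤ.* w (suc j)) (ℤP.*-zeroʳ z₀)) (ℤP.+-identityˡ _))))))
          (R.trans (R.sym (φ-twoTerms w z j others)) φw≈0))
        z₀≈0 : z₀ ≈ + 0
        z₀≈0 = cancel (+ d) z₀ (<⇒≉0 (s≤s z≤n) d<p)
          (R.trans (R.reflexive (≡.trans (ℤP.*-comm (+ d) z₀) (cong (z₀ ℤ.*_) (≡.sym T₀))))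
          (R.trans (R.sym (R.trans (R.+-congˡ {z₀ ℤ.* T 0} (R.trans (R.*-congʳ {T (suc j)} zⱼ≈0) (R.zeroˡ (T (suc j)))))
              (R.+-identityʳ (z₀ ℤ.* T 0))))
            (R.trans (R.sym (φ-twoTerms T z j others)) φT≈0)))
        higher : ∀ k → Dec (k ≡ j) → coef z (suc k) ≈ + 0
        higher k (yes ≡.refl) = zⱼ≈0
        higher k (no  k≢j)    = others k k≢j

      image≋0 : ∀ y (j : Fin d′) → ¬ (w (suc (toℕ j)) ≈ + 0) →
        (∀ i → i ≢ j → coef (image y) (suc (toℕ i)) ≈ + 0) → image y ≋ []
      image≋0 y j w≉0 rows = vanishing (image y) (toℕ j) w≉0 (λ k → others k (k ℕ.<? d′))
          (∣⇒≈0 (φ-image T T-rec T-per y)) (∣⇒≈0 (φ-image w w-rec w-per y))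
        where
        others : ∀ k → Dec (k < d′) → k ≢ toℕ j → coef (image y) (suc k) ≈ + 0
        others k (yes k<d′) k≢j = R.trans (R.reflexive (cong (λ k → coef (image y) (suc k)) (≡.sym (FinP.toℕ-fromℕ< k<d′))))
          (rows (Fin.fromℕ< k<d′) (λ eq → k≢j (≡.trans (≡.sym (FinP.toℕ-fromℕ< k<d′)) (cong toℕ eq))))
        others k (no  k≮d′) k≢j = image-degree y (suc k) (s≤s (ℕP.≮⇒≥ k≮d′))

      private
        unitRow : Fin d → ℤ
        unitRow Fin.zero    = + 1
        unitRow (Fin.suc _) = + 0

        -- Row j, whose coordinate j + 1 of the image is left free, is reused for the condition y₀ =
        -- 0. This keeps the number of equations at d - 1, one less than the unknowns.
        equations : Fin d′ → Fin d′ → Fin d → ℤ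
        equations j i m = if does (i FinP.≟ j) then unitRow m else coef (L (toℕ m)) (suc (toℕ i))

      w≈0 : ∀ (j : Fin d′) → w (suc (toℕ j)) ≈ + 0
      w≈0 j = by-cases (zero? (w (suc (toℕ j))))
        where
        Solution = Σ (Fin d → ℤ) λ y → (∃ λ i → ¬ (y i ≈ + 0)) × (∀ i → RSum.sum (λ m → equations j i m R.* y m) ≈ + 0)
        contradiction : ¬ (w (suc (toℕ j)) ≈ + 0) → Solution → ⊥
        contradiction neq (y , nonzero , rows) = image≉0 y y₀≈0 nonzero (image≋0 y j neq other)
          where
          -- The boolean is generalised so that either branch of the conditional in `equations` can
          -- be selected by an equation.
          row : ∀ i b → does (i FinP.≟ j) ≡ b →
            RSum.sum (λ m → (if b then unitRow m else coef (L (toℕ m)) (suc (toℕ i))) R.* y m) ≈ + 0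
          row i b ≡.refl = rows i
          y₀≈0 : y Fin.zero ≈ + 0
          y₀≈0 = R.trans (R.sym (R.trans (R.+-cong (R.*-identityˡ (y Fin.zero))
            (R.trans (RSum.sum-cong-≋ {d′} (λ m → R.zeroˡ (y (Fin.suc m)))) (RSum.sum-replicate-zero d′))) (R.+-identityʳ (y Fin.zero))))
            (row j true (dec-true (j FinP.≟ j) ≡.refl))
          other : ∀ i → i ≢ j → coef (image y) (suc (toℕ i)) ≈ + 0
          other i i≢j = R.trans (coef-sum (λ m → scale (y m) (L (toℕ m))) (suc (toℕ i)))
            (R.trans (RSum.sum-cong-≋ {d} (λ m → R.trans (coef-scale (y m) (L (toℕ m)) (suc (toℕ i))) (R.*-comm (y m) (coef (L (toℕ m)) (suc (toℕ i))))))
              (row i false (dec-false (i FinP.≟ j) i≢j)))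
        by-cases : Dec (w (suc (toℕ j)) ≈ + 0) → w (suc (toℕ j)) ≈ + 0
        by-cases (yes eq)  = eq
        by-cases (no  neq) = ⊥-elim (contradiction neq
          (LinearSystem.nontrivialSolution Rp zero? 1≉0 cancel d′ d ℕP.≤-refl (equations j)))

-- Roots in a field of characteristic zero

∣-<⇒≡0 : ∀ {p x} → ℤ.∣ x ∣ < p → + p ∣ℤ.∣ x → x ≡ + 0
∣-<⇒≡0 {p} {x} x<p p∣x = ℤP.∣i∣≡0⇒i≡0 (small ℤ.∣ x ∣ x<p (∣ℤ.∣⇒∣ᵤ p∣x))
  where
  small : ∀ n → n < p → p ∣ n → n ≡ 0
  small zero      _   _   = ≡.refl
  small n@(suc _) n<p p∣n = ⊥-elim (∣.>⇒∤ n<p p∣n)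

-- From 1 ≤ c < p it follows that p ∤ c, so c cancels from the congruence for c U.
almostDold⇒prime-congruence : ∀ {p c} (U : ℕ → ℤ) → Prime p → 1 ≤ c → c < p → Dold (λ n → + c ℤ.* U n) →
  ∀ m → 1 ≤ m → m < p → + p ∣ℤ.∣ U (m ℕ.* p) ℤ.- U m
almostDold⇒prime-congruence {p} {c} U pr 1≤c c<p dold m 1≤m m<p
  with ModPrime.prime-∣-* pr (+ c) (U (m ℕ.* p) ℤ.- U m) (subst (+ p ∣ℤ.∣_)
    (S.solve 3 (λ c x y → c S.:* x S.:- c S.:* y S.:= c S.:* (x S.:- y)) ≡.refl (+ c) (U (m ℕ.* p)) (U m))
    (dold⇒prime-congruence {A = λ n → + c ℤ.* U n} pr dold m 1≤m m<p))
  where module S = +-*-Solver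
... | inj₁ p∣c = ⊥-elim (∣.>⇒∤ {{ℕ.>-nonZero 1≤c}} c<p (∣ℤ.∣⇒∣ᵤ p∣c))
... | inj₂ p∣U = p∣U

-- The reciprocal polynomial 1 - r₁ x - ⋯ - r_d xᵈ, that is, the coefficients of C from the top
-- down.
recurrenceSeries : ∀ {d} → (Fin d → ℤ) → ℕ → ℤ
recurrenceSeries r = coeff (+ 1 ∷ tabulate (λ i → ℤ.- r i))

recurrenceSeries-degree : ∀ {d} (r : Fin d → ℤ) k → d < k → recurrenceSeries r k ≡ + 0
recurrenceSeries-degree r (suc k) (s≤s d≤k) = beyond (λ i → ℤ.- r i) k d≤k
  where
  beyond : ∀ {d} (g : Fin d → ℤ) k → d ≤ k → coeff (tabulate g) k ≡ + 0
  beyond {zero}  g k       _         = ≡.refl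
  beyond {suc d} g (suc k) (s≤s d≤k) = beyond (g ∘ Fin.suc) k d≤k

-- Power sums of the roots of the characteristic polynomial in positive degree, by Newton's identities.
newtonSums : ∀ {d} → (Fin d → ℤ) → ℕ → ℤ
newtonSums r = ℤSeries.quotient (λ n → ℤ.- ℤSeries.δ (recurrenceSeries r) n) (recurrenceSeries r)

newtonSums-logDerivative : ∀ {d} (r : Fin d → ℤ) → ℤSeries.LogDerivative (newtonSums r) (recurrenceSeries r)
newtonSums-logDerivative r = ℤSeries.conv-quotient _ (recurrenceSeries r) ≡.refl

-- A logarithmic derivative has constant term 0, but the sum of the zeroth powers is d. With this
-- value at 0 the recurrence already holds at n = d, and φ_T(1) = d.
traces : ∀ {d} → (Fin d → ℤ) → ℕ → ℤ
traces {d} r zero    = + d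
traces     r (suc n) = newtonSums r (suc n)

traces-dold : ∀ {d} (r : Fin d → ℤ) → ∀ n → NonZero n → + n ∣ℤ.∣ doldSum (traces r) n
traces-dold r n n≢0 = subst (+ n ∣ℤ.∣_) (doldSum-cong n (λ { (suc m) _ _ → ≡.refl }))
  (logDerivative-dold n {{n≢0}} ≡.refl (newtonSums-logDerivative r))

module OverField {a ℓ} (K : Field a ℓ) (charZero : FieldOps.CharZero K) where
  open Field K using (commutativeRing; inverse)
  open CommutativeRing commutativeRing
  open IntegerCoefficients commutativeRing
  open Series commutativeRing
  open import Algebra.Properties.Semiring.Mult semiring using () renaming (_×_ to _·_)
  open import Algebra.Properties.Semiring.Exp semiring using (_^_; ^-homo-*)
  open import Algebra.Properties.Semiring.Sum semiring using (sum; sum-cong-≋; ∑-comm; ∑-distrib-+; *-distribˡ-sum; sum-replicate)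
  open import Algebra.Properties.Ring ring using (-0#≈0#)
  open import Relation.Binary.Reasoning.Setoid setoid
  module Ops = FieldOps K

  fromℕ≡· : ∀ n → Ops.fromℕ n ≡ n · 1#
  fromℕ≡· zero    = ≡.refl
  fromℕ≡· (suc n) = cong (λ x → 1# + x) (fromℕ≡· n)

  fromℤ≡ : ∀ x → Ops.fromℤ x ≡ fromℤ x
  fromℤ≡ (+ n)    = fromℕ≡· n
  fromℤ≡ -[1+ n ] = cong (λ y → - y) (fromℕ≡· (suc n))

  ^≡ : ∀ x n → x Ops.^ n ≡ x ^ n
  ^≡ x zero    = ≡.refl
  ^≡ x (suc n) = cong (x *_) (^≡ x n)

  sumFin≈sum : ∀ {d} {f g : Fin d → Carrier} → (∀ i → f i ≈ g i) → Ops.sumFin f ≈ sum g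
  sumFin≈sum {zero}  eq = refl
  sumFin≈sum {suc d} eq = +-cong (eq Fin.zero) (sumFin≈sum (eq ∘ Fin.suc))

  cancel : ∀ x y → ¬ (x ≈ 0#) → x * y ≈ 0# → y ≈ 0#
  cancel x y x≉0 xy≈0 with inverse x x≉0
  ... | x⁻¹ , xx⁻¹≈1 = begin
    y                ≈⟨ *-identityˡ y ⟨
    1# * y           ≈⟨ *-congʳ xx⁻¹≈1 ⟨
    x * x⁻¹ * y      ≈⟨ solve 3 (λ x u y → x :* u :* y := u :* (x :* y)) refl x x⁻¹ y ⟩
    x⁻¹ * (x * y)    ≈⟨ *-congˡ xy≈0 ⟩
    x⁻¹ * 0#         ≈⟨ zeroʳ _ ⟩
    0#               ∎

  open Cancellative cancel using (newton; vandermonde)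

  ·1≉0 : ∀ n → .{{NonZero n}} → ¬ (n · 1# ≈ 0#)
  ·1≉0 n@(suc _) eq = charZero n _ (trans (reflexive (fromℕ≡· n)) eq)

  fromℤ-≈0 : ∀ x → fromℤ x ≈ 0# → x ≡ + 0
  fromℤ-≈0 (+ zero)  eq = ≡.refl
  fromℤ-≈0 (+ suc n) eq = ⊥-elim (·1≉0 (suc n) eq)
  fromℤ-≈0 -[1+ n ]  eq = ⊥-elim (·1≉0 (suc n) (begin
    suc n · 1#          ≈⟨ solve 1 (λ x → x := :- (:- x)) refl _ ⟩
    - - (suc n · 1#)    ≈⟨ -‿cong eq ⟩
    - 0#                ≈⟨ -0#≈0# ⟩
    0#                  ∎))

  fromℤ-sub : ∀ x y → fromℤ (x ℤ.- y) ≈ fromℤ x - fromℤ y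
  fromℤ-sub x y = trans (fromℤ-+ x (ℤ.- y)) (+-congˡ (fromℤ-neg y))

  -- Characteristic zero embeds ℤ in K, so identities obtained from the roots can be brought back to
  -- integers.
  fromℤ-injective : ∀ x y → fromℤ x ≈ fromℤ y → x ≡ y
  fromℤ-injective x y eq = ℤP.i-j≡0⇒i≡j x y (fromℤ-≈0 (x ℤ.- y)
    (trans (fromℤ-sub x y) (trans (+-congʳ eq) (-‿inverseʳ _))))

  fromℤ-sum : ∀ {d} (f : Fin d → ℤ) → fromℤ (sumFinℤ f) ≈ sum (λ i → fromℤ (f i))
  fromℤ-sum {zero}  f = refl
  fromℤ-sum {suc d} f = trans (fromℤ-+ (f Fin.zero) _) (+-congˡ (fromℤ-sum (f ∘ Fin.suc)))

  fromℤ-conv : ∀ f g n → fromℤ (ℤSeries.conv f g n) ≈ conv (fromℤ ∘ f) (fromℤ ∘ g) n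
  fromℤ-conv f g zero    = fromℤ-* (f 0) (g 0)
  fromℤ-conv f g (suc n) = trans (fromℤ-+ (f 0 ℤ.* g (suc n)) _)
    (+-cong (fromℤ-* (f 0) (g (suc n))) (fromℤ-conv (f ∘ suc) g n))

  fromℤ-logDerivative : ∀ {t E} → ℤSeries.LogDerivative t E → LogDerivative (fromℤ ∘ t) (fromℤ ∘ E)
  fromℤ-logDerivative {t} {E} h n = begin
    conv (fromℤ ∘ t) (fromℤ ∘ E) n       ≈⟨ fromℤ-conv t E n ⟨
    fromℤ (ℤSeries.conv t E n)           ≡⟨ cong fromℤ (≡.trans (h n) (cong (λ x → ℤ.- (x ℤ.* E n)) (GaussCongruence.n·1≡n n))) ⟩
    fromℤ (ℤ.- (+ n ℤ.* E n))            ≈⟨ fromℤ-neg (+ n ℤ.* E n) ⟩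
    - fromℤ (+ n ℤ.* E n)                ≈⟨ -‿cong (fromℤ-* (+ n) (E n)) ⟩
    - (n · 1# * fromℤ (E n))             ∎

  -- `horner` adds the constant coefficient last; peeling off the leading one instead permits
  -- induction along `tabulate`.
  horner-suc : ∀ E x n → horner E x (suc n) ≈ E 0 * x ^ suc n + horner (E ∘ suc) x n
  horner-suc E x zero    = +-congʳ (solve 2 (λ x e → x :* e := e :* (x :* con (+ 1))) refl x (E 0))
  horner-suc E x (suc n) = trans (+-congʳ (*-congˡ (horner-suc E x n)))
    (solve 5 (λ x e u h e′ → x :* (e :* u :+ h) :+ e′ := e :* (x :* u) :+ (x :* h :+ e′)) refl x (E 0) (x ^ suc n) _ _)

  horner-coeff : ∀ {d} b (g : Fin d → ℤ) x → horner (fromℤ ∘ coeff (b ∷ tabulate g)) x d ≈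
    fromℤ b * x ^ d + sum (λ i → fromℤ (g i) * x ^ (d ℕ.∸ suc (toℕ i)))
  horner-coeff {zero}  b g x = solve 1 (λ b → b := b :* con (+ 1) :+ con (+ 0)) refl (fromℤ b)
  horner-coeff {suc d} b g x = trans (horner-suc _ x d) (+-congˡ (horner-coeff (g Fin.zero) (g ∘ Fin.suc) x))

  module Roots {d : ℕ} (r : Fin d → ℤ) (α : Fin d → Carrier)
    (distinct : ∀ i j → α i ≈ α j → i ≡ j) (roots : ∀ i → Ops.IsRootOfChar d r (α i)) where

    root : ∀ j → α j ^ d ≈ sum (λ i → fromℤ (r i) * α j ^ (d ℕ.∸ suc (toℕ i)))
    root j = begin
      α j ^ d                    ≈⟨ solve 2 (λ x y → x := x :- y :+ y) refl (α j ^ d) s ⟩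
      α j ^ d - s + s            ≈⟨ +-congʳ (+-cong (reflexive (≡.sym (^≡ (α j) d))) (-‿cong (sym (sumFin≈sum {d} (λ i →
                                      *-cong (reflexive (fromℤ≡ (r i))) (reflexive (^≡ (α j) (d ℕ.∸ suc (toℕ i))))))))) ⟩
      _ + s                      ≈⟨ +-congʳ (roots j) ⟩
      0# + s                     ≈⟨ +-identityˡ s ⟩
      s                          ∎
      where s = sum (λ i → fromℤ (r i) * α j ^ (d ℕ.∸ suc (toℕ i)))

    horner-root : ∀ j → horner (fromℤ ∘ recurrenceSeries r) (α j) d ≈ 0#
    horner-root j = begin
      horner (fromℤ ∘ recurrenceSeries r) (α j) d
        ≈⟨ horner-coeff (+ 1) (λ i → ℤ.- r i) (α j) ⟩
      fromℤ (+ 1) * α j ^ d + sum (λ i → fromℤ (ℤ.- r i) * α j ^ (d ℕ.∸ suc (toℕ i)))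
        ≈⟨ +-cong (*-congʳ (+-identityʳ 1#)) (sum-cong-≋ {d} (λ i → trans (*-congʳ (fromℤ-neg (r i)))
             (solve 2 (λ x y → (:- x) :* y := (:- con (+ 1)) :* (x :* y)) refl (fromℤ (r i)) _))) ⟩
      1# * α j ^ d + sum (λ i → - 1# * (fromℤ (r i) * α j ^ (d ℕ.∸ suc (toℕ i))))
        ≈⟨ +-cong (*-congˡ (root j)) (sym (*-distribˡ-sum {d} (- 1#) _)) ⟩
      1# * s + - 1# * s
        ≈⟨ solve 1 (λ s → con (+ 1) :* s :+ (:- con (+ 1)) :* s := con (+ 0)) refl s ⟩
      0# ∎
      where s = sum (λ i → fromℤ (r i) * α j ^ (d ℕ.∸ suc (toℕ i)))

    -- In positive degree both sides are logarithmic derivatives of the same series with constant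
    -- term 1, and such a derivative is unique. This is also how the power sums are seen to be
    -- integers.
    traces≈powerSums : ∀ n → fromℤ (traces r n) ≈ sum (λ i → α i ^ n)
    traces≈powerSums zero    = sym (sum-replicate d)
    traces≈powerSums (suc n) = logDerivative-unique {E = fromℤ ∘ recurrenceSeries r} (+-identityʳ 1#)
      (fromℤ-logDerivative (newtonSums-logDerivative r))
      (newton d α distinct (fromℤ ∘ recurrenceSeries r)
        (λ k d<k → reflexive (cong fromℤ (recurrenceSeries-degree r k d<k))) horner-root) (suc n)

    root-shifted : ∀ j n → d ≤ n → α j ^ n ≈ sum (λ i → fromℤ (r i) * α j ^ (n ℕ.∸ suc (toℕ i)))
    root-shifted j n d≤n = begin
      x ^ n                                                      ≡⟨ cong (x ^_) (ℕP.m∸n+n≡m d≤n) ⟨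
      x ^ (k ℕ.+ d)                                              ≈⟨ ^-homo-* x k d ⟩
      x ^ k * x ^ d                                              ≈⟨ *-congˡ (root j) ⟩
      x ^ k * sum (λ i → fromℤ (r i) * x ^ (d ℕ.∸ suc (toℕ i)))  ≈⟨ *-distribˡ-sum {d} (x ^ k) _ ⟩
      sum (λ i → x ^ k * (fromℤ (r i) * x ^ (d ℕ.∸ suc (toℕ i)))) ≈⟨ sum-cong-≋ {d} term ⟩
      sum (λ i → fromℤ (r i) * x ^ (n ℕ.∸ suc (toℕ i)))          ∎
      where
      x = α j
      k = n ℕ.∸ d
      exponent : ∀ (i : Fin d) → k ℕ.+ (d ℕ.∸ suc (toℕ i)) ≡ n ℕ.∸ suc (toℕ i)
      exponent i = ≡.trans (≡.sym (ℕP.+-∸-assoc k (FinP.toℕ<n i))) (cong (ℕ._∸ suc (toℕ i)) (ℕP.m∸n+n≡m d≤n))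
      term : ∀ (i : Fin d) → x ^ k * (fromℤ (r i) * x ^ (d ℕ.∸ suc (toℕ i))) ≈ fromℤ (r i) * x ^ (n ℕ.∸ suc (toℕ i))
      term i = begin
        x ^ k * (fromℤ (r i) * x ^ (d ℕ.∸ suc (toℕ i)))     ≈⟨ solve 3 (λ a b c → a :* (b :* c) := b :* (a :* c)) refl (x ^ k) (fromℤ (r i)) _ ⟩
        fromℤ (r i) * (x ^ k * x ^ (d ℕ.∸ suc (toℕ i)))     ≈⟨ *-congˡ (^-homo-* x k (d ℕ.∸ suc (toℕ i))) ⟨
        fromℤ (r i) * x ^ (k ℕ.+ (d ℕ.∸ suc (toℕ i)))       ≡⟨ cong (λ n → fromℤ (r i) * x ^ n) (exponent i) ⟩
        fromℤ (r i) * x ^ (n ℕ.∸ suc (toℕ i))               ∎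

    -- The powers of each root satisfy the recurrence, hence so does any combination of them;
    -- injectivity of ℤ → K returns the identity to ℤ.
    recurrence : ∀ V (l : Fin d → Carrier) → (∀ n → fromℤ (V n) ≈ sum (λ j → l j * α j ^ n)) → Recurrence d r V
    recurrence V l eq n d≤n = fromℤ-injective (V n) _ (begin
      fromℤ (V n)
        ≈⟨ eq n ⟩
      sum (λ j → l j * α j ^ n)
        ≈⟨ sum-cong-≋ {d} (λ j → trans (*-congˡ (root-shifted j n d≤n)) (*-distribˡ-sum {d} (l j) _)) ⟩
      sum (λ j → sum (λ i → l j * (fromℤ (r i) * α j ^ (n ℕ.∸ suc (toℕ i)))))
        ≈⟨ ∑-comm {d} {d} _ ⟩
      sum (λ i → sum (λ j → l j * (fromℤ (r i) * α j ^ (n ℕ.∸ suc (toℕ i)))))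
        ≈⟨ sum-cong-≋ {d} (λ i → trans (sum-cong-≋ {d} (λ j →
             solve 3 (λ l r x → l :* (r :* x) := r :* (l :* x)) refl (l j) (fromℤ (r i)) _)) (sym (*-distribˡ-sum {d} (fromℤ (r i)) _))) ⟩
      sum (λ i → fromℤ (r i) * sum (λ j → l j * α j ^ (n ℕ.∸ suc (toℕ i))))
        ≈⟨ sum-cong-≋ {d} (λ i → trans (*-congˡ (sym (eq _))) (sym (fromℤ-* (r i) _))) ⟩
      sum (λ i → fromℤ (r i ℤ.* V (n ℕ.∸ suc (toℕ i))))
        ≈⟨ fromℤ-sum (λ i → r i ℤ.* V (n ℕ.∸ suc (toℕ i))) ⟨
      fromℤ (sumFinℤ (λ i → r i ℤ.* V (n ℕ.∸ suc (toℕ i)))) ∎)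

    traces-recurrence : Recurrence d r (traces r)
    traces-recurrence = recurrence (traces r) (λ _ → 1#)
      (λ n → trans (traces≈powerSums n) (sum-cong-≋ {d} (λ i → sym (*-identityˡ _))))

    module Solution (U : ℕ → ℤ) (l : Fin d → Carrier) (U≈ : ∀ n → fromℤ (U n) ≈ sum (λ i → l i * α i ^ n)) where

      -- The common value l₀ need not be an integer. Eliminating it between Uₙ = l₀ Tₙ and U₀ = l₀ d
      -- leaves an identity over ℤ, at the price of the factor d.
      constant⇒almostDold : 1 ≤ d → (∀ i j → l i ≈ l j) → AlmostDold U
      constant⇒almostDold 1≤d const = d , 1≤d , λ n n≢0 → ∣ℤ.∣⇒∣ᵤ (subst (+ n ∣ℤ.∣_) (≡.sym (doldSum-U n))
        (∣ℤ.∣n⇒∣m*n (U 0) (traces-dold r n n≢0)))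
        where
        l₀ = l (Fin.fromℕ< 1≤d)
        U≈l₀ : ∀ n → fromℤ (U n) ≈ l₀ * fromℤ (traces r n)
        U≈l₀ n = begin
          fromℤ (U n)                  ≈⟨ U≈ n ⟩
          sum (λ i → l i * α i ^ n)    ≈⟨ sum-cong-≋ {d} (λ i → *-congʳ (const i _)) ⟩
          sum (λ i → l₀ * α i ^ n)     ≈⟨ *-distribˡ-sum {d} l₀ _ ⟨
          l₀ * sum (λ i → α i ^ n)     ≈⟨ *-congˡ (traces≈powerSums n) ⟨
          l₀ * fromℤ (traces r n)      ∎
        dU≡ : ∀ n → + d ℤ.* U n ≡ U 0 ℤ.* traces r n
        dU≡ n = fromℤ-injective _ _ (begin
          fromℤ (+ d ℤ.* U n)                        ≈⟨ fromℤ-* (+ d) (U n) ⟩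
          fromℤ (+ d) * fromℤ (U n)                  ≈⟨ *-congˡ (U≈l₀ n) ⟩
          fromℤ (+ d) * (l₀ * fromℤ (traces r n))    ≈⟨ solve 3 (λ a b c → a :* (b :* c) := b :* a :* c) refl (fromℤ (+ d)) l₀ _ ⟩
          l₀ * fromℤ (+ d) * fromℤ (traces r n)      ≈⟨ *-congʳ (U≈l₀ 0) ⟨
          fromℤ (U 0) * fromℤ (traces r n)           ≈⟨ fromℤ-* (U 0) (traces r n) ⟨
          fromℤ (U 0 ℤ.* traces r n)                 ∎)
        doldSum-U : ∀ n → doldSum (λ n → + d ℤ.* U n) n ≡ U 0 ℤ.* doldSum (traces r) n
        doldSum-U n = ≡.trans (doldSum-cong n (λ m _ _ → dU≡ m)) (doldSum-* (U 0) (traces r) n)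

      -- Measures how far U is from a multiple of T; the two coefficients are chosen so that it
      -- vanishes at 0.
      defect : ℕ → ℤ
      defect n = + d ℤ.* U n ℤ.- U 0 ℤ.* traces r n

      defect₀ : defect 0 ≡ + 0
      defect₀ = ℤP.i≡j⇒i-j≡0 (ℤP.*-comm (+ d) (U 0))

      defect≈ : ∀ n → fromℤ (defect n) ≈ sum (λ i → (fromℤ (+ d) * l i - fromℤ (U 0)) * α i ^ n)
      defect≈ n = begin
        fromℤ (defect n)
          ≈⟨ trans (fromℤ-sub (+ d ℤ.* U n) (U 0 ℤ.* traces r n)) (+-cong (fromℤ-* (+ d) (U n)) (-‿cong (fromℤ-* (U 0) (traces r n)))) ⟩
        fromℤ (+ d) * fromℤ (U n) - fromℤ (U 0) * fromℤ (traces r n)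
          ≈⟨ +-cong (*-congˡ (U≈ n)) (-‿cong (*-congˡ (traces≈powerSums n))) ⟩
        fromℤ (+ d) * sum (λ i → l i * α i ^ n) - fromℤ (U 0) * sum (λ i → α i ^ n)
          ≈⟨ +-congˡ (solve 2 (λ x y → :- (x :* y) := (:- x) :* y) refl (fromℤ (U 0)) _) ⟩
        fromℤ (+ d) * sum (λ i → l i * α i ^ n) + - fromℤ (U 0) * sum (λ i → α i ^ n)
          ≈⟨ +-cong (*-distribˡ-sum {d} (fromℤ (+ d)) _) (*-distribˡ-sum {d} (- fromℤ (U 0)) _) ⟩
        sum (λ i → fromℤ (+ d) * (l i * α i ^ n)) + sum (λ i → - fromℤ (U 0) * α i ^ n)
          ≈⟨ ∑-distrib-+ {d} _ _ ⟨
        sum (λ i → fromℤ (+ d) * (l i * α i ^ n) + - fromℤ (U 0) * α i ^ n)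
          ≈⟨ sum-cong-≋ {d} (λ i → solve 4 (λ a l x u → a :* (l :* x) :+ (:- u) :* x := (a :* l :- u) :* x) refl (fromℤ (+ d)) (l i) (α i ^ n) (fromℤ (U 0))) ⟩
        sum (λ i → (fromℤ (+ d) * l i - fromℤ (U 0)) * α i ^ n) ∎

      defect-recurrence : Recurrence d r defect
      defect-recurrence = recurrence defect (λ i → fromℤ (+ d) * l i - fromℤ (U 0)) defect≈

      defect≡0⇒constant : 1 ≤ d → (∀ m → m < d → defect m ≡ + 0) → ∀ i j → l i ≈ l j
      defect≡0⇒constant 1≤d defect≡0 i j = begin
        l i                  ≈⟨ solve 2 (λ x y → x := x :- y :+ y) refl (l i) (l j) ⟩
        l i - l j + l j      ≈⟨ +-congʳ (cancel (d · 1#) _ (·1≉0 d {{ℕ.>-nonZero 1≤d}}) (begin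
          fromℤ (+ d) * (l i - l j)
            ≈⟨ solve 4 (λ a x y u → a :* (x :- y) := (a :* x :- u) :- (a :* y :- u)) refl (fromℤ (+ d)) (l i) (l j) (fromℤ (U 0)) ⟩
          (fromℤ (+ d) * l i - fromℤ (U 0)) - (fromℤ (+ d) * l j - fromℤ (U 0))
            ≈⟨ +-cong (vanish i) (-‿cong (vanish j)) ⟩
          0# - 0#
            ≈⟨ -‿inverseʳ 0# ⟩
          0# ∎)) ⟩
        0# + l j             ≈⟨ +-identityˡ _ ⟩
        l j                  ∎
        where
        vanish : ∀ i → fromℤ (+ d) * l i - fromℤ (U 0) ≈ 0#
        vanish = vandermonde d α distinct _ (λ m m<d → trans (sym (defect≈ m)) (reflexive (cong fromℤ (defect≡0 m m<d))))

-- Comparison of U with the traces at large primes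

traces-congruence : ∀ {d p} (r : Fin d → ℤ) → Prime p → ∀ m → 1 ≤ m → m < p →
  + p ∣ℤ.∣ traces r (m ℕ.* p) ℤ.- traces r m
traces-congruence r pr = dold⇒prime-congruence {A = traces r} pr (λ n n≢0 → ∣ℤ.∣⇒∣ᵤ (traces-dold r n n≢0))

theorem5 : {c ℓ : Level} (d : ℕ) → 1 ≤ d → (r : Fin d → ℤ) → (U : ℕ → ℤ) →
    Recurrence d r U →
    (∀ N → Σ ℕ λ p → N < p × Prime p × IrreducibleModP p (charPoly d r)) →
    (K : Field c ℓ) → FieldOps.CharZero K →
    (α : Fin d → Field.Carrier K) →
    (∀ i j → Field._≈_ K (α i) (α j) → i ≡ j) →
    (∀ i → FieldOps.IsRootOfChar K d r (α i)) →
    (l : Fin d → Field.Carrier K) →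
    (∀ n → Field._≈_ K (FieldOps.fromℤ K (U n))
    (FieldOps.sumFin K (λ i → Field._*_ K (l i) (FieldOps._^_ K (α i) n)))) →
    AlmostDold U ⇔ (∀ i j → Field._≈_ K (l i) (l j))
theorem5 d@(suc d′) 1≤d r U _ primes K charZero α distinct roots l U≈ =
  mk⇔ (λ almost → defect≡0⇒constant 1≤d (defect≡0 almost)) (constant⇒almostDold 1≤d)
  where
  module K = Field K
  open OverField K charZero using (fromℤ≡; ^≡; sumFin≈sum; module Roots)
  open IntegerCoefficients K.commutativeRing using (fromℤ)
  open import Algebra.Properties.Semiring.Exp K.semiring using (_^_)
  open import Algebra.Properties.Semiring.Sum K.semiring using (sum)

  U≈sum : ∀ n → fromℤ (U n) K.≈ sum (λ i → l i K.* α i ^ n)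
  U≈sum n = K.trans (K.reflexive (≡.sym (fromℤ≡ (U n)))) (K.trans (U≈ n)
    (sumFin≈sum {d} (λ i → K.*-congˡ {l i} (K.reflexive (^≡ (α i) n)))))

  open Roots r α distinct roots using (traces-recurrence; module Solution)
  open Solution U l U≈sum
    using (constant⇒almostDold; defect; defect₀; defect-recurrence; defect≡0⇒constant)

  defect-congruence : ∀ {p c} → Prime p → 1 ≤ c → c < p → Dold (λ n → + c ℤ.* U n) →
    ∀ m → 1 ≤ m → m < p → + p ∣ℤ.∣ defect (m ℕ.* p) ℤ.- defect m
  defect-congruence {p} pr 1≤c c<p dold m 1≤m m<p = subst (+ p ∣ℤ.∣_)
    (S.solve 6 (λ d u v t x y → d S.:* (x S.:- y) S.:- t S.:* (u S.:- v) S.:=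
        (d S.:* x S.:- t S.:* u) S.:- (d S.:* y S.:- t S.:* v)) ≡.refl
      (+ d) (traces r (m ℕ.* p)) (traces r m) (U 0) (U (m ℕ.* p)) (U m))
    (∣ℤ.∣m∣n⇒∣m-n (∣ℤ.∣n⇒∣m*n (+ d) (almostDold⇒prime-congruence U pr 1≤c c<p dold m 1≤m m<p))
      (∣ℤ.∣n⇒∣m*n (U 0) (traces-congruence r pr m 1≤m m<p)))
    where module S = +-*-Solver

  defect≡0 : AlmostDold U → ∀ m → m < d → defect m ≡ + 0
  defect≡0 _                zero    _         = defect₀
  defect≡0 (c , 1≤c , dold) (suc m) (s≤s m<d′)
    -- The prime may depend on m. It exceeds c, so that c cancels; it exceeds d, so that d is
    -- invertible and all exponents below d are covered by the congruences; and it exceeds the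
    -- absolute value of the defect, so that divisibility by p forces 0.
    with primes (c ℕ.+ d ℕ.+ ℤ.∣ defect (suc m) ∣)
  ... | p , N<p , pr , irr = ∣-<⇒≡0 (ℕP.≤-<-trans (ℕP.m≤n+m _ (c ℕ.+ d)) N<p)
    (subst (λ k → + p ∣ℤ.∣ defect (suc k)) (FinP.toℕ-fromℕ< m<d′)
      (ModPrime.≈0⇒∣ pr (Residues.w≈0 d′ r pr irr d<p traces-recurrence ≡.refl defect-recurrence defect₀
        (traces-congruence r pr) (defect-congruence pr 1≤c c<p dold) (Fin.fromℕ< m<d′))))
    where
    c+d<p = ℕP.≤-<-trans (ℕP.m≤m+n (c ℕ.+ d) _) N<p
    c<p = ℕP.≤-<-trans (ℕP.m≤m+n c d) c+d<p
    d<p = ℕP.≤-<-trans (ℕP.m≤n+m d c) c+d<p
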